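{- Let $K\subset L'\subset M'$ be finite extensions. Let $M'/K$ be obtained by general normal magnification from $M/K$ through $J'/K$ and let $L'/K$ be obtained by general normal magnification from $L/K$ through $J/K$, where $L\subset M$ and $J\subset J'$. Then (1) $\rho_K(M',L')=\rho_K(M,L)\cdot\rho_K(J',J)$ and $\lambda_K(M',L')=\lambda_K(M,L)\cdot\lambda_K(J',J)$. (2) $\tau_K(M',L')=\tau_K(M,L)\cdot\tau_K(J',J)$ and $\alpha_K(M',L')=\alpha_K(M,L)\cdot\alpha_K(J',J)$. (3) $\gamma_K(M',L')=\gamma_K(M,L)\cdot\gamma_K(J',J)$, $\Gamma_K(M',L')=\Gamma_K(M,L)\cdot\Gamma_K(J',J)$ and $\iota_K(M',L')=\iota_K(M,L)\cdot\iota_K(J',J)$.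
   Context: $K$ is any field (not necessarily perfect) with a fixed algebraic closure $\bar K$; all extensions are finite and contained in $\bar K$. A tilde denotes normal closure over $K$ in $\bar K$; for an extension $E/K$, $E_S$ and $E_I$ denote its maximal separable and maximal purely inseparable subextensions. A finite extension $M/K$ is obtained by general normal magnification from a subextension $L/K$ through a finite extension $J/K$ if $[L:K]>1$, $\tilde L$ and $\tilde J$ are linearly disjoint over $K$, and $LJ=M$. For extensions $E/K$ and $T/K$, let $E_1,\dots,E_a$ be all the distinct subfields of $T$ isomorphic to $E$ over $K$. Let $r_K(E)=|\mathrm{Aut}(E/K)|$ and $l_K(E)=[E:E_S]\cdot r_K(E)$. Define: root capacity $\rho_K(T,E)=a\cdot r_K(E)$; multiroot capacity $\lambda_K(T,E)=a\cdot l_K(E)$; intersection indicium $\tau_K(T,E)=[\bigcap_i (E_i)_S:K]$; intersection normal indicium $\alpha_K(T,E)=[\bigcap_i E_i:K]$; compositum indicium $\gamma_K(T,E)=[\prod_i (E_i)_S:K]$; compositum normal indicium $\Gamma_K(T,E)=[\prod_i E_i:K]$; $\iota_K(T,E)=[(\prod_i E_i)_I:K]$ ($\prod$ is the compositum of fields). If $a=0$, the quantities $\tau,\alpha,\gamma,\Gamma,\iota$ are defined to be $0$. -}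

module Defs where

open import Algebra.Apartness.Bundles using (HeytingField; HeytingCommutativeRing)
open import Algebra.Bundles using (CommutativeRing; RawRing; Semiring)
import Algebra.Definitions.RawSemiring as RawSemiringDefs
open import Algebra.Morphism.Structures using (module RingMorphisms)
open import Axiom.ExcludedMiddle using (ExcludedMiddle)
open import Data.Fin.Base using (Fin)
open import Data.List.Base as List using (List; []; _∷_)
open import Data.List.Relation.Unary.All using (All)
open import Data.Nat.Base as ℕ using (ℕ; zero; suc)
open import Data.Nat.Primality using (Prime)
open import Data.Product.Base using (Σ; Σ-syntax; ∃; ∃-syntax; _×_; _,_; proj₁)
open import Data.Sum.Base using (_⊎_)
open import Data.Vec.Functional using (Vector)
open import Function.Base using (_∘_; _on_)
open import Function.Bundles using (Inverse)
open import Level using (Level; _⊔_) renaming (suc to lsuc)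
open import Relation.Binary.Bundles using (Setoid)
open import Relation.Binary.Definitions using (_Respects_)
import Relation.Binary.PropositionalEquality as ≡
open import Relation.Nullary.Decidable.Core using (yes; no)
open import Relation.Nullary.Negation using (¬_)
open import Relation.Unary using (Pred; _∈_; _⊆_; _≐_; _∪_)
open import Relation.Unary.Properties using (≐-refl; ≐-sym; ≐-trans)

-- Everything takes place inside one ambient field K̄, in which every field is
-- a subset.  A HeytingField is the library's notion of field; in the presence
-- of `em` its apartness relation is forced to be the negation of equality.
-- `em` makes degrees and cardinalities total ℕ-valued functions; where the
-- object being measured or chosen does not exist, a dummy value is returned.

module Extensions
  (em : ∀ {a : Level} → ExcludedMiddle a)
  {c ℓ₁ ℓ₂ : Level} (K̄ : HeytingField c ℓ₁ ℓ₂)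
  where

  open HeytingField K̄ using (heytingCommutativeRing)
  open CommutativeRing
    (HeytingCommutativeRing.commutativeRing heytingCommutativeRing)
    using (Carrier; _≈_; _+_; _*_; -_; 0#; 1#; semiring)
    renaming (refl to ≈-refl; sym to ≈-sym; trans to ≈-trans)
  open RawSemiringDefs (Semiring.rawSemiring semiring) using (sum; _^_) renaming (_×_ to _·_)

  private
    p : Level
    p = c ⊔ ℓ₁

  record Subfield : Set (lsuc p) where
    field
      mem       : Pred Carrier p
      resp      : mem Respects _≈_
      0#-closed : 0# ∈ mem
      1#-closed : 1# ∈ mem
      +-closed  : ∀ {x y} → x ∈ mem → y ∈ mem → x + y ∈ mem
      *-closed  : ∀ {x y} → x ∈ mem → y ∈ mem → x * y ∈ mem
      neg-closed : ∀ {x} → x ∈ mem → - x ∈ mem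
      inv-closed : ∀ {x y} → x ∈ mem → x * y ≈ 1# → y ∈ mem

    El : Set p
    El = Σ Carrier mem

    rawRing : RawRing p ℓ₁
    rawRing = record
      { Carrier = El
      ; _≈_     = _≈_ on proj₁
      ; _+_     = λ (x , x∈) (y , y∈) → x + y , +-closed x∈ y∈
      ; _*_     = λ (x , x∈) (y , y∈) → x * y , *-closed x∈ y∈
      ; -_      = λ (x , x∈) → - x , neg-closed x∈
      ; 0#      = 0# , 0#-closed
      ; 1#      = 1# , 1#-closed
      }

  open Subfield using (mem; El; rawRing)

  infix 4 _∈ᶠ_ _⊑_ _≑_

  _∈ᶠ_ : Carrier → Subfield → Set p
  x ∈ᶠ F = x ∈ mem F

  _⊑_ : Subfield → Subfield → Set p
  E ⊑ F = mem E ⊆ mem F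

  _≑_ : Subfield → Subfield → Set p
  E ≑ F = mem E ≐ mem F

  data Closure (S : Pred Carrier p) : Pred Carrier p where
    incl  : S ⊆ Closure S
    resp  : (Closure S) Respects _≈_
    zero∈ : 0# ∈ Closure S
    one∈  : 1# ∈ Closure S
    add∈  : ∀ {x y} → x ∈ Closure S → y ∈ Closure S → x + y ∈ Closure S
    mul∈  : ∀ {x y} → x ∈ Closure S → y ∈ Closure S → x * y ∈ Closure S
    neg∈  : ∀ {x} → x ∈ Closure S → - x ∈ Closure S
    inv∈  : ∀ {x y} → x ∈ Closure S → x * y ≈ 1# → y ∈ Closure S

  generated : Pred Carrier p → Subfield
  generated S = record
    { mem = Closure S ; resp = resp ; 0#-closed = zero∈ ; 1#-closed = one∈
    ; +-closed = add∈ ; *-closed = mul∈ ; neg-closed = neg∈ ; inv-closed = inv∈ }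

  compositum : Subfield → Subfield → Subfield
  compositum E F = generated (mem E ∪ mem F)

  ∏ : ∀ {n} → (Fin n → Subfield) → Subfield
  ∏ Es = generated (λ x → ∃[ i ] x ∈ᶠ Es i)

  ⋂ : ∀ {n} → (Fin n → Subfield) → Subfield
  ⋂ Es = record
    { mem        = λ x → ∀ i → x ∈ᶠ Es i
    ; resp       = λ x≈y x∈ i → S.resp (Es i) x≈y (x∈ i)
    ; 0#-closed  = λ i → S.0#-closed (Es i)
    ; 1#-closed  = λ i → S.1#-closed (Es i)
    ; +-closed   = λ x∈ y∈ i → S.+-closed (Es i) (x∈ i) (y∈ i)
    ; *-closed   = λ x∈ y∈ i → S.*-closed (Es i) (x∈ i) (y∈ i)
    ; neg-closed = λ x∈ i → S.neg-closed (Es i) (x∈ i)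
    ; inv-closed = λ x∈ xy≈1 i → S.inv-closed (Es i) (x∈ i) xy≈1
    }
    where module S = Subfield

  LinearlyIndependent : Subfield → ∀ {n} → Vector Carrier n → Set p
  LinearlyIndependent F {n} v =
    (a : Vector Carrier n) → (∀ i → a i ∈ᶠ F) →
    sum (λ i → a i * v i) ≈ 0# → ∀ i → a i ≈ 0#

  record Basis (F E : Subfield) (n : ℕ) : Set p where
    field
      vec         : Vector Carrier n
      vec∈        : ∀ i → vec i ∈ᶠ E
      independent : LinearlyIndependent F vec
      spans       : ∀ {x} → x ∈ᶠ E →
                    Σ[ a ∈ Vector Carrier n ]
                      (∀ i → a i ∈ᶠ F) × x ≈ sum (λ i → a i * vec i)

  FiniteExtension : Subfield → Subfield → Set p
  FiniteExtension K E = K ⊑ E × ∃ (Basis K E)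

  -- degree F E is [E : F], and 0 if there is no finite basis.
  degree : Subfield → Subfield → ℕ
  degree F E with em {P = ∃ (Basis F E)}
  ... | yes (n , _) = n
  ... | no  _       = 0

  LinearlyDisjoint : (K E F : Subfield) → Set p
  LinearlyDisjoint K E F =
    ∀ {n} (v : Vector Carrier n) → (∀ i → v i ∈ᶠ E) →
    LinearlyIndependent K v → LinearlyIndependent F v

  -- Polynomials over K̄, as coefficient lists with the constant term first;
  -- trailing zeros are allowed, so equality is coefficientwise.

  Poly : Set c
  Poly = List Carrier

  coeff : Poly → ℕ → Carrier
  coeff []      _       = 0#
  coeff (a ∷ f) zero    = a
  coeff (a ∷ f) (suc n) = coeff f n

  infix 4 _≋_
  _≋_ : Poly → Poly → Set ℓ₁
  f ≋ g = ∀ n → coeff f n ≈ coeff g n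

  eval : Poly → Carrier → Carrier
  eval []      x = 0#
  eval (a ∷ f) x = a + x * eval f x

  infixl 6 _+ₚ_
  infixl 7 _*ₚ_

  _+ₚ_ : Poly → Poly → Poly
  []      +ₚ g       = g
  (a ∷ f) +ₚ []      = a ∷ f
  (a ∷ f) +ₚ (b ∷ g) = a + b ∷ f +ₚ g

  _*ₚ_ : Poly → Poly → Poly
  []      *ₚ g = []
  (a ∷ f) *ₚ g = List.map (a *_) g +ₚ (0# ∷ f *ₚ g)

  X-_ : Carrier → Poly
  X- a = - a ∷ 1# ∷ []

  DegreeIs : Poly → ℕ → Set ℓ₁
  DegreeIs f n = ¬ (coeff f n ≈ 0#) × (∀ m → n ℕ.< m → coeff f m ≈ 0#)

  Over : Subfield → Poly → Set p
  Over F f = All (_∈ᶠ F) f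

  SplitsOver : Subfield → Poly → Set p
  SplitsOver F f = ∃[ a ] ∃[ roots ] a ∈ᶠ F × All (_∈ᶠ F) roots ×
    f ≋ (a ∷ []) *ₚ List.foldr _*ₚ_ (1# ∷ []) (List.map X-_ roots)

  record MinimalPolynomial (K : Subfield) (x : Carrier) (f : Poly) : Set p where
    field
      over    : Over K f
      deg     : ℕ
      hasDeg  : DegreeIs f deg
      monic   : coeff f deg ≈ 1#
      root    : eval f x ≈ 0#
      minimal : ∀ {g m} → Over K g → DegreeIs g m → eval g x ≈ 0# → deg ℕ.≤ m

  record IsAlgebraicClosure (K : Subfield) : Set p where
    field
      algebraicallyClosed : ∀ f n → DegreeIs f (suc n) → ∃[ x ] eval f x ≈ 0#
      algebraic           : ∀ x → ∃[ f ] ∃[ n ]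
                              Over K f × DegreeIs f n × eval f x ≈ 0#

  Normal : (K N : Subfield) → Set p
  Normal K N = K ⊑ N ×
    (∀ {x f} → x ∈ᶠ N → MinimalPolynomial K x f → SplitsOver N f)

  record NormalClosure (K E N : Subfield) : Set (lsuc p) where
    field
      contains : E ⊑ N
      normal   : Normal K N
      smallest : ∀ N′ → E ⊑ N′ → Normal K N′ → N ⊑ N′

  HasMultipleRoot : Poly → Set p
  HasMultipleRoot f = ∃[ a ] ∃[ g ] f ≋ (X- a) *ₚ (X- a) *ₚ g

  Separable : Subfield → Pred Carrier p
  Separable K x = ∃[ f ] MinimalPolynomial K x f × ¬ HasMultipleRoot f

  -- In characteristic zero only the first alternative can occur.
  PurelyInseparable : Subfield → Pred Carrier p
  PurelyInseparable K x = x ∈ᶠ K ⊎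
    (∃[ q ] ∃[ n ] Prime q × q · 1# ≈ 0# × x ^ (q ℕ.^ n) ∈ᶠ K)

  record LargestSubextension
      (K : Subfield) (P : Pred Carrier p) (E F : Subfield) : Set (lsuc p) where
    field
      above   : K ⊑ F
      below   : F ⊑ E
      all     : mem F ⊆ P
      largest : ∀ F′ → K ⊑ F′ → F′ ⊑ E → mem F′ ⊆ P → F′ ⊑ F

  -- Dummy value K if there is no largest such subextension.
  largestSubextension : Subfield → Pred Carrier p → Subfield → Subfield
  largestSubextension K P E with em {P = ∃ (LargestSubextension K P E)}
  ... | yes (F , _) = F
  ... | no  _       = K

  -- sep K E and insep K E are E_S and E_I.
  sep insep : (K E : Subfield) → Subfield
  sep   K = largestSubextension K (Separable K)
  insep K = largestSubextension K (PurelyInseparable K)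

  record _≅[_]_ (E K F : Subfield) : Set p where
    open RingMorphisms (rawRing E) (rawRing F) using (IsRingIsomorphism)
    field
      to    : El E → El F
      isIso : IsRingIsomorphism to
      fixes : ∀ x → proj₁ x ∈ᶠ K → proj₁ (to x) ≈ proj₁ x

  open _≅[_]_ using (to)

  Aut : (E K : Subfield) → Setoid p p
  Aut E K = record
    { Carrier       = E ≅[ K ] E
    ; _≈_           = λ σ τ → ∀ x → proj₁ (to σ x) ≈ proj₁ (to τ x)
    ; isEquivalence = record
      { refl  = λ x → ≈-refl
      ; sym   = λ eq x → ≈-sym (eq x)
      ; trans = λ eq eq′ x → ≈-trans (eq x) (eq′ x)
      }
    }

  Copies : (K T E : Subfield) → Setoid (lsuc p) p
  Copies K T E = record
    { Carrier       = Σ[ F ∈ Subfield ] F ⊑ T × E ≅[ K ] F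
    ; _≈_           = _≑_ on proj₁
    ; isEquivalence = record { refl = ≐-refl ; sym = ≐-sym ; trans = ≐-trans }
    }

  -- A repetition-free list of all elements of S; the empty list if S is
  -- not finite.
  enumerate : ∀ {a b} (S : Setoid a b) → Σ[ n ∈ ℕ ] (Fin n → Setoid.Carrier S)
  enumerate S with em {P = ∃[ n ] Inverse (≡.setoid (Fin n)) S}
  ... | yes (n , inv) = n , Inverse.to inv
  ... | no  _         = 0 , λ ()

  copies : (K T E : Subfield) → Σ[ n ∈ ℕ ] (Fin n → Subfield)
  copies K T E with enumerate (Copies K T E)
  ... | n , Es = n , proj₁ ∘ Es

  -- Λ is the multiroot capacity λ_K(T, E), λ being a reserved word.
  r l : (K E : Subfield) → ℕ
  r K E = proj₁ (enumerate (Aut E K))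
  l K E = degree (sep K E) E ℕ.* r K E

  ρ Λ : (K T E : Subfield) → ℕ
  ρ K T E = proj₁ (copies K T E) ℕ.* r K E
  Λ K T E = proj₁ (copies K T E) ℕ.* l K E

  indicium : (∀ {n} → (Fin n → Subfield) → Subfield) → (K T E : Subfield) → ℕ
  indicium op K T E with copies K T E
  ... | zero  , _  = 0
  ... | suc n , Es = degree K (op Es)

  τ α γ Γ ι : (K T E : Subfield) → ℕ
  τ K = indicium (λ Es → ⋂ (sep K ∘ Es)) K
  α K = indicium ⋂ K
  γ K = indicium (λ Es → ∏ (sep K ∘ Es)) K
  Γ K = indicium ∏ K
  ι K = indicium (λ Es → insep K (∏ Es)) K

  record GeneralNormalMagnification (K M L J : Subfield) : Set (lsuc p) where
    field
      finite-M   : FiniteExtension K M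
      finite-J   : FiniteExtension K J
      K⊑L        : K ⊑ L
      L⊑M        : L ⊑ M
      nontrivial : 1 ℕ.< degree K L
      L~ J~      : Subfield
      closure-L  : NormalClosure K L L~
      closure-J  : NormalClosure K J J~
      disjoint   : LinearlyDisjoint K L~ J~
      generates  : compositum L J ≑ M

module Submission where

-- Let N and N′ be the normal closures of M and J′.  They are linearly disjoint, so coefficients
-- with respect to a K-basis inside N′ are unique over N, and the coefficients of an element of
-- F F′ (F ⊆ N, F′ ⊆ N′) lie in F.  Hence the intersection of composita A_i B_j is (⋂ A_i)(⋂ B_j);
-- in particular M′ ∩ N = M and M′ ∩ N′ = J′.  A K-embedding of L′ = L J into M′ = M J′ maps L into
-- N and J into N′, thus L into M and J into J′, and conversely any two embeddings glue; so the
-- copies of L′ in M′ are the composita of a copy of L in M and a copy of J in J′, and degrees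
-- multiply.  It remains to see that E ↦ E_S and E ↦ E_I commute with composita.  In characteristic
-- q one has E_S = K E^(q^n) for large n, which is visibly multiplicative.  Moreover every
-- y ∈ N lies in N_I[y^q], so P Q ⊆ N_I N′_I E_S for E = P Q; since E_S is linearly disjoint from
-- the perfect closure of K, this forces E_I ⊆ N_I N′_I, and intersecting gives E_I = P_I Q_I.

-- The detour through `N_I N′_I` is forced: a finite extension `E` need not be separable over `E_I`,
-- so `y ∈ E_I[y^q]` may fail for `y` in `E`. It holds in a normal extension, where the minimal
-- polynomial of `y^q` over `N_I` is pulled back along Frobenius to a polynomial with coefficients
-- in `N`, because all its roots are conjugates of `y`. That `K E^(q^n)` equals `E_S` for large `n`
-- rests on a dimension count: the degrees over `K` decrease, and once two consecutive ones agree,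
-- Frobenius carries `K`-independent families to `K`-independent families. By Mac Lane's criterion
-- this is separability; iterated, it also gives disjointness from the perfect closure, since high
-- powers of the coefficients of a relation lie in `K`. The existence of a largest separable
-- subextension is a by-product. In characteristic zero `E_S = E` and `E_I = K`.

open import Defs
open import Algebra.Apartness.Bundles using (HeytingField; HeytingCommutativeRing)
open import Algebra.Bundles using (CommutativeRing)
open import Algebra.Morphism.Structures using (module RingMorphisms)
import Algebra.Properties.CommutativeSemiring.Binomial as Binomial
import Algebra.Properties.CommutativeSemiring.Exp as SemiringExp
import Algebra.Properties.Ring as RingProperties
import Algebra.Properties.Semiring.Mult as SemiringMult
import Algebra.Properties.Semiring.Mult.TCOptimised as SemiringMultTC
import Algebra.Properties.Semiring.Sum as SemiringSum
import Algebra.Solver.Ring as RingSolver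
open import Algebra.Solver.Ring.AlmostCommutativeRing
  using (fromCommutativeRing; Induced-equivalence; _-Raw-AlmostCommutative⟶_)
open import Axiom.ExcludedMiddle using (ExcludedMiddle)
open import Data.Fin.Base as Fin using (Fin; zero; suc; _↑ˡ_; _↑ʳ_; splitAt; toℕ)
import Data.Fin.Properties as Fin
open import Data.Integer.Base as ℤ using (ℤ; +_; -[1+_])
import Data.Integer.Properties as ℤ
open import Data.List.Base as List using (List; []; _∷_)
open import Data.List.Relation.Unary.All as All using (All; []; _∷_)
import Data.List.Relation.Unary.All.Properties as All
open import Data.Maybe.Base using (just; nothing)
open import Data.Nat.Base as ℕ using (ℕ; zero; suc; z≤n; s≤s)
open import Data.Nat.Combinatorics using (_C_; nC1≡n; nCn≡1; k>n⇒nCk≡0; nCk+nC[k+1]≡[n+1]C[k+1])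
open import Data.Nat.Coprimality using (Coprime; coprime-Bézout; prime⇒coprime)
open import Data.Nat.Divisibility using (_∣_; divides; ∣⇒≤)
open import Data.Nat.GCD using (module Bézout)
open import Data.Nat.ListAction using (product)
open import Data.Nat.Primality using (Prime; euclidsLemma; prime⇒nonZero)
open import Data.Nat.Primality.Factorisation using (factorise; module PrimeFactorisation)
import Data.Nat.Properties as ℕ
open import Data.Product.Base using (Σ; Σ-syntax; ∃; ∃-syntax; _×_; _,_; proj₁; proj₂; map₂)
open import Data.Sum.Base using (_⊎_; inj₁; inj₂; [_,_]′)
open import Data.Unit.Polymorphic.Base using (⊤; tt)
import Data.Vec.Functional as Vector
open import Data.Vec.Functional using (Vector)
import Data.Vec.Functional.Properties as Vector
open import Function.Base using (_∘_; id; case_of_)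
open import Function.Bundles using (Inverse)
open import Level using (Level; _⊔_; Lift; lift) renaming (suc to lsuc)
open import Relation.Binary.Bundles using (Setoid)
open import Relation.Binary.Definitions using (_Respects_; WeaklyDecidable; tri<; tri≈; tri>)
import Relation.Binary.PropositionalEquality as ≡
open ≡ using (_≡_)
import Relation.Binary.Reasoning.Setoid as SetoidReasoning
open import Relation.Nullary.Decidable.Core using (Dec; yes; no; decidable-stable)
open import Relation.Nullary.Negation using (¬_; contradiction)
open import Relation.Unary using (Pred; _∈_; _⊆_)
open import Relation.Unary.Properties using (≐-refl; ≐-sym; ≐-trans)

private
  module ≡R = ≡.≡-Reasoning

-- Ring solver with integer coefficients: cancellation is only detected when
-- equality of coefficients is decided by computation, which it is not in R.
module IntegerCoefficients {c ℓ} (R : CommutativeRing c ℓ) where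
  open CommutativeRing R
  open SemiringMultTC semiring using (1+×; ×-homo-+; ×1-homo-*) renaming (_×_ to _·_)
  open RingProperties ring
  open SetoidReasoning setoid

  fromℤ : ℤ → Carrier
  fromℤ (+ n)    = n · 1#
  fromℤ -[1+ n ] = - (suc n · 1#)

  fromℤ-⊖ : ∀ m n → fromℤ (m ℤ.⊖ n) ≈ m · 1# - n · 1#
  fromℤ-⊖ m zero = sym (trans (+-congˡ -0#≈0#) (+-identityʳ _))
  fromℤ-⊖ zero (suc n) = sym (+-identityˡ _)
  fromℤ-⊖ (suc m) (suc n) = begin
    fromℤ (suc m ℤ.⊖ suc n)               ≡⟨ ≡.cong fromℤ (ℤ.[1+m]⊖[1+n]≡m⊖n m n) ⟩
    fromℤ (m ℤ.⊖ n)                       ≈⟨ fromℤ-⊖ m n ⟩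
    m · 1# - n · 1#                       ≈⟨ +-congʳ (xyx⁻¹≈y 1# _) ⟨
    1# + m · 1# - 1# - n · 1#             ≈⟨ +-assoc _ _ _ ⟩
    1# + m · 1# + (- 1# - n · 1#)         ≈⟨ +-congˡ (-‿+-comm _ _) ⟩
    1# + m · 1# - (1# + n · 1#)           ≈⟨ +-cong (1+× m 1#) (-‿cong (1+× n 1#)) ⟨
    suc m · 1# - suc n · 1#               ∎

  fromℤ-neg : ∀ i → fromℤ (ℤ.- i) ≈ - fromℤ i
  fromℤ-neg (+ zero)  = sym -0#≈0#
  fromℤ-neg (+ suc n) = refl
  fromℤ-neg -[1+ n ]  = sym (-‿involutive _)

  fromℤ-+ : ∀ i j → fromℤ (i ℤ.+ j) ≈ fromℤ i + fromℤ j
  fromℤ-+ (+ m)    (+ n)    = ×-homo-+ 1# m n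
  fromℤ-+ (+ m)    -[1+ n ] = fromℤ-⊖ m (suc n)
  fromℤ-+ -[1+ m ] (+ n)    = trans (fromℤ-⊖ n (suc m)) (+-comm _ _)
  fromℤ-+ -[1+ m ] -[1+ n ] = begin
    - (suc (suc (m ℕ.+ n)) · 1#)    ≡⟨ ≡.cong (λ k → - (suc k · 1#)) (ℕ.+-suc m n) ⟨
    - ((suc m ℕ.+ suc n) · 1#)      ≈⟨ -‿cong (×-homo-+ 1# (suc m) (suc n)) ⟩
    - (suc m · 1# + suc n · 1#)     ≈⟨ -‿+-comm _ _ ⟨
    - (suc m · 1#) - suc n · 1#     ∎

  fromℤ-+*+ : ∀ m n → fromℤ (+ m ℤ.* + n) ≈ (m · 1#) * (n · 1#)
  fromℤ-+*+ m n = begin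
    fromℤ (+ m ℤ.* + n)  ≡⟨ ≡.cong fromℤ (ℤ.pos-* m n) ⟨
    (m ℕ.* n) · 1#       ≈⟨ ×1-homo-* m n ⟩
    (m · 1#) * (n · 1#)  ∎

  fromℤ-* : ∀ i j → fromℤ (i ℤ.* j) ≈ fromℤ i * fromℤ j
  fromℤ-* (+ m)    (+ n)    = fromℤ-+*+ m n
  fromℤ-* (+ m)    -[1+ n ] = begin
    fromℤ (+ m ℤ.* -[1+ n ])       ≡⟨ ≡.cong fromℤ (ℤ.neg-distribʳ-* (+ m) (+ suc n)) ⟨
    fromℤ (ℤ.- (+ m ℤ.* + suc n))  ≈⟨ fromℤ-neg (+ m ℤ.* + suc n) ⟩
    - fromℤ (+ m ℤ.* + suc n)      ≈⟨ -‿cong (fromℤ-+*+ m (suc n)) ⟩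
    - (m · 1# * (suc n · 1#))      ≈⟨ -‿distribʳ-* _ _ ⟩
    m · 1# * - (suc n · 1#)        ∎
  fromℤ-* -[1+ m ] (+ n)    = begin
    fromℤ (-[1+ m ] ℤ.* + n)       ≡⟨ ≡.cong fromℤ (ℤ.neg-distribˡ-* (+ suc m) (+ n)) ⟨
    fromℤ (ℤ.- (+ suc m ℤ.* + n))  ≈⟨ fromℤ-neg (+ suc m ℤ.* + n) ⟩
    - fromℤ (+ suc m ℤ.* + n)      ≈⟨ -‿cong (fromℤ-+*+ (suc m) n) ⟩
    - (suc m · 1# * (n · 1#))      ≈⟨ -‿distribˡ-* _ _ ⟩
    - (suc m · 1#) * (n · 1#)      ∎
  fromℤ-* -[1+ m ] -[1+ n ] = begin
    fromℤ (-[1+ m ] ℤ.* -[1+ n ])         ≡⟨ ≡.cong fromℤ (ℤ.neg-distribˡ-* (+ suc m) -[1+ n ]) ⟨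
    fromℤ (ℤ.- (+ suc m ℤ.* -[1+ n ]))    ≈⟨ fromℤ-neg (+ suc m ℤ.* -[1+ n ]) ⟩
    - fromℤ (+ suc m ℤ.* -[1+ n ])        ≈⟨ -‿cong (fromℤ-* (+ suc m) -[1+ n ]) ⟩
    - (suc m · 1# * - (suc n · 1#))       ≈⟨ -‿distribˡ-* _ _ ⟩
    - (suc m · 1#) * - (suc n · 1#)       ∎

  morphism : ℤ.+-*-rawRing -Raw-AlmostCommutative⟶ fromCommutativeRing R
  morphism = record
    { ⟦_⟧    = fromℤ
    ; +-homo = fromℤ-+
    ; *-homo = fromℤ-*
    ; -‿homo = fromℤ-neg
    ; 0-homo = refl
    ; 1-homo = refl
    }

  _coeff≟_ : WeaklyDecidable (Induced-equivalence morphism)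
  i coeff≟ j with i ℤ.≟ j
  ... | yes i≡j = just (reflexive (≡.cong fromℤ i≡j))
  ... | no  _   = nothing

  open RingSolver ℤ.+-*-rawRing (fromCommutativeRing R) morphism _coeff≟_ public
    using (solve; _:=_; con; _:+_; _:*_; :-_; _:-_)

-- Binomial coefficients

[1+k]*[1+n]C[1+k]≡[1+n]*nCk : ∀ n k → suc k ℕ.* (suc n C suc k) ≡ suc n ℕ.* (n C k)
[1+k]*[1+n]C[1+k]≡[1+n]*nCk zero zero = ≡.refl
[1+k]*[1+n]C[1+k]≡[1+n]*nCk zero (suc k)
  rewrite k>n⇒nCk≡0 {1} {suc (suc k)} (s≤s (s≤s z≤n)) | k>n⇒nCk≡0 {0} {suc k} (s≤s z≤n) = ℕ.*-zeroʳ k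
[1+k]*[1+n]C[1+k]≡[1+n]*nCk (suc n) zero = begin
  1 ℕ.* (suc (suc n) C 1)        ≡⟨ ℕ.*-identityˡ _ ⟩
  suc (suc n) C 1                ≡⟨ nC1≡n (suc (suc n)) ⟩
  suc (suc n)                    ≡⟨ ℕ.*-identityʳ _ ⟨
  suc (suc n) ℕ.* (suc n C 0)    ∎
  where
  open ≡.≡-Reasoning
[1+k]*[1+n]C[1+k]≡[1+n]*nCk (suc n) (suc k) = begin
  suc (suc k) ℕ.* (suc (suc n) C suc (suc k))
    ≡⟨ ≡.cong (suc (suc k) ℕ.*_) (nCk+nC[k+1]≡[n+1]C[k+1] (suc n) (suc k)) ⟨
  suc (suc k) ℕ.* (suc n C suc k ℕ.+ suc n C suc (suc k))
    ≡⟨ ℕ.*-distribˡ-+ (suc (suc k)) (suc n C suc k) _ ⟩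
  suc n C suc k ℕ.+ suc k ℕ.* (suc n C suc k) ℕ.+ suc (suc k) ℕ.* (suc n C suc (suc k))
    ≡⟨ ≡.cong₂ (λ s t → suc n C suc k ℕ.+ s ℕ.+ t) ([1+k]*[1+n]C[1+k]≡[1+n]*nCk n k) ([1+k]*[1+n]C[1+k]≡[1+n]*nCk n (suc k)) ⟩
  suc n C suc k ℕ.+ suc n ℕ.* (n C k) ℕ.+ suc n ℕ.* (n C suc k)
    ≡⟨ ℕ.+-assoc (suc n C suc k) _ _ ⟩
  suc n C suc k ℕ.+ (suc n ℕ.* (n C k) ℕ.+ suc n ℕ.* (n C suc k))
    ≡⟨ ≡.cong (suc n C suc k ℕ.+_) (ℕ.*-distribˡ-+ (suc n) (n C k) _) ⟨
  suc n C suc k ℕ.+ suc n ℕ.* (n C k ℕ.+ n C suc k)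
    ≡⟨ ≡.cong (λ s → suc n C suc k ℕ.+ suc n ℕ.* s) (nCk+nC[k+1]≡[n+1]C[k+1] n k) ⟩
  suc (suc n) ℕ.* (suc n C suc k)  ∎
  where
  open ≡.≡-Reasoning

-- By the absorption identity the prime divides `suc k` times the binomial coefficient, and `suc k`
-- is too small to be a multiple of it.
prime∣binomial : ∀ {n k} → Prime (suc n) → suc k ℕ.< suc n → suc n ∣ (suc n C suc k)
prime∣binomial {n} {k} n-prime k<n with euclidsLemma (suc k) (suc n C suc k) n-prime
  (divides (n C k) (≡.trans ([1+k]*[1+n]C[1+k]≡[1+n]*nCk n k) (ℕ.*-comm (suc n) (n C k))))
... | inj₁ n∣k = contradiction (∣⇒≤ n∣k) (ℕ.<⇒≱ k<n)
... | inj₂ n∣C = n∣C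

module _ (em : ∀ {a : Level} → ExcludedMiddle a) where

  least : ∀ {a} (P : ℕ → Set a) → ∃ P → ∃[ n ] P n × (∀ {m} → P m → n ℕ.≤ m)
  least P (n , Pn) = go n n ℕ.≤-refl Pn
    where
    go : ∀ b n → n ℕ.≤ b → P n → ∃[ n ] P n × (∀ {m} → P m → n ℕ.≤ m)
    go b n n≤b Pn with em {P = ∃[ m ] m ℕ.< n × P m}
    ... | no ∄ = n , Pn , λ {m} Pm → ℕ.≮⇒≥ λ m<n → ∄ (m , m<n , Pm)
    go zero    .zero z≤n Pn | yes (_ , () , _)
    go (suc b) n     n≤b Pn | yes (m , m<n , Pm) = go b m (ℕ.≤-pred (ℕ.≤-trans m<n n≤b)) Pm

-- Enumerations of setoids

module _ {a b} (S : Setoid a b) where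
  open Setoid S renaming (Carrier to A) using (_≈_)

  -- An `Inverse` reduced to what has to be checked by hand: the map back is read off `covers`, and
  -- `distinct` makes it respect equality.
  record IsEnumeration (e : Σ[ n ∈ ℕ ] (Fin n → A)) : Set (a ⊔ b) where
    field
      distinct : ∀ {i j} → proj₂ e i ≈ proj₂ e j → i ≡ j
      covers   : ∀ x → ∃[ i ] proj₂ e i ≈ x

module _ {a b} {S : Setoid a b} where
  open Setoid S renaming (Carrier to A)

  inverse⇒enumeration : ∀ {n} (inv : Inverse (≡.setoid (Fin n)) S) → IsEnumeration S (n , Inverse.to inv)
  inverse⇒enumeration inv = record
    { distinct = λ {i} {j} eq → ≡.trans (≡.sym (strictlyInverseʳ i)) (≡.trans (from-cong eq) (strictlyInverseʳ j))
    ; covers   = λ x → from x , strictlyInverseˡ x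
    }
    where
    open Inverse inv

  enumeration⇒inverse : ∀ {e} → IsEnumeration S e → Inverse (≡.setoid (Fin (proj₁ e))) S
  enumeration⇒inverse {n , e} enum = record
    { to        = e
    ; from      = proj₁ ∘ covers
    ; to-cong   = λ { ≡.refl → refl }
    ; from-cong = λ {x} {y} x≈y → distinct (trans (proj₂ (covers x)) (trans x≈y (sym (proj₂ (covers y)))))
    ; inverse   = (λ { {x} ≡.refl → proj₂ (covers x) }) , (λ {i} {x} x≈ei → distinct (trans (proj₂ (covers x)) x≈ei))
    }
    where
    open IsEnumeration enum

  size-≤ : ∀ {e f} → IsEnumeration S e → IsEnumeration S f → proj₁ e ℕ.≤ proj₁ f
  size-≤ {m , e} {n , f} E F = Fin.injective⇒≤ {f = λ i → proj₁ (F.covers (e i))} λ {i} {j} eq →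
    E.distinct (trans (sym (proj₂ (F.covers (e i)))) (trans (reflexive (≡.cong f eq)) (proj₂ (F.covers (e j)))))
    where
    module E = IsEnumeration E
    module F = IsEnumeration F

  size-unique : ∀ {e f} → IsEnumeration S e → IsEnumeration S f → proj₁ e ≡ proj₁ f
  size-unique E F = ℕ.≤-antisym (size-≤ E F) (size-≤ F E)

module _ (em : ∀ {a : Level} → ExcludedMiddle a) where

  -- Induction on `n`. Elements of nonzero index are enumerated after `punchOut`; those of index
  -- zero form at most one class, and excluded middle decides whether there is one.
  index⇒enumeration : ∀ {a b} n (S : Setoid a b) → let open Setoid S in (h : Carrier → Fin n) →
                      (∀ {x y} → x ≈ y → h x ≡ h y) → (∀ {x y} → h x ≡ h y → x ≈ y) → ∃ (IsEnumeration S)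
  index⇒enumeration zero S h _ _ = (0 , λ ()) , record { distinct = λ { {()} } ; covers = λ x → case h x of λ () }
  index⇒enumeration {a} {b} (suc n) S h h-cong h-inj = go (index⇒enumeration n S′ h′
      (λ {x} {y} eq → Fin.punchOut-cong zero {i≢j = proj₂ x} {proj₂ y} (h-cong eq))
      (λ {x} {y} eq → h-inj (Fin.punchOut-injective (proj₂ x) (proj₂ y) eq))) em
    where
    open Setoid S renaming (Carrier to A)
    S′ : Setoid a b
    S′ = record
      { Carrier = Σ[ x ∈ A ] ¬ zero ≡ h x ; _≈_ = λ x y → proj₁ x ≈ proj₁ y
      ; isEquivalence = record { refl = refl ; sym = sym ; trans = trans } }
    h′ : Setoid.Carrier S′ → Fin n
    h′ (x , h≢0) = Fin.punchOut h≢0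
    go : ∃ (IsEnumeration S′) → Dec (∃[ x ] zero ≡ h x) → ∃ (IsEnumeration S)
    go ((m , e) , E) (no ∄) = (m , proj₁ ∘ e) , record
      { distinct = E.distinct ; covers = λ x → E.covers (x , λ h≡0 → ∄ (x , h≡0)) }
      where
      module E = IsEnumeration E
    go ((m , e) , E) (yes (x₀ , h₀)) = (suc m , e⁺) , record { distinct = distinct⁺ ; covers = covers⁺ }
      where
      module E = IsEnumeration E
      e⁺ : Fin (suc m) → A
      e⁺ zero    = x₀
      e⁺ (suc i) = proj₁ (e i)
      distinct⁺ : ∀ {i j} → e⁺ i ≈ e⁺ j → i ≡ j
      distinct⁺ {zero}  {zero}  _  = ≡.refl
      distinct⁺ {zero}  {suc j} eq = contradiction (≡.trans h₀ (h-cong eq)) (proj₂ (e j))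
      distinct⁺ {suc i} {zero}  eq = contradiction (≡.trans h₀ (h-cong (sym eq))) (proj₂ (e i))
      distinct⁺ {suc i} {suc j} eq = ≡.cong suc (E.distinct eq)
      covers⁺ : ∀ x → ∃[ i ] e⁺ i ≈ x
      covers⁺ x with em {P = zero ≡ h x}
      ... | yes h≡0 = zero , h-inj (≡.trans (≡.sym h₀) h≡0)
      ... | no  h≢0 = let (i , eq) = E.covers (x , h≢0) in suc i , eq

  module _ {a b a′ b′} {S : Setoid a b} {T : Setoid a′ b′} where
    private
      module S = Setoid S
      module T = Setoid T

    injection⇒enumeration : (g : S.Carrier → T.Carrier) → (∀ {x y} → x S.≈ y → g x T.≈ g y) → (∀ {x y} → g x T.≈ g y → x S.≈ y) →
                            ∃ (IsEnumeration T) → ∃ (IsEnumeration S)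
    injection⇒enumeration g g-cong g-inj ((n , e) , E) = index⇒enumeration n S (λ x → proj₁ (covers (g x)))
      (λ {x} {y} x≈y → distinct (T.trans (proj₂ (covers (g x))) (T.trans (g-cong x≈y) (T.sym (proj₂ (covers (g y)))))))
      (λ {x} {y} eq → g-inj (T.trans (T.sym (proj₂ (covers (g x)))) (T.trans (T.reflexive (≡.cong e eq)) (proj₂ (covers (g y))))))
      where
      open IsEnumeration E

  module _ {c ℓ₁ ℓ₂} (K̄ : HeytingField c ℓ₁ ℓ₂) where
    open Extensions em K̄ using (enumerate)

    enumerate-isEnumeration : ∀ {a b} (S : Setoid a b) → ∃ (IsEnumeration S) → IsEnumeration S (enumerate S)
    enumerate-isEnumeration S (e , E) with em {P = ∃[ n ] Inverse (≡.setoid (Fin n)) S}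
    ... | yes (_ , inv) = inverse⇒enumeration inv
    ... | no ∄ = contradiction (_ , enumeration⇒inverse E) ∄

    enumerate-infinite : ∀ {a b} (S : Setoid a b) → ¬ ∃ (IsEnumeration S) → proj₁ (enumerate S) ≡ 0
    enumerate-infinite S infinite with em {P = ∃[ n ] Inverse (≡.setoid (Fin n)) S}
    ... | yes (_ , inv) = contradiction (_ , inverse⇒enumeration inv) infinite
    ... | no _ = ≡.refl

    module _ {a b a′ b′ a″ b″} (S : Setoid a b) (A : Setoid a′ b′) (B : Setoid a″ b″) where
      private
        module S = Setoid S
        module A = Setoid A
        module B = Setoid B

      -- No finiteness is needed: since A and B are inhabited, S is infinite as soon as one of them is.
      enumerate-product : (f : A.Carrier → B.Carrier → S.Carrier) →
                          (∀ {x x′ y y′} → x A.≈ x′ → y B.≈ y′ → f x y S.≈ f x′ y′) →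
                          (∀ {x x′ y y′} → f x y S.≈ f x′ y′ → x A.≈ x′ × y B.≈ y′) →
                          (∀ s → ∃[ x ] ∃[ y ] f x y S.≈ s) → A.Carrier → B.Carrier →
                          proj₁ (enumerate S) ≡ proj₁ (enumerate A) ℕ.* proj₁ (enumerate B)
      enumerate-product f f-cong f-inj f-surj x₀ y₀ = go em em
        where
        S-infinite : ∀ {n} → n ≡ 0 → ¬ ∃ (IsEnumeration S) → proj₁ (enumerate S) ≡ n
        S-infinite n≡0 infinite = ≡.trans (enumerate-infinite S infinite) (≡.sym n≡0)
        go : Dec (∃ (IsEnumeration A)) → Dec (∃ (IsEnumeration B)) →
             proj₁ (enumerate S) ≡ proj₁ (enumerate A) ℕ.* proj₁ (enumerate B)
        go (no A-inf) _ = S-infinite (≡.cong (ℕ._* proj₁ (enumerate B)) (enumerate-infinite A A-inf))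
          λ E → A-inf (injection⇒enumeration {S = A} {S} (λ x → f x y₀) (λ eq → f-cong eq B.refl) (λ eq → proj₁ (f-inj eq)) E)
        go (yes _) (no B-inf) = S-infinite (≡.trans (≡.cong (proj₁ (enumerate A) ℕ.*_) (enumerate-infinite B B-inf)) (ℕ.*-zeroʳ (proj₁ (enumerate A))))
          λ E → B-inf (injection⇒enumeration {S = B} {S} (f x₀) (λ eq → f-cong A.refl eq) (λ eq → proj₂ (f-inj eq)) E)
        go (yes A-fin) (yes B-fin) = size-unique (enumerate-isEnumeration S (_ , pairs)) pairs
          where
          m n : ℕ
          m = proj₁ (enumerate A)
          n = proj₁ (enumerate B)
          module EA = IsEnumeration (enumerate-isEnumeration A A-fin)
          module EB = IsEnumeration (enumerate-isEnumeration B B-fin)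
          e : Fin m × Fin n → S.Carrier
          e (i , j) = f (proj₂ (enumerate A) i) (proj₂ (enumerate B) j)
          e-inj : ∀ {s t} → e s S.≈ e t → s ≡ t
          e-inj eq = ≡.cong₂ _,_ (EA.distinct (proj₁ (f-inj eq))) (EB.distinct (proj₂ (f-inj eq)))
          pairs : IsEnumeration S (m ℕ.* n , λ k → e (Fin.remQuot n k))
          pairs = record
            { distinct = λ {k} {l} eq → ≡.trans (≡.sym (Fin.combine-remQuot {m} n k))
                (≡.trans (≡.cong (λ s → Fin.combine (proj₁ s) (proj₂ s)) (e-inj eq)) (Fin.combine-remQuot {m} n l))
            ; covers = λ s → let (x , y , fxy≈s) = f-surj s ; (i , ei≈x) = EA.covers x ; (j , ej≈y) = EB.covers y in
                Fin.combine i j , S.trans (S.reflexive (≡.cong e (Fin.remQuot-combine i j))) (S.trans (f-cong ei≈x ej≈y) fxy≈s)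
            }

-- Linear algebra in `K̄` over its subfields

module FieldTheory (em : ∀ {a : Level} → ExcludedMiddle a) {c ℓ₁ ℓ₂ : Level} (K̄ : HeytingField c ℓ₁ ℓ₂) where
  open Extensions em K̄ hiding (resp; neg∈; r; l; ρ; Λ; τ; α; γ; Γ; ι)
  open Subfield using (mem)
  open HeytingField K̄ using (_#_; tight; #⇒invertible; invertible⇒#; #-irrefl)

  R : CommutativeRing c ℓ₁
  R = HeytingCommutativeRing.commutativeRing (HeytingField.heytingCommutativeRing K̄)

  open CommutativeRing R hiding (zero; rawRing)
  open RingProperties ring using (-0#≈0#; x∙y⁻¹≈ε⇒x≈y; x≈y⇒x∙y⁻¹≈ε)
  open SemiringSum semiring using (sum; sum-cong-≋; sum-replicate-zero; ∑-distrib-+; ∑-comm; *-distribˡ-sum; *-distribʳ-sum)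
  open IntegerCoefficients R using (solve; _:=_; con; _:+_; _:*_; :-_; _:-_)
  open SetoidReasoning setoid
  private
    p : Level
    p = c ⊔ ℓ₁


  -- Otherwise every element equals `1#`, so the difference of `0#` with itself is invertible, which
  -- would make `0#` apart from itself.
  1≉0 : ¬ 1# ≈ 0#
  1≉0 1≈0 = #-irrefl refl (invertible⇒# {0#} {0#} (0# , ≈1 , ≈1))
    where
    ≈1 : ∀ {x} → x ≈ 1#
    ≈1 {x} = begin
      x       ≈⟨ *-identityˡ x ⟨
      1# * x  ≈⟨ *-congʳ 1≈0 ⟩
      0# * x  ≈⟨ zeroˡ x ⟩
      0#      ≈⟨ 1≈0 ⟨
      1#      ∎

  -- Apartness is recovered from inequality by excluded middle and tightness; the field axiom then
  -- inverts the difference `x - 0#`.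
  inverse : ∀ {x} → ¬ x ≈ 0# → ∃[ y ] x * y ≈ 1#
  inverse {x} x≉0 with em {P = x # 0#}
  ... | no ¬x#0 = contradiction (proj₁ (tight x 0#) ¬x#0) x≉0
  ... | yes x#0 with #⇒invertible x#0
  ... | y , _ , [x-0]y≈1 =
    y , trans (*-congʳ (sym (trans (+-congˡ -0#≈0#) (+-identityʳ x)))) [x-0]y≈1

  cancel-≉0 : ∀ {x y} → x * y ≈ 0# → ¬ x ≈ 0# → y ≈ 0#
  cancel-≉0 {x} {y} xy≈0 x≉0 with inverse x≉0
  ... | z , xz≈1 = begin
    y            ≈⟨ *-identityˡ y ⟨
    1# * y       ≈⟨ *-congʳ xz≈1 ⟨
    x * z * y    ≈⟨ solve 3 (λ x y z → x :* z :* y := z :* (x :* y)) refl x y z ⟩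
    z * (x * y)  ≈⟨ *-congˡ xy≈0 ⟩
    z * 0#       ≈⟨ zeroʳ z ⟩
    0#           ∎

  x-y≈0⇒x≈y : ∀ {x y} → x - y ≈ 0# → x ≈ y
  x-y≈0⇒x≈y = x∙y⁻¹≈ε⇒x≈y _ _

  module _ (F : Subfield) where
    open Subfield F

    sub-closed : ∀ {x y} → x ∈ᶠ F → y ∈ᶠ F → x - y ∈ᶠ F
    sub-closed x∈ y∈ = +-closed x∈ (neg-closed y∈)

    sum-closed : ∀ {n} {v : Vector Carrier n} → (∀ i → v i ∈ᶠ F) → sum v ∈ᶠ F
    sum-closed {zero}  v∈ = 0#-closed
    sum-closed {suc n} v∈ = +-closed (v∈ zero) (sum-closed (v∈ ∘ suc))

  -- Linear combinations

  lin : ∀ {n} → Vector Carrier n → Vector Carrier n → Carrier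
  lin a v = sum (λ i → a i * v i)

  lin-cong : ∀ {n} {a b v w : Vector Carrier n} → (∀ i → a i ≈ b i) → (∀ i → v i ≈ w i) → lin a v ≈ lin b w
  lin-cong a≈b v≈w = sum-cong-≋ λ i → *-cong (a≈b i) (v≈w i)

  lin-+ : ∀ {n} (a b v : Vector Carrier n) → lin (λ i → a i + b i) v ≈ lin a v + lin b v
  lin-+ a b v = trans (sum-cong-≋ λ i → distribʳ (v i) (a i) (b i)) (∑-distrib-+ (λ i → a i * v i) (λ i → b i * v i))

  lin-* : ∀ {n} x (a v : Vector Carrier n) → lin (λ i → x * a i) v ≈ x * lin a v
  lin-* x a v = trans (sum-cong-≋ λ i → *-assoc x (a i) (v i)) (sym (*-distribˡ-sum x (λ i → a i * v i)))

  lin-*ʳ : ∀ {n} x (a v : Vector Carrier n) → lin a (λ i → x * v i) ≈ x * lin a v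
  lin-*ʳ x a v = trans (sum-cong-≋ λ i → solve 3 (λ x a v → a :* (x :* v) := x :* (a :* v)) refl x (a i) (v i))
                       (sym (*-distribˡ-sum x (λ i → a i * v i)))

  lin-neg : ∀ {n} (a v : Vector Carrier n) → lin (λ i → - a i) v ≈ - lin a v
  lin-neg a v = begin
    lin (λ i → - a i) v       ≈⟨ lin-cong (λ i → solve 1 (λ x → :- x := :- con (+ 1) :* x) refl (a i)) (λ _ → refl) ⟩
    lin (λ i → - 1# * a i) v  ≈⟨ lin-* (- 1#) a v ⟩
    - 1# * lin a v            ≈⟨ solve 1 (λ x → :- con (+ 1) :* x := :- x) refl (lin a v) ⟩
    - lin a v                 ∎

  lin-0 : ∀ {n} {a : Vector Carrier n} (v : Vector Carrier n) → (∀ i → a i ≈ 0#) → lin a v ≈ 0#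
  lin-0 {n} v a≈0 = trans (sum-cong-≋ λ i → trans (*-congʳ (a≈0 i)) (zeroˡ (v i))) (sum-replicate-zero n)

  lin-comm : ∀ {m n} (a : Vector Carrier m) (B : Fin m → Vector Carrier n) (v : Vector Carrier n) →
             lin a (λ i → lin (B i) v) ≈ lin (λ j → lin a (λ i → B i j)) v
  lin-comm a B v = begin
    sum (λ i → a i * sum (λ j → B i j * v j))      ≈⟨ sum-cong-≋ (λ i → *-distribˡ-sum (a i) (λ j → B i j * v j)) ⟩
    sum (λ i → sum (λ j → a i * (B i j * v j)))    ≈⟨ ∑-comm (λ i j → a i * (B i j * v j)) ⟩
    sum (λ j → sum (λ i → a i * (B i j * v j)))    ≈⟨ sum-cong-≋ (λ j → sum-cong-≋ λ i → sym (*-assoc (a i) (B i j) (v j))) ⟩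
    sum (λ j → sum (λ i → a i * B i j * v j))      ≈⟨ sum-cong-≋ (λ j → *-distribʳ-sum (v j) (λ i → a i * B i j)) ⟨
    sum (λ j → sum (λ i → a i * B i j) * v j)      ∎

  sum-split : ∀ m {n} (f : Vector Carrier (m ℕ.+ n)) → sum f ≈ sum (λ i → f (i ↑ˡ n)) + sum (λ j → f (m ↑ʳ j))
  sum-split zero    f = sym (+-identityˡ _)
  sum-split (suc m) f = trans (+-congˡ (sum-split m (f ∘ suc))) (sym (+-assoc _ _ _))

  infixr 5 _++_
  _++_ : ∀ {m n} → Vector Carrier m → Vector Carrier n → Vector Carrier (m ℕ.+ n)
  _++_ = Vector._++_

  ++-all : ∀ {q} (P : Pred Carrier q) {m n} {v : Vector Carrier m} {w : Vector Carrier n} →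
           (∀ i → v i ∈ P) → (∀ i → w i ∈ P) → ∀ i → (v ++ w) i ∈ P
  ++-all P {m} v∈ w∈ i with splitAt m i
  ... | inj₁ j = v∈ j
  ... | inj₂ j = w∈ j

  lin-++ : ∀ {m n} (a : Vector Carrier (m ℕ.+ n)) (v : Vector Carrier m) (w : Vector Carrier n) →
           lin a (v ++ w) ≈ lin (λ i → a (i ↑ˡ n)) v + lin (λ j → a (m ↑ʳ j)) w
  lin-++ {m} {n} a v w = trans (sum-split m _)
    (+-cong (sum-cong-≋ λ i → *-congˡ (reflexive (Vector.lookup-++ˡ v w i)))
            (sum-cong-≋ λ j → *-congˡ (reflexive (Vector.lookup-++ʳ v w j))))

  -- Subspaces of K̄

  record IsSubspace (F : Subfield) (U : Pred Carrier p) : Set p where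
    field
      resp  : U Respects _≈_
      0∈    : 0# ∈ U
      +∈    : ∀ {x y} → x ∈ U → y ∈ U → x + y ∈ U
      scale : ∀ {a x} → a ∈ᶠ F → x ∈ U → a * x ∈ U

    neg∈ : ∀ {x} → x ∈ U → - x ∈ U
    neg∈ {x} x∈ = resp (solve 1 (λ x → :- con (+ 1) :* x := :- x) refl x)
      (scale (Subfield.neg-closed F (Subfield.1#-closed F)) x∈)

    -∈ : ∀ {x y} → x ∈ U → y ∈ U → x - y ∈ U
    -∈ x∈ y∈ = +∈ x∈ (neg∈ y∈)

    sum∈ : ∀ {n} {v : Vector Carrier n} → (∀ i → v i ∈ U) → sum v ∈ U
    sum∈ {zero}  v∈ = 0∈
    sum∈ {suc n} v∈ = +∈ (v∈ zero) (sum∈ (v∈ ∘ suc))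

    lin∈ : ∀ {n} {a v : Vector Carrier n} → (∀ i → a i ∈ᶠ F) → (∀ i → v i ∈ U) → lin a v ∈ U
    lin∈ a∈ v∈ = sum∈ λ i → scale (a∈ i) (v∈ i)

  open IsSubspace

  restrict-scalars : ∀ {F E U} → F ⊑ E → IsSubspace E U → IsSubspace F U
  restrict-scalars F⊑E S = record { resp = resp S ; 0∈ = 0∈ S ; +∈ = +∈ S ; scale = scale S ∘ F⊑E }

  subfield-subspace : ∀ {F} E → F ⊑ E → IsSubspace F (mem E)
  subfield-subspace E F⊑E = record
    { resp = E.resp ; 0∈ = E.0#-closed ; +∈ = E.+-closed ; scale = λ a∈ → E.*-closed (F⊑E a∈) }
    where
    module E = Subfield E

  -- The zero subspace, lifted to the level of the other predicates. Modulo it, `Ind` is ordinary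
  -- linear independence.
  Zero : Pred Carrier p
  Zero x = Lift p (x ≈ 0#)

  zero-subspace : ∀ F → IsSubspace F Zero
  zero-subspace F = record
    { resp  = λ { x≈y (lift x≈0) → lift (trans (sym x≈y) x≈0) }
    ; 0∈    = lift refl
    ; +∈    = λ { (lift x≈0) (lift y≈0) → lift (trans (+-cong x≈0 y≈0) (+-identityʳ 0#)) }
    ; scale = λ { _ (lift x≈0) → lift (trans (*-congˡ x≈0) (zeroʳ _)) }
    }

  record Comb (F : Subfield) {n : ℕ} (v : Vector Carrier n) (x : Carrier) : Set p where
    constructor comb
    field
      coef  : Vector Carrier n
      coef∈ : ∀ i → coef i ∈ᶠ F
      eq    : x ≈ lin coef v

  comb-subspace : ∀ F {n} (v : Vector Carrier n) → IsSubspace F (Comb F v)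
  comb-subspace F v = record
    { resp  = λ { x≈y (comb a a∈ x≈) → comb a a∈ (trans (sym x≈y) x≈) }
    ; 0∈    = comb (λ _ → 0#) (λ _ → F.0#-closed) (sym (lin-0 v λ _ → refl))
    ; +∈    = λ { (comb a a∈ x≈) (comb b b∈ y≈) → comb (λ i → a i + b i)
                  (λ i → F.+-closed (a∈ i) (b∈ i)) (trans (+-cong x≈ y≈) (sym (lin-+ a b v))) }
    ; scale = λ { {s} s∈ (comb a a∈ x≈) → comb (λ i → s * a i)
                  (λ i → F.*-closed s∈ (a∈ i)) (trans (*-congˡ x≈) (sym (lin-* s a v))) }
    }
    where
    module F = Subfield F

  comb-cons : ∀ {F n} (v : Vector Carrier (suc n)) {a y} →
              a ∈ᶠ F → Comb F (v ∘ suc) y → Comb F v (a * v zero + y)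
  comb-cons v {a} a∈ (comb b b∈ y≈) =
    comb (a Vector.∷ b) (λ { zero → a∈ ; (suc i) → b∈ i }) (+-congˡ y≈)

  comb-∋ : ∀ {F n} (v : Vector Carrier n) i → Comb F v (v i)
  comb-∋ {F} v zero = resp (comb-subspace F v)
    (trans (+-identityʳ _) (*-identityˡ _))
    (comb-cons v (Subfield.1#-closed F) (0∈ (comb-subspace F (v ∘ suc))))
  comb-∋ {F} v (suc i) = resp (comb-subspace F v)
    (trans (+-congʳ (zeroˡ _)) (+-identityˡ _))
    (comb-cons v (Subfield.0#-closed F) (comb-∋ (v ∘ suc) i))

  comb-least : ∀ {F U n} {v : Vector Carrier n} → IsSubspace F U → (∀ i → v i ∈ U) → Comb F v ⊆ U
  comb-least S v∈ (comb a a∈ x≈) = resp S (sym x≈) (lin∈ S a∈ v∈)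

  comb-mono : ∀ {F E n} {v : Vector Carrier n} → F ⊑ E → Comb F v ⊆ Comb E v
  comb-mono F⊑E (comb a a∈ x≈) = comb a (λ i → F⊑E (a∈ i)) x≈

  comb-++ˡ : ∀ {F m n} (v : Vector Carrier m) (w : Vector Carrier n) → Comb F v ⊆ Comb F (v ++ w)
  comb-++ˡ {F} {n = n} v w = comb-least (comb-subspace F (v ++ w)) λ i →
    ≡.subst (Comb F (v ++ w)) (Vector.lookup-++ˡ v w i) (comb-∋ (v ++ w) (i ↑ˡ n))

  comb-++ʳ : ∀ {F m n} (v : Vector Carrier m) (w : Vector Carrier n) → Comb F w ⊆ Comb F (v ++ w)
  comb-++ʳ {F} {m} v w = comb-least (comb-subspace F (v ++ w)) λ i →
    ≡.subst (Comb F (v ++ w)) (Vector.lookup-++ʳ v w i) (comb-∋ (v ++ w) (m ↑ʳ i))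

  record Span (F : Subfield) (S : Pred Carrier p) (x : Carrier) : Set p where
    constructor span
    field
      {size} : ℕ
      vec    : Vector Carrier size
      vec∈   : ∀ i → vec i ∈ S
      comb∈  : x ∈ Comb F vec

  span-subspace : ∀ F S → IsSubspace F (Span F S)
  span-subspace F S = record
    { resp  = λ { x≈y (span v v∈ x∈) → span v v∈ (resp (comb-subspace F v) x≈y x∈) }
    ; 0∈    = span {size = 0} (λ ()) (λ ()) (0∈ (comb-subspace F (λ ())))
    ; +∈    = λ { (span v v∈ x∈) (span w w∈ y∈) → span (v ++ w) (++-all S v∈ w∈)
                  (+∈ (comb-subspace F (v ++ w)) (comb-++ˡ v w x∈) (comb-++ʳ v w y∈)) }
    ; scale = λ { s∈ (span v v∈ x∈) → span v v∈ (scale (comb-subspace F v) s∈ x∈) }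
    }

  span-∋ : ∀ {F S} → S ⊆ Span F S
  span-∋ {x = x} x∈ = span {size = 1} (λ _ → x) (λ _ → x∈) (comb-∋ (λ _ → x) zero)

  span-least : ∀ {F S U} → IsSubspace F U → S ⊆ U → Span F S ⊆ U
  span-least sub S⊆U (span v v∈ x∈) = comb-least sub (λ i → S⊆U (v∈ i)) x∈

  -- Multiplication by `y` is linear, so generators suffice. Applied in both arguments, this makes
  -- the span of a multiplicatively closed set a ring.
  span-*ˡ : ∀ {F S T} y → (∀ {z} → z ∈ S → y * z ∈ Span F T) → ∀ {x} → x ∈ Span F S → y * x ∈ Span F T
  span-*ˡ {F} {T = T} y h (span v v∈ (comb a a∈ x≈)) =
    resp sub (trans (lin-*ʳ y a v) (*-congˡ (sym x≈))) (lin∈ sub a∈ λ i → h (v∈ i))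
    where sub = span-subspace F T

  -- Independence modulo a subspace

  -- The subspace `U + F v`, with the component in `U` given as a difference so that only the scalar
  -- has to be named.
  record Adjoin (F : Subfield) (U : Pred Carrier p) (v x : Carrier) : Set p where
    constructor adjoin
    field
      coef  : Carrier
      coef∈ : coef ∈ᶠ F
      rest∈ : x - coef * v ∈ U

  adjoin-subspace : ∀ {F U} → IsSubspace F U → ∀ v → IsSubspace F (Adjoin F U v)
  adjoin-subspace {F} {U} S v = record
    { resp  = λ { x≈y (adjoin a a∈ x∈) → adjoin a a∈ (resp S (+-congʳ x≈y) x∈) }
    ; 0∈    = adjoin 0# F.0#-closed (resp S (solve 1 (λ v → con (+ 0) := con (+ 0) :- con (+ 0) :* v) refl v) (0∈ S))
    ; +∈    = λ { {x} {y} (adjoin a a∈ x∈) (adjoin b b∈ y∈) → adjoin (a + b) (F.+-closed a∈ b∈)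
                  (resp S (solve 5 (λ x y a b v → (x :- a :* v) :+ (y :- b :* v) := (x :+ y) :- (a :+ b) :* v)
                            refl x y a b v) (+∈ S x∈ y∈)) }
    ; scale = λ { {s} {x} s∈ (adjoin a a∈ x∈) → adjoin (s * a) (F.*-closed s∈ a∈)
                  (resp S (solve 4 (λ s x a v → s :* (x :- a :* v) := s :* x :- s :* a :* v) refl s x a v)
                    (scale S s∈ x∈)) }
    }
    where
    module F = Subfield F

  adjoin-mono : ∀ {F U V v} → U ⊆ V → Adjoin F U v ⊆ Adjoin F V v
  adjoin-mono U⊆V (adjoin a a∈ x∈) = adjoin a a∈ (U⊆V x∈)

  adjoin-swap : ∀ {F U v w} → IsSubspace F U → Adjoin F (Adjoin F U v) w ⊆ Adjoin F (Adjoin F U w) v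
  adjoin-swap {v = v} {w} S {x} (adjoin a a∈ (adjoin b b∈ x∈)) = adjoin b b∈ (adjoin a a∈
    (resp S (solve 5 (λ x a w b v → (x :- a :* w) :- b :* v := (x :- b :* v) :- a :* w) refl x a w b v) x∈))

  -- Steinitz exchange: the coefficient of `v` in `w` is nonzero, since otherwise `w` would lie in
  -- `U`, and solving for `v` expresses it by `w` modulo `U`.
  exchange : ∀ {F U v w} → IsSubspace F U → w ∈ Adjoin F U v → ¬ w ∈ U → Adjoin F U v ⊆ Adjoin F U w
  exchange {F} {U} {v} {w} S (adjoin a a∈ w-av∈) w∉U {x} (adjoin b b∈ x-bv∈) with em {P = a ≈ 0#}
  ... | yes a≈0 = contradiction (resp S w-av≈w w-av∈) w∉U
    where
    w-av≈w : w - a * v ≈ w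
    w-av≈w = trans (+-congˡ (-‿cong (trans (*-congʳ a≈0) (zeroˡ v)))) (trans (+-congˡ -0#≈0#) (+-identityʳ w))
  ... | no a≉0 with inverse a≉0
  ... | s , as≈1 = adjoin (b * s) (*-closed b∈ s∈) (resp S eq (-∈ S x-bv∈ (scale S (*-closed b∈ s∈) w-av∈)))
    where
    open Subfield F using (*-closed; inv-closed)
    s∈ : s ∈ᶠ F
    s∈ = inv-closed a∈ as≈1
    eq : x - b * v - b * s * (w - a * v) ≈ x - b * s * w
    eq = begin
      x - b * v - b * s * (w - a * v)
        ≈⟨ solve 6 (λ x b v s w a → x :- b :* v :- b :* s :* (w :- a :* v)
             := (x :- b :* v :+ b :* v :* (a :* s)) :- b :* s :* w) refl x b v s w a ⟩
      x - b * v + b * v * (a * s) - b * s * w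
        ≈⟨ +-congʳ (+-congˡ (*-congˡ as≈1)) ⟩
      x - b * v + b * v * 1# - b * s * w
        ≈⟨ solve 5 (λ x b v s w → (x :- b :* v :+ b :* v :* con (+ 1)) :- b :* s :* w := x :- b :* s :* w)
             refl x b v s w ⟩
      x - b * s * w ∎

  -- Independence modulo `U`, one vector at a time: each lies outside the span of `U` and its
  -- predecessors. No coefficients occur, so a vector can be absorbed into `U` in an induction;
  -- `ind⇒li` and `li⇒ind` translate.
  Ind : ∀ F (U : Pred Carrier p) {n} → Vector Carrier n → Set p
  Ind F U {zero}  v = ⊤
  Ind F U {suc n} v = ¬ v zero ∈ U × Ind F (Adjoin F U (v zero)) (v ∘ suc)

  ind-antitone : ∀ {F U V n} {v : Vector Carrier n} → U ⊆ V → Ind F V v → Ind F U v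
  ind-antitone {n = zero}  U⊆V _            = tt
  ind-antitone {n = suc n} U⊆V (v₀∉ , ind) = v₀∉ ∘ U⊆V , ind-antitone (adjoin-mono U⊆V) ind

  -- Enlarging `U` by one vector costs at most one member of an independent family: the first that
  -- falls into the enlarged subspace is dropped, and by `exchange` its successors stay independent.
  -- `P` records where the surviving vectors lie.
  ind-remove : ∀ {F U q} (P : Pred Carrier q) {n} {w : Vector Carrier n} → IsSubspace F U → Ind F U w → (∀ i → w i ∈ P) → ∀ v →
               ∃[ m ] ∃[ w′ ] n ℕ.≤ suc m × (∀ (i : Fin m) → w′ i ∈ P) × Ind F (Adjoin F U v) w′
  ind-remove P {zero} S _ _ v = 0 , (λ ()) , z≤n , (λ ()) , tt
  ind-remove {F} {U} P {suc n} {w} S (w₀∉ , ind) w∈ v with em {P = w zero ∈ Adjoin F U v}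
  ... | yes w₀∈ = n , w ∘ suc , ℕ.≤-refl , w∈ ∘ suc , ind-antitone (exchange S w₀∈ w₀∉) ind
  ... | no w₀∉′ with ind-remove P (adjoin-subspace S (w zero)) ind (w∈ ∘ suc) v
  ... | m , w′ , n≤ , w′∈ , ind′ =
    suc m , w zero Vector.∷ w′ , s≤s n≤ , (λ { zero → w∈ zero ; (suc i) → w′∈ i }) ,
    w₀∉′ , ind-antitone (adjoin-swap S) ind′

  record CombMod (F : Subfield) (U : Pred Carrier p) {n} (v : Vector Carrier n) (x : Carrier) : Set p where
    constructor combMod
    field
      {near} : Carrier
      near∈  : near ∈ Comb F v
      rest∈  : x - near ∈ U

  combMod-[] : ∀ {F U x} {v : Vector Carrier 0} → IsSubspace F U → x ∈ CombMod F U v → x ∈ U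
  combMod-[] {x = x} S (combMod {y} (comb _ _ y≈0) x-y∈) =
    resp S (trans (+-congˡ (trans (-‿cong y≈0) -0#≈0#)) (+-identityʳ x)) x-y∈

  combMod-⊇ : ∀ {F U n x} (v : Vector Carrier n) → IsSubspace F U → x ∈ U → x ∈ CombMod F U v
  combMod-⊇ {F} {x = x} v S x∈ = combMod (0∈ (comb-subspace F v))
    (resp S (sym (trans (+-congˡ -0#≈0#) (+-identityʳ x))) x∈)

  combMod-uncons : ∀ {F U n x} (v : Vector Carrier (suc n)) → IsSubspace F U →
                   x ∈ CombMod F U v → x ∈ CombMod F (Adjoin F U (v zero)) (v ∘ suc)
  combMod-uncons {x = x} v S (combMod (comb a a∈ y≈) x-y∈) =
    combMod (comb (a ∘ suc) (a∈ ∘ suc) refl) (adjoin (a zero) (a∈ zero)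
      (resp S (trans (+-congˡ (-‿cong y≈)) (solve 3 (λ x s t → x :- (s :+ t) := x :- t :- s) refl x _ _)) x-y∈))

  combMod-cons : ∀ {F U n x} (v : Vector Carrier (suc n)) → IsSubspace F U →
                 x ∈ CombMod F (Adjoin F U (v zero)) (v ∘ suc) → x ∈ CombMod F U v
  combMod-cons {x = x} v S (combMod {y} y∈ (adjoin a a∈ x-y-av∈)) =
    combMod (comb-cons v a∈ y∈)
      (resp S (solve 4 (λ x y a v → x :- y :- a :* v := x :- (a :* v :+ y)) refl x y a (v zero)) x-y-av∈)

  -- Induction on the spanning family: its first vector is absorbed into `U`, and `ind-remove` takes
  -- at most one vector from `w`.
  ind-bound : ∀ {F U m n} {v : Vector Carrier m} {w : Vector Carrier n} → IsSubspace F U → Ind F U w →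
              (∀ i → w i ∈ CombMod F U v) → n ℕ.≤ m
  ind-bound {m = zero} {zero} S _ _ = z≤n
  ind-bound {m = zero} {suc n} S (w₀∉ , _) w∈ = contradiction (combMod-[] S (w∈ zero)) w₀∉
  ind-bound {F} {U} {suc m} {v = v} S ind w∈ with ind-remove (CombMod F U v) S ind w∈ (v zero)
  ... | k , w′ , n≤ , w′∈ , ind′ =
    ℕ.≤-trans n≤ (s≤s (ind-bound (adjoin-subspace S (v zero)) ind′ λ i → combMod-uncons v S (w′∈ i)))

  ind⇒li : ∀ {F U n} {v : Vector Carrier n} → IsSubspace F U → Ind F U v →
           ∀ a → (∀ i → a i ∈ᶠ F) → lin a v ∈ U → ∀ i → a i ≈ 0#
  ind⇒li {F} {U} {suc n} {v} S (v₀∉ , ind) a a∈ lin∈U = λ { zero → a₀≈0 ; (suc i) → tail≈0 i }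
    where
    tail≈0 : ∀ i → a (suc i) ≈ 0#
    tail≈0 = ind⇒li (adjoin-subspace S (v zero)) ind (a ∘ suc) (a∈ ∘ suc)
      (adjoin (- a zero) (Subfield.neg-closed F (a∈ zero))
        (resp S (solve 3 (λ a v t → a :* v :+ t := t :- (:- a) :* v) refl (a zero) (v zero) _) lin∈U))
    a₀v₀∈ : a zero * v zero ∈ U
    a₀v₀∈ = resp S (trans (+-congˡ (lin-0 (v ∘ suc) tail≈0)) (+-identityʳ _)) lin∈U
    a₀≈0 : a zero ≈ 0#
    a₀≈0 = decidable-stable em λ a₀≉0 → case inverse a₀≉0 of λ { (s , as≈1) →
      v₀∉ (resp S (trans (solve 3 (λ s a v → s :* (a :* v) := a :* s :* v) refl s (a zero) (v zero))
                         (trans (*-congʳ as≈1) (*-identityˡ _)))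
                  (scale S (Subfield.inv-closed F (a∈ zero) as≈1) a₀v₀∈)) }

  li⇒ind : ∀ {F U n} {v : Vector Carrier n} → IsSubspace F U →
           (∀ a → (∀ i → a i ∈ᶠ F) → lin a v ∈ U → ∀ i → a i ≈ 0#) → Ind F U v
  li⇒ind {n = zero} S li = tt
  li⇒ind {F} {U} {suc n} {v} S li =
    (λ v₀∈ → 1≉0 (li (1# Vector.∷ λ _ → 0#) (λ { zero → F.1#-closed ; (suc i) → F.0#-closed })
      (resp S (sym (trans (+-congˡ (lin-0 (v ∘ suc) λ _ → refl)) (trans (+-identityʳ _) (*-identityˡ _)))) v₀∈) zero)) ,
    li⇒ind (adjoin-subspace S (v zero)) (λ { a a∈ (adjoin b b∈ t∈) i →
      li (- b Vector.∷ a) (λ { zero → F.neg-closed b∈ ; (suc j) → a∈ j })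
        (resp S (solve 3 (λ t b v → t :- b :* v := (:- b) :* v :+ t) refl _ b (v zero)) t∈) (suc i) })
    where
    module F = Subfield F

  -- Greedy choice: as long as `V` has a vector outside `U`, it is taken and absorbed into `U`. The
  -- bound `m` on independent families is the recursion measure.
  ind-extend : ∀ {F U} {V : Pred Carrier p} m → IsSubspace F U →
               (∀ {n} (w : Vector Carrier n) → (∀ i → w i ∈ V) → Ind F U w → n ℕ.≤ m) →
               ∃[ n ] Σ[ w ∈ Vector Carrier n ] (∀ i → w i ∈ V) × Ind F U w × (V ⊆ CombMod F U w)
  ind-extend {F} {U} {V} m S bound with em {P = ∃[ x ] x ∈ V × ¬ x ∈ U}
  ... | no ∄ = 0 , (λ ()) , (λ ()) , tt , λ {x} x∈V →
    combMod-⊇ (λ ()) S (decidable-stable em λ x∉U → ∄ (x , x∈V , x∉U))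
  ind-extend {V = V} zero S bound | yes (x , x∈V , x∉U) with bound {1} (λ _ → x) (λ _ → x∈V) (x∉U , tt)
  ... | ()
  ind-extend {F} {U} {V} (suc m) S bound | yes (x , x∈V , x∉U)
    with ind-extend {V = V} m (adjoin-subspace S x) (λ w w∈ ind → ℕ.≤-pred (bound (x Vector.∷ w)
           (λ { zero → x∈V ; (suc i) → w∈ i }) (x∉U , ind)))
  ... | n , w , w∈ , ind , spans = suc n , x Vector.∷ w , (λ { zero → x∈V ; (suc i) → w∈ i }) , (x∉U , ind) ,
    λ z∈V → combMod-cons (x Vector.∷ w) S (spans z∈V)

  -- Bases and degrees

  li⇒ind₀ : ∀ {F n} {v : Vector Carrier n} → LinearlyIndependent F v → Ind F Zero v
  li⇒ind₀ {F} li = li⇒ind (zero-subspace F) λ a a∈ (lift eq) → li a a∈ eq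

  ind₀⇒li : ∀ {F n} {v : Vector Carrier n} → Ind F Zero v → LinearlyIndependent F v
  ind₀⇒li {F} ind a a∈ eq = ind⇒li (zero-subspace F) ind a a∈ (lift eq)

  combMod₀⇒comb : ∀ {F n} {v : Vector Carrier n} → CombMod F Zero v ⊆ Comb F v
  combMod₀⇒comb {F} {v = v} (combMod y∈ (lift x-y≈0)) =
    resp (comb-subspace F v) (sym (x-y≈0⇒x≈y x-y≈0)) y∈

  comb⇒combMod₀ : ∀ {F n} {v : Vector Carrier n} → Comb F v ⊆ CombMod F Zero v
  comb⇒combMod₀ x∈ = combMod x∈ (lift (x≈y⇒x∙y⁻¹≈ε refl))

  li-bound : ∀ {F m n} {v : Vector Carrier m} {w : Vector Carrier n} →
             LinearlyIndependent F w → (∀ i → w i ∈ Comb F v) → n ℕ.≤ m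
  li-bound {F} li w∈ = ind-bound (zero-subspace F) (li⇒ind₀ li) λ i → comb⇒combMod₀ (w∈ i)

  basis-of : ∀ {F E n} {v : Vector Carrier n} → (∀ i → v i ∈ᶠ E) → LinearlyIndependent F v →
             mem E ⊆ Comb F v → Basis F E n
  basis-of {v = v} v∈ li spans = record
    { vec = v ; vec∈ = v∈ ; independent = li
    ; spans = λ x∈ → case spans x∈ of λ { (comb a a∈ x≈) → a , a∈ , x≈ } }

  basis-spans : ∀ {F E n} (B : Basis F E n) → mem E ⊆ Comb F (Basis.vec B)
  basis-spans B x∈ with Basis.spans B x∈
  ... | a , a∈ , x≈ = comb a a∈ x≈

  basis-bound : ∀ {F E n} → Basis F E n → ∀ {m} {w : Vector Carrier m} → LinearlyIndependent F w →
                (∀ i → w i ∈ᶠ E) → m ℕ.≤ n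
  basis-bound B li w∈ = li-bound li λ i → basis-spans B (w∈ i)

  degree-≡ : ∀ {F E n} → Basis F E n → degree F E ≡ n
  degree-≡ {F} {E} B with em {P = ∃ (Basis F E)}
  ... | yes (_ , B′) = ℕ.≤-antisym (basis-bound B (Basis.independent B′) (Basis.vec∈ B′))
                                   (basis-bound B′ (Basis.independent B) (Basis.vec∈ B))
  ... | no ∄ = contradiction (_ , B) ∄

  basis-resp : ∀ {F F′ E E′ n} → F ≑ F′ → E ≑ E′ → Basis F E n → Basis F′ E′ n
  basis-resp (F⊑F′ , F′⊑F) (E⊑E′ , E′⊑E) B = basis-of (λ i → E⊑E′ (vec∈ i)) (λ a a∈ → independent a (λ i → F′⊑F (a∈ i)))
    (comb-mono F⊑F′ ∘ basis-spans B ∘ E′⊑E)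
    where
    open Basis B

  degree-cong : ∀ {F F′ E E′} → F ≑ F′ → E ≑ E′ → degree F E ≡ degree F′ E′
  degree-cong {F} {F′} {E} {E′} F≑F′ E≑E′ with em {P = ∃ (Basis F E)}
  ... | yes (_ , B) = ≡.sym (degree-≡ (basis-resp F≑F′ E≑E′ B))
  ... | no ∄ with em {P = ∃ (Basis F′ E′)}
  ... | yes (_ , B) = contradiction (_ , basis-resp (≐-sym F≑F′) (≐-sym E≑E′) B) ∄
  ... | no _ = ≡.refl

  li-++ : ∀ {F k n} {u : Vector Carrier k} {w : Vector Carrier n} → LinearlyIndependent F u → Ind F (Comb F u) w →
          LinearlyIndependent F (u ++ w)
  li-++ {F} {k} {n} {u} {w} li ind a a∈ eq = λ i → ≡.subst (λ j → a j ≈ 0#) (Fin.join-splitAt k n i) (a≈0 (splitAt k i))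
    where
    a₁ : Vector Carrier k
    a₁ i = a (i ↑ˡ n)
    a₂ : Vector Carrier n
    a₂ j = a (k ↑ʳ j)
    eq′ : lin a₁ u + lin a₂ w ≈ 0#
    eq′ = trans (sym (lin-++ a u w)) eq
    a₂w≈ : - lin a₁ u ≈ lin a₂ w
    a₂w≈ = begin
      - lin a₁ u                          ≈⟨ +-identityʳ _ ⟨
      - lin a₁ u + 0#                     ≈⟨ +-congˡ eq′ ⟨
      - lin a₁ u + (lin a₁ u + lin a₂ w)  ≈⟨ solve 2 (λ s t → :- s :+ (s :+ t) := t) refl _ _ ⟩
      lin a₂ w                            ∎
    a₂≈0 : ∀ j → a₂ j ≈ 0#
    a₂≈0 = ind⇒li (comb-subspace F u) ind a₂ (λ j → a∈ (k ↑ʳ j))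
      (resp (comb-subspace F u) a₂w≈ (neg∈ (comb-subspace F u) (comb a₁ (λ i → a∈ (i ↑ˡ n)) refl)))
    a₁≈0 : ∀ j → a₁ j ≈ 0#
    a₁≈0 = li a₁ (λ i → a∈ (i ↑ˡ n)) (trans (sym (trans (+-congˡ (lin-0 w a₂≈0)) (+-identityʳ _))) eq′)
    a≈0 : ∀ s → a (Fin.join k n s) ≈ 0#
    a≈0 (inj₁ i) = a₁≈0 i
    a≈0 (inj₂ j) = a₂≈0 j

  li-extend : ∀ {F k} {V : Pred Carrier p} m {u : Vector Carrier k} → LinearlyIndependent F u →
              (∀ {n} {w : Vector Carrier n} → (∀ i → w i ∈ V) → LinearlyIndependent F w → n ℕ.≤ m) →
              (∀ i → u i ∈ V) →
              ∃[ n ] Σ[ w ∈ Vector Carrier n ] (∀ i → w i ∈ V) × LinearlyIndependent F (u ++ w) × V ⊆ Comb F (u ++ w)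
  li-extend {F} {k} {V} m {u} li bound u∈ with ind-extend m (comb-subspace F u) (λ w w∈ ind →
      bound w∈ (ind₀⇒li (ind-antitone (λ { (lift x≈0) → resp (comb-subspace F u) (sym x≈0) (0∈ (comb-subspace F u)) }) ind)))
  ... | n , w , w∈ , ind , spans = n , w , w∈ , li-++ li ind , λ x∈ → spans′ (spans x∈)
    where
    spans′ : CombMod F (Comb F u) w ⊆ Comb F (u ++ w)
    spans′ {x} (combMod {y} y∈ x-y∈) = resp (comb-subspace F (u ++ w)) (solve 2 (λ x y → (x :- y) :+ y := x) refl x y)
      (+∈ (comb-subspace F (u ++ w)) (comb-++ˡ u w x-y∈) (comb-++ʳ u w y∈))

  subspace-basis : ∀ {F} {V : Pred Carrier p} m →
                   (∀ {n} {w : Vector Carrier n} → (∀ i → w i ∈ V) → LinearlyIndependent F w → n ℕ.≤ m) →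
                   ∃[ n ] Σ[ w ∈ Vector Carrier n ] (∀ i → w i ∈ V) × LinearlyIndependent F w × V ⊆ Comb F w
  subspace-basis {F} {V} m bound with ind-extend {V = V} m (zero-subspace F) (λ w w∈ ind → bound w∈ (ind₀⇒li ind))
  ... | n , w , w∈ , ind , spans = n , w , w∈ , ind₀⇒li ind , λ x∈ → combMod₀⇒comb (spans x∈)

  sub-finite : ∀ {F E E′} → ∃ (Basis F E) → E′ ⊑ E → ∃ (Basis F E′)
  sub-finite (m , B) E′⊑E with subspace-basis m (λ w∈ li → basis-bound B li (E′⊑E ∘ w∈))
  ... | n , w , w∈ , li , spans = n , basis-of w∈ li spans

  -- A vector in the span of `v` but not in that of `w` would extend `w` to `n + 1` independent
  -- vectors in a space spanned by at most `n`.
  li-spans : ∀ {F m n} {v : Vector Carrier m} {w : Vector Carrier n} → LinearlyIndependent F w →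
             (∀ i → w i ∈ Comb F v) → m ℕ.≤ n → Comb F v ⊆ Comb F w
  li-spans {F} {m} {n} {v} {w} li w∈ m≤n {x} x∈ = decidable-stable em λ x∉ →
    ℕ.1+n≰n (ℕ.≤-trans (≡.subst (ℕ._≤ m) (ℕ.+-comm n 1)
      (li-bound {v = v} (li-++ {u = w} {λ (_ : Fin 1) → x} li (x∉ , tt)) (++-all (Comb F v) w∈ λ _ → x∈))) m≤n)

  -- The second alternative drops a redundant vector without losing any of the span modulo `U`. This
  -- forces a spanning family of minimal size to be independent, as `spanning-li` concludes.
  ind-or-shrink : ∀ {F U n} → IsSubspace F U → (v : Vector Carrier n) →
                  Ind F U v ⊎ (∃[ k ] n ≡ suc k × Σ[ v′ ∈ Vector Carrier k ] CombMod F U v ⊆ CombMod F U v′)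
  ind-or-shrink {n = zero} S v = inj₁ tt
  ind-or-shrink {F} {U} {suc n} S v with em {P = v zero ∈ U} | ind-or-shrink (adjoin-subspace S (v zero)) (v ∘ suc)
  ... | no v₀∉ | inj₁ ind = inj₁ (v₀∉ , ind)
  ... | no _ | inj₂ (k , eq , v′ , sub) = inj₂ (n , ≡.refl , ≡.subst (λ k → Σ[ v′ ∈ Vector Carrier k ] CombMod F U v ⊆ CombMod F U v′) (≡.sym eq)
    (v zero Vector.∷ v′ , λ x∈ → combMod-cons (v zero Vector.∷ v′) S (sub (combMod-uncons v S x∈))))
  ... | yes v₀∈ | _ = inj₂ (n , ≡.refl , v ∘ suc , λ x∈ → absorb (combMod-uncons v S x∈))
    where
    absorb : CombMod F (Adjoin F U (v zero)) (v ∘ suc) ⊆ CombMod F U (v ∘ suc)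
    absorb (combMod y∈ (adjoin a a∈ r∈)) = combMod y∈
      (resp S (solve 2 (λ r s → r :- s :+ s := r) refl _ _) (+∈ S r∈ (scale S a∈ v₀∈)))

  spanning-li : ∀ {F m n} {v : Vector Carrier m} {w : Vector Carrier n} → LinearlyIndependent F w →
                (∀ i → w i ∈ Comb F v) → m ℕ.≤ n → LinearlyIndependent F v
  spanning-li {F} {v = v} li w∈ m≤n with ind-or-shrink (zero-subspace F) v
  ... | inj₁ ind = ind₀⇒li ind
  ... | inj₂ (k , ≡.refl , v′ , sub) = contradiction
    (ℕ.≤-trans m≤n (li-bound {v = v′} li λ i → combMod₀⇒comb (sub (comb⇒combMod₀ (w∈ i))))) ℕ.1+n≰n

  li-unique : ∀ {F n} {v : Vector Carrier n} → LinearlyIndependent F v → ∀ {a b} →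
              (∀ i → a i ∈ᶠ F) → (∀ i → b i ∈ᶠ F) → lin a v ≈ lin b v → ∀ i → a i ≈ b i
  li-unique {F} {v = v} li {a} {b} a∈ b∈ eq i = x-y≈0⇒x≈y (li (λ j → a j - b j) (λ j → sub-closed F (a∈ j) (b∈ j))
    (trans (lin-+ a (λ j → - b j) v) (trans (+-congˡ (lin-neg b v)) (x≈y⇒x∙y⁻¹≈ε eq))) i)

  -- Towers

  lin-combine : ∀ {m n} (a : Fin m → Vector Carrier n) (v : Vector Carrier m) (w : Vector Carrier n)
                (b : Vector Carrier (m ℕ.* n)) → (∀ i j → b (Fin.combine i j) ≈ a i j) →
                lin b (λ k → v (Fin.quotient n k) * w (Fin.remainder {m} n k)) ≈ lin (λ i → lin (a i) w) v
  lin-combine {m} {n} a v w b b≈a = trans (sum-combine m (λ k → b k * (v (Fin.quotient n k) * w (Fin.remainder {m} n k))))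
    (sum-cong-≋ {m} λ i → trans (sum-cong-≋ {n} λ j → step i j) (sym (*-distribʳ-sum (v i) (λ j → a i j * w j))))
    where
    sum-combine : ∀ m (f : Vector Carrier (m ℕ.* n)) → sum f ≈ sum (λ (i : Fin m) → sum (λ (j : Fin n) → f (Fin.combine i j)))
    sum-combine zero    f = refl
    sum-combine (suc m) f = trans (sum-split n f) (+-congˡ {sum (λ i → f (i ↑ˡ m ℕ.* n))} (sum-combine m (λ k → f (n ↑ʳ k))))
    step : ∀ i j → b (Fin.combine i j) * (v (Fin.quotient n (Fin.combine i j)) * w (Fin.remainder {m} n (Fin.combine i j)))
                   ≈ a i j * w j * v i
    step i j = trans (*-cong (b≈a i j) (*-cong (reflexive (≡.cong (v ∘ proj₁) rq)) (reflexive (≡.cong (w ∘ proj₂) rq))))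
      (solve 3 (λ a v w → a :* (v :* w) := a :* w :* v) refl (a i j) (v i) (w j))
      where rq = Fin.remQuot-combine i j

  tower-basis : ∀ {F E G m n} → F ⊑ E → E ⊑ G → Basis E G m → Basis F E n → Basis F G (m ℕ.* n)
  tower-basis {F} {E} {G} {m} {n} F⊑E E⊑G V W = basis-of
    (λ k → Subfield.*-closed G (V.vec∈ _) (E⊑G (W.vec∈ _))) li spans
    where
    module V = Basis V
    module W = Basis W
    u : Vector Carrier (m ℕ.* n)
    u k = V.vec (Fin.quotient n k) * W.vec (Fin.remainder {m} n k)
    li : LinearlyIndependent F u
    li a a∈ eq k = ≡.subst (λ k → a k ≈ 0#) (Fin.combine-remQuot {m} n k)
      (W.independent (λ j → a (Fin.combine i j)) (λ j → a∈ _)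
        (V.independent (λ i′ → lin (λ j → a (Fin.combine i′ j)) W.vec)
          (λ i → lin∈ (subfield-subspace {F} E F⊑E) {a = λ j → a (Fin.combine i j)} (λ j → a∈ _) W.vec∈)
          (trans (sym (lin-combine (λ i′ j → a (Fin.combine i′ j)) V.vec W.vec a λ _ _ → refl)) eq) i) (Fin.remainder {m} n k))
      where
      i : Fin m
      i = Fin.quotient n k
    spans : mem G ⊆ Comb F u
    spans {x} x∈ with basis-spans V x∈
    ... | comb e e∈ x≈ = comb (λ k → a (Fin.quotient n k) (Fin.remainder {m} n k)) (λ k → Comb.coef∈ (e-comb _) _)
      (trans x≈ (trans (lin-cong (λ i → Comb.eq (e-comb i)) (λ _ → refl)) (sym (lin-combine a V.vec W.vec _ combine≈))))
      where
      e-comb : ∀ i → Comb F W.vec (e i)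
      e-comb i = basis-spans W (e∈ i)
      a : Fin m → Vector Carrier n
      a i = Comb.coef (e-comb i)
      combine≈ : ∀ i j → a (Fin.quotient n (Fin.combine i j)) (Fin.remainder {m} n (Fin.combine i j)) ≈ a i j
      combine≈ i j = reflexive (≡.cong (λ (q : Fin m × Fin n) → a (proj₁ q) (proj₂ q)) (Fin.remQuot-combine i j))

  -- An `F`-basis of `G` still spans over `E`, which bounds the `E`-independent families in `G`.
  tower-finite : ∀ {F E G} → F ⊑ E → E ⊑ G → ∃ (Basis F G) → ∃ (Basis E G)
  tower-finite {F} {E} {G} F⊑E E⊑G (n , B) with subspace-basis n (λ {_} {w} w∈ li →
    li-bound {E} {v = Basis.vec B} {w} li λ i → comb-mono F⊑E (basis-spans B (w∈ i)))
  ... | k , w , w∈ , li , spans = k , basis-of w∈ li spans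

  degree-tower : ∀ {F E G} → F ⊑ E → E ⊑ G → ∃ (Basis F G) → degree F G ≡ degree E G ℕ.* degree F E
  degree-tower {F} {E} {G} F⊑E E⊑G fin with sub-finite fin E⊑G | tower-finite F⊑E E⊑G fin
  ... | _ , W | _ , V = ≡.trans (degree-≡ (tower-basis F⊑E E⊑G V W)) (≡.cong₂ ℕ._*_ (≡.sym (degree-≡ V)) (≡.sym (degree-≡ W)))

-- Extensions of a base field `K` with algebraic closure `K̄`

module BaseField (em : ∀ {a : Level} → ExcludedMiddle a) {c ℓ₁ ℓ₂ : Level} (K̄ : HeytingField c ℓ₁ ℓ₂)
                 (K : Extensions.Subfield em K̄) (ac : Extensions.IsAlgebraicClosure em K̄ K) where
  open FieldTheory em K̄
  open Extensions em K̄ hiding (resp; neg∈; r; l; ρ; Λ; τ; α; γ; Γ; ι)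
  open Subfield using (mem; El)
  open CommutativeRing R hiding (zero; rawRing)
  open RingProperties ring using (-‿distribˡ-*; x≈y⇒x∙y⁻¹≈ε)
  open SemiringSum semiring using (sum; sum-cong-≋; sum-replicate-zero; sum-init-last)
  open IntegerCoefficients R using (solve; _:=_; con; _:+_; _:*_; :-_; _:-_)
  open SetoidReasoning setoid
  open IsSubspace
  private
    p : Level
    p = c ⊔ ℓ₁
  open SemiringMult semiring using (×-comm-*; ×-assoc-*; ×1-homo-*; ×-congʳ; ×-assocˡ) renaming (_×_ to infixr 8 _·_)
  open SemiringExp commutativeSemiring using (_^_; ^-congˡ; ^-distrib-*; ^-assocʳ)
  open IsAlgebraicClosure ac

  closure-least : ∀ {S : Pred Carrier p} F → S ⊆ mem F → mem (generated S) ⊆ mem F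
  closure-least {S} F S⊆F = go
    where
    module F = Subfield F
    go : Closure S ⊆ mem F
    go (incl x∈)            = S⊆F x∈
    go (Closure.resp eq x∈) = F.resp eq (go x∈)
    go zero∈                = F.0#-closed
    go one∈                 = F.1#-closed
    go (add∈ x∈ y∈)         = F.+-closed (go x∈) (go y∈)
    go (mul∈ x∈ y∈)         = F.*-closed (go x∈) (go y∈)
    go (Closure.neg∈ x∈)    = F.neg-closed (go x∈)
    go (inv∈ x∈ xy≈1)       = F.inv-closed (go x∈) xy≈1

  -- Enough for a subfield: every element of `K̄` is algebraic over `K`, so the inverse of `x` is a
  -- polynomial in `x`.
  record IsSubalgebra (A : Pred Carrier p) : Set p where
    field
      subspace : IsSubspace K A
      1∈       : 1# ∈ A
      *∈       : ∀ {x y} → x ∈ A → y ∈ A → x * y ∈ A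

    eval∈ : ∀ {f x} → Over K f → x ∈ A → eval f x ∈ A
    eval∈ []        x∈ = 0∈ subspace
    eval∈ {a ∷ f} (a∈ ∷ f∈) x∈ = +∈ subspace
      (resp subspace (*-identityʳ a) (scale subspace a∈ 1∈)) (*∈ x∈ (eval∈ f∈ x∈))

    -- If the constant term `a` is nonzero, `a + x e = 0` gives the inverse of `x` as `e` divided by
    -- `- a`, where `e` is the value of the remaining polynomial. Otherwise `x` is cancelled, and
    -- the remaining polynomial is still nonzero.
    inv∈′ : ∀ {f n x y} → Over K f → DegreeIs f n → eval f x ≈ 0# → x ∈ A → x * y ≈ 1# → y ∈ A
    inv∈′ {[]}    {n} _ (0≉0 , _) _ _ _ = contradiction refl 0≉0
    inv∈′ {a ∷ f} {n} {x} {y} (a∈ ∷ f∈) degree eq x∈ xy≈1 with em {P = a ≈ 0#}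
    inv∈′ {a ∷ f} {zero}  _ (a≉0 , _) _ _ _ | yes a≈0 = contradiction a≈0 a≉0
    inv∈′ {a ∷ f} {suc n} {x} {y} (_ ∷ f∈) (lead , above) eq x∈ xy≈1 | yes a≈0 =
      inv∈′ {f} {n} f∈ (lead , λ m n<m → above (suc m) (s≤s n<m)) eval-f≈0 x∈ xy≈1
      where
      x≉0 : ¬ x ≈ 0#
      x≉0 x≈0 = 1≉0 (trans (sym xy≈1) (trans (*-congʳ x≈0) (zeroˡ y)))
      eval-f≈0 : eval f x ≈ 0#
      eval-f≈0 = cancel-≉0 (trans (sym (trans (+-congʳ a≈0) (+-identityˡ _))) eq) x≉0
    inv∈′ {a ∷ f} {n} {x} {y} (a∈ ∷ f∈) _ eq x∈ xy≈1 | no a≉0 with inverse a≉0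
    ... | b , ab≈1 = resp subspace y≈ (scale subspace (Subfield.neg-closed K (Subfield.inv-closed K a∈ ab≈1)) (eval∈ f∈ x∈))
      where
      e : Carrier
      e = eval f x
      y≈ : - b * e ≈ y
      y≈ = begin
        - b * e                                    ≈⟨ solve 2 (λ b e → :- b :* e := :- b :* (con (+ 1) :* e)) refl b e ⟩
        - b * (1# * e)                             ≈⟨ *-congˡ (*-congʳ xy≈1) ⟨
        - b * (x * y * e)                          ≈⟨ solve 5 (λ a b x y e → :- b :* (x :* y :* e)
                                                        := a :* b :* y :- b :* y :* (a :+ x :* e)) refl a b x y e ⟩
        a * b * y - b * y * (a + x * e)            ≈⟨ +-cong (*-congʳ ab≈1) (-‿cong (*-congˡ eq)) ⟩
        1# * y - b * y * 0#                        ≈⟨ solve 2 (λ b y → con (+ 1) :* y :- b :* y :* con (+ 0) := y) refl b y ⟩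
        y                                          ∎

    toSubfield : Subfield
    toSubfield = record
      { mem        = A
      ; resp       = resp subspace
      ; 0#-closed  = 0∈ subspace
      ; 1#-closed  = 1∈
      ; +-closed   = +∈ subspace
      ; *-closed   = *∈
      ; neg-closed = neg∈ subspace
      ; inv-closed = λ {x} x∈ xy≈1 → case algebraic x of λ { (f , n , f∈ , degree , fx≈0) →
                       inv∈′ {f} {n} f∈ degree fx≈0 x∈ xy≈1 }
      }

    ⊇K : mem K ⊆ A
    ⊇K {a} a∈ = resp subspace (*-identityʳ a) (scale subspace a∈ 1∈)

  span-subalgebra : ∀ E {S : Pred Carrier p} → K ⊑ E → 1# ∈ S → (∀ {x y} → x ∈ S → y ∈ S → x * y ∈ S) →
                    IsSubalgebra (Span E S)
  span-subalgebra E {S} K⊑E 1∈ *∈ = record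
    { subspace = restrict-scalars {K} {E} K⊑E (span-subspace E S)
    ; 1∈       = span-∋ 1∈
    ; *∈       = λ {x} {y} x∈ y∈ → span-*ˡ x (λ {z} z∈ → resp (span-subspace E S) (*-comm z x)
                   (span-*ˡ z (λ w∈ → span-∋ (*∈ z∈ w∈)) x∈)) y∈
    }

  -- Composita

  infixl 7 _∙_
  _∙_ : Subfield → Subfield → Subfield
  _∙_ = compositum

  ∙-left : ∀ {A B} → A ⊑ A ∙ B
  ∙-left x∈ = incl (inj₁ x∈)

  ∙-right : ∀ {A B} → B ⊑ A ∙ B
  ∙-right x∈ = incl (inj₂ x∈)

  ∙-least : ∀ {A B} G → A ⊑ G → B ⊑ G → A ∙ B ⊑ G
  ∙-least G A⊑G B⊑G = closure-least G [ A⊑G , B⊑G ]′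

  ∙-mono : ∀ {A A′ B B′} → A ⊑ A′ → B ⊑ B′ → A ∙ B ⊑ A′ ∙ B′
  ∙-mono {A} {A′} {B} {B′} A⊑ B⊑ = ∙-least {A} {B} (A′ ∙ B′) (∙-left {A′} {B′} ∘ A⊑) (∙-right {A′} {B′} ∘ B⊑)

  ∙-comm : ∀ {A B} → A ∙ B ⊑ B ∙ A
  ∙-comm {A} {B} = ∙-least {A} {B} (B ∙ A) (∙-right {B} {A}) (∙-left {B} {A})

  -- The `A`-span of `B` is closed under products, hence a field by algebraicity, and it contains
  -- both factors.
  ∙⇒span : ∀ {A B} → K ⊑ A → K ⊑ B → mem (A ∙ B) ⊆ Span A (mem B)
  ∙⇒span {A} {B} K⊑A K⊑B = ∙-least {A} {B} (IsSubalgebra.toSubfield (span-subalgebra A K⊑A B.1#-closed B.*-closed))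
    (λ {a} a∈ → resp (span-subspace A (mem B)) (*-identityʳ a) (scale (span-subspace A (mem B)) a∈ (span-∋ B.1#-closed)))
    span-∋
    where
    module B = Subfield B

  -- Linear disjointness

  -- The coefficients `e` of a relation over `E` are expanded in a `K`-basis `u` of their span.
  -- Regrouped, the relation has coefficients in `F` on `u`; these vanish by disjointness, and
  -- independence of `w` over `K` then kills the scalars.
  disjoint-sym : ∀ {E F} → K ⊑ E → K ⊑ F → LinearlyDisjoint K E F → LinearlyDisjoint K F E
  disjoint-sym {E} {F} K⊑E K⊑F disjoint {m} w w∈ w-li e e∈ eq with
    subspace-basis {K} {Comb K e} m (λ {_} {v} v∈ v-li → li-bound {K} {v = e} {v} v-li v∈)
  ... | n , u , u∈ , u-li , spans = λ j → trans (Comb.eq (e-comb j)) (lin-0 u (α≈0 j))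
    where
    e-comb : ∀ j → Comb K u (e j)
    e-comb j = spans (comb-∋ e j)
    α : Fin m → Vector Carrier n
    α j = Comb.coef (e-comb j)
    α∈ : ∀ j k → α j k ∈ᶠ K
    α∈ j = Comb.coef∈ (e-comb j)
    u∈E : ∀ k → u k ∈ᶠ E
    u∈E k = comb-least (subfield-subspace {K} E K⊑E) e∈ (u∈ k)
    β : Vector Carrier n
    β k = lin (λ j → α j k) w
    β∈ : ∀ k → β k ∈ᶠ F
    β∈ k = lin∈ (subfield-subspace {K} F K⊑F) {a = λ j → α j k} (λ j → α∈ j k) w∈
    lin-β : lin β u ≈ 0#
    lin-β = begin
      lin β u                                ≈⟨ lin-cong (λ k → sum-cong-≋ {m} λ j → *-comm (α j k) (w j)) (λ _ → refl) ⟩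
      lin (λ k → lin w (λ j → α j k)) u      ≈⟨ lin-comm w α u ⟨
      lin w (λ j → lin (α j) u)              ≈⟨ sum-cong-≋ {m} (λ j → trans (*-comm _ _) (*-congʳ (sym (Comb.eq (e-comb j))))) ⟩
      lin e w                                ≈⟨ eq ⟩
      0#                                     ∎
    β≈0 : ∀ k → β k ≈ 0#
    β≈0 = disjoint u u∈E u-li β β∈ lin-β
    α≈0 : ∀ j k → α j k ≈ 0#
    α≈0 j k = w-li (λ j → α j k) (λ j → α∈ j k) (β≈0 k) j

  li-extend-by : ∀ {F m n} {c : Vector Carrier n} → LinearlyIndependent F c → (g : Vector Carrier m) →
                 ∃[ k ] Σ[ w ∈ Vector Carrier k ] (∀ i → w i ∈ Comb F (c ++ g)) × LinearlyIndependent F (c ++ w) ×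
                   (∀ i → g i ∈ Comb F (c ++ w))
  li-extend-by {F} {m} {n} {c} li g = map₂ (λ (w , w∈ , cw-li , spans) → w , w∈ , cw-li , λ i → spans (comb-++ʳ c g (comb-∋ g i)))
    (li-extend {F} {V = Comb F (c ++ g)} (n ℕ.+ m) {c} li (λ {_} {v} v∈ v-li → li-bound {F} {v = c ++ g} {v} v-li v∈)
      (λ i → comb-++ˡ c g (comb-∋ c i)))

  -- A K-independent family in N′ is N-independent, so it can be extended to one over which
  -- the coefficients of any element of F N′ lie in F.
  coefficients∈ : ∀ {N N′ F} → K ⊑ N′ → LinearlyDisjoint K N′ N → K ⊑ F → F ⊑ N →
                  ∀ {n} {e c : Vector Carrier n} → (∀ i → e i ∈ᶠ N) → (∀ i → c i ∈ᶠ N′) → LinearlyIndependent K c →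
                  lin e c ∈ Span F (mem N′) → ∀ i → e i ∈ᶠ F
  coefficients∈ {N} {N′} {F} K⊑N′ disjoint K⊑F F⊑N {n} {e} {c} e∈ c∈ li (span {m} g g∈ x∈) = go (li-extend-by {K} {c = c} li g)
    where
    go : (∃[ k ] Σ[ w ∈ Vector Carrier k ] (∀ i → w i ∈ Comb K (c ++ g)) × LinearlyIndependent K (c ++ w) ×
           (∀ i → g i ∈ Comb K (c ++ w))) → ∀ i → e i ∈ᶠ F
    go (k , w , w∈ , cw-li , spans) i = Subfield.resp F (sym (trans e≈ ≈h)) (h∈ (i ↑ˡ k))
      where
      -- Two coordinate vectors of the same element along the extended family: `e` padded by zeros,
      -- and `h` with entries in `F`. The family is independent over `N`, so they agree.
      e0 : Vector Carrier (n ℕ.+ k)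
      e0 = e ++ λ _ → 0#
      w∈N′ : ∀ i → w i ∈ᶠ N′
      w∈N′ i = comb-least (subfield-subspace {K} N′ K⊑N′) (++-all (mem N′) c∈ g∈) (w∈ i)
      x∈cw : lin e c ∈ Comb F (c ++ w)
      x∈cw = comb-least (comb-subspace F (c ++ w)) (λ i → comb-mono {K} {F} K⊑F (spans i)) x∈
      h : Vector Carrier (n ℕ.+ k)
      h = Comb.coef x∈cw
      h∈ : ∀ i → h i ∈ᶠ F
      h∈ = Comb.coef∈ x∈cw
      e0-lin : lin e0 (c ++ w) ≈ lin h (c ++ w)
      e0-lin = begin
        lin e0 (c ++ w)  ≈⟨ lin-++ e0 c w ⟩
        lin (λ i → e0 (i ↑ˡ k)) c + lin (λ j → e0 (n ↑ʳ j)) w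
          ≈⟨ +-cong (lin-cong (λ i → reflexive (Vector.lookup-++ˡ e (λ _ → 0#) i)) (λ _ → refl))
                    (lin-0 w (λ j → reflexive (Vector.lookup-++ʳ e (λ _ → 0#) j))) ⟩
        lin e c + 0#     ≈⟨ +-identityʳ _ ⟩
        lin e c          ≈⟨ Comb.eq x∈cw ⟩
        lin h (c ++ w)   ∎
      ≈h : e0 (i ↑ˡ k) ≈ h (i ↑ˡ k)
      ≈h = li-unique {N} {v = c ++ w} (disjoint (c ++ w) (++-all (mem N′) c∈ w∈N′) cw-li) {e0} {h}
        (++-all (mem N) e∈ (λ _ → Subfield.0#-closed N)) (λ j → F⊑N (h∈ j)) e0-lin (i ↑ˡ k)
      e≈ : e i ≈ e0 (i ↑ˡ k)
      e≈ = reflexive (≡.sym (Vector.lookup-++ˡ e (λ _ → 0#) i))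

  ∙-comb : ∀ {A B n} → K ⊑ A → K ⊑ B → (V : Basis K B n) → mem (A ∙ B) ⊆ Comb A (Basis.vec V)
  ∙-comb {A} {B} K⊑A K⊑B V x∈ = span-least (comb-subspace A (Basis.vec V))
    (λ b∈ → comb-mono {K} {A} K⊑A (basis-spans V b∈)) (∙⇒span {A} {B} K⊑A K⊑B x∈)

  -- One factor at a time: `x` is expanded in a `K`-basis of `Q` with coefficients in `P`. By
  -- `coefficients∈` each coefficient lies in every `F s`, hence in `A`, while the basis of `Q`
  -- stays.
  ∙-∩ʳ : ∀ {N N′ P Q A} → K ⊑ N′ → LinearlyDisjoint K N′ N → K ⊑ P → P ⊑ N → K ⊑ Q → Q ⊑ N′ → ∃ (Basis K Q) →
         ∀ {s} {S : Set s} (F F′ : S → Subfield) →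
         (∀ s → K ⊑ F s) → (∀ s → F s ⊑ N) → (∀ s → K ⊑ F′ s) → (∀ s → F′ s ⊑ N′) →
         (∀ {x} → x ∈ᶠ P → (∀ s → x ∈ᶠ F s) → x ∈ᶠ A) →
         ∀ {x} → x ∈ᶠ P ∙ Q → (∀ s → x ∈ᶠ F s ∙ F′ s) → x ∈ᶠ A ∙ Q
  ∙-∩ʳ {N} {N′} {P} {Q} {A} K⊑N′ disjoint K⊑P P⊑N K⊑Q Q⊑N′ (n , V) F F′ K⊑F F⊑N K⊑F′ F′⊑N′ ⊆A {x} x∈PQ x∈FF′ =
    Subfield.resp (A ∙ Q) (sym x≈) (lin∈ (subfield-subspace {A} (A ∙ Q) (∙-left {A} {Q})) {a = e}
      (λ i → ⊆A (e∈ i) (e∈F i)) (λ i → ∙-right {A} {Q} (V.vec∈ i)))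
    where
    module V = Basis V
    open Comb (∙-comb {P} {Q} K⊑P K⊑Q V x∈PQ) renaming (coef to e; coef∈ to e∈; eq to x≈)
    e∈F : ∀ i s → e i ∈ᶠ F s
    e∈F i s = coefficients∈ {N} {N′} {F s} K⊑N′ disjoint (K⊑F s) (F⊑N s) (λ i → P⊑N (e∈ i)) (λ i → Q⊑N′ (V.vec∈ i)) V.independent
      (resp (span-subspace (F s) (mem N′)) x≈
        (span-least (span-subspace (F s) (mem N′)) (λ b∈ → span-∋ (F′⊑N′ s b∈)) (∙⇒span {F s} {F′ s} (K⊑F s) (K⊑F′ s) (x∈FF′ s)))) i

  module Disjoint {N N′ : Subfield} (K⊑N : K ⊑ N) (K⊑N′ : K ⊑ N′) (disjoint : LinearlyDisjoint K N N′) where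

    disjoint′ : LinearlyDisjoint K N′ N
    disjoint′ = disjoint-sym {N} {N′} K⊑N K⊑N′ disjoint

    -- The hypotheses on A and B say that they contain P ∩ ⋂ F and Q ∩ ⋂ F′.
    ∙-∩ : ∀ {P Q A B} → K ⊑ P → P ⊑ N → K ⊑ Q → Q ⊑ N′ → K ⊑ A → A ⊑ P → ∃ (Basis K P) → ∃ (Basis K Q) →
          ∀ {s} {S : Set s} (F F′ : S → Subfield) →
          (∀ s → K ⊑ F s) → (∀ s → F s ⊑ N) → (∀ s → K ⊑ F′ s) → (∀ s → F′ s ⊑ N′) →
          (∀ {x} → x ∈ᶠ P → (∀ s → x ∈ᶠ F s) → x ∈ᶠ A) → (∀ {x} → x ∈ᶠ Q → (∀ s → x ∈ᶠ F′ s) → x ∈ᶠ B) →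
          ∀ {x} → x ∈ᶠ P ∙ Q → (∀ s → x ∈ᶠ F s ∙ F′ s) → x ∈ᶠ A ∙ B
    ∙-∩ {P} {Q} {A} {B} K⊑P P⊑N K⊑Q Q⊑N′ K⊑A A⊑P finP finQ F F′ K⊑F F⊑N K⊑F′ F′⊑N′ ⊆A ⊆B x∈PQ x∈FF′ =
      -- The inner call shrinks `P` to `A`; the outer one exchanges the two sides and shrinks `Q` to
      -- `B`.
      ∙-comm {B} {A} (∙-∩ʳ {N′} {N} {Q} {A} {B} K⊑N disjoint K⊑Q Q⊑N′ K⊑A (λ x∈ → P⊑N (A⊑P x∈)) (sub-finite {K} {P} {A} finP A⊑P)
        F′ F K⊑F′ F′⊑N′ K⊑F F⊑N ⊆B
        (∙-comm {A} {Q} (∙-∩ʳ {N} {N′} {P} {Q} {A} K⊑N′ disjoint′ K⊑P P⊑N K⊑Q Q⊑N′ finQ F F′ K⊑F F⊑N K⊑F′ F′⊑N′ ⊆A x∈PQ x∈FF′))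
        (λ s → ∙-comm {F s} {F′ s} (x∈FF′ s)))

    -- This is `coefficients∈` for the family consisting of `1#` alone: an element `x` of `N` is its
    -- own coefficient.
    ∙-∩-left : ∀ {A B x} → K ⊑ A → A ⊑ N → K ⊑ B → B ⊑ N′ → x ∈ᶠ A ∙ B → x ∈ᶠ N → x ∈ᶠ A
    ∙-∩-left {A} {B} {x} K⊑A A⊑N K⊑B B⊑N′ x∈AB x∈N =
      coefficients∈ {N} {N′} {A} K⊑N′ disjoint′ K⊑A A⊑N {1} {λ _ → x} {λ _ → 1#} (λ _ → x∈N) (λ _ → Subfield.1#-closed N′) li
        (resp (span-subspace A (mem N′)) (sym (trans (+-identityʳ _) (*-identityʳ x)))
          (span-least (span-subspace A (mem N′)) (λ b∈ → span-∋ (B⊑N′ b∈)) (∙⇒span {A} {B} K⊑A K⊑B x∈AB))) zero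
      where
      li : LinearlyIndependent K {1} (λ _ → 1#)
      li a a∈ eq zero = trans (sym (trans (+-identityʳ _) (*-identityʳ _))) eq

    compositum-basis : ∀ {A B n} → K ⊑ A → A ⊑ N → K ⊑ B → B ⊑ N′ → Basis K B n → Basis A (A ∙ B) n
    compositum-basis {A} {B} K⊑A A⊑N K⊑B B⊑N′ V = basis-of {A} {A ∙ B} (λ i → ∙-right {A} {B} (V.vec∈ i))
      (λ a a∈ → disjoint′ V.vec (λ i → B⊑N′ (V.vec∈ i)) V.independent a (λ i → A⊑N (a∈ i)))
      (∙-comb {A} {B} K⊑A K⊑B V)
      where
      module V = Basis V

    degree-∙ : ∀ {A B} → K ⊑ A → A ⊑ N → K ⊑ B → B ⊑ N′ → ∃ (Basis K A) → ∃ (Basis K B) →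
               degree K (A ∙ B) ≡ degree K A ℕ.* degree K B
    degree-∙ {A} {B} K⊑A A⊑N K⊑B B⊑N′ (m , U) (n , V) =
      ≡.trans (degree-≡ (tower-basis {K} {A} {A ∙ B} K⊑A (∙-left {A} {B}) (compositum-basis {A} {B} K⊑A A⊑N K⊑B B⊑N′ V) U))
        (≡.trans (ℕ.*-comm n m) (≡.cong₂ ℕ._*_ (≡.sym (degree-≡ U)) (≡.sym (degree-≡ V))))

    finite-∙ : ∀ {A B} → K ⊑ A → A ⊑ N → K ⊑ B → B ⊑ N′ → ∃ (Basis K A) → ∃ (Basis K B) → ∃ (Basis K (A ∙ B))
    finite-∙ {A} {B} K⊑A A⊑N K⊑B B⊑N′ (m , U) (n , V) =
      _ , tower-basis {K} {A} {A ∙ B} K⊑A (∙-left {A} {B}) (compositum-basis {A} {B} K⊑A A⊑N K⊑B B⊑N′ V) U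

  -- Polynomials

  coeff-+ : ∀ f g n → coeff (f +ₚ g) n ≈ coeff f n + coeff g n
  coeff-+ []      g       n       = sym (+-identityˡ _)
  coeff-+ (a ∷ f) []      n       = sym (+-identityʳ _)
  coeff-+ (a ∷ f) (b ∷ g) zero    = refl
  coeff-+ (a ∷ f) (b ∷ g) (suc n) = coeff-+ f g n

  coeff-scale : ∀ b f n → coeff (List.map (b *_) f) n ≈ b * coeff f n
  coeff-scale b []      n       = sym (zeroʳ b)
  coeff-scale b (a ∷ f) zero    = refl
  coeff-scale b (a ∷ f) (suc n) = coeff-scale b f n

  coeff-0∷[] : ∀ n → coeff (0# ∷ []) n ≈ 0#
  coeff-0∷[] zero    = refl
  coeff-0∷[] (suc n) = refl

  eval-≈0 : ∀ f {x} → (∀ n → coeff f n ≈ 0#) → eval f x ≈ 0#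
  eval-≈0 []          f≈0 = refl
  eval-≈0 (a ∷ f) {x} f≈0 = begin
    a + x * eval f x  ≈⟨ +-cong (f≈0 zero) (*-congˡ (eval-≈0 f (f≈0 ∘ suc))) ⟩
    0# + x * 0#       ≈⟨ solve 1 (λ x → con (+ 0) :+ x :* con (+ 0) := con (+ 0)) refl x ⟩
    0#                ∎

  eval-cong : ∀ f g {x} → f ≋ g → eval f x ≈ eval g x
  eval-cong []      g       f≋g = sym (eval-≈0 g (λ n → sym (f≋g n)))
  eval-cong (a ∷ f) []      f≋g = eval-≈0 (a ∷ f) f≋g
  eval-cong (a ∷ f) (b ∷ g) f≋g = +-cong (f≋g zero) (*-congˡ (eval-cong f g (f≋g ∘ suc)))

  eval-congʳ : ∀ f {x y} → x ≈ y → eval f x ≈ eval f y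
  eval-congʳ []      x≈y = refl
  eval-congʳ (a ∷ f) x≈y = +-congˡ (*-cong x≈y (eval-congʳ f x≈y))

  eval-+ : ∀ f g x → eval (f +ₚ g) x ≈ eval f x + eval g x
  eval-+ []      g       x = sym (+-identityˡ _)
  eval-+ (a ∷ f) []      x = sym (+-identityʳ _)
  eval-+ (a ∷ f) (b ∷ g) x = trans (+-congˡ (*-congˡ (eval-+ f g x)))
    (solve 5 (λ a b x s t → a :+ b :+ x :* (s :+ t) := a :+ x :* s :+ (b :+ x :* t)) refl a b x (eval f x) (eval g x))

  eval-scale : ∀ b f x → eval (List.map (b *_) f) x ≈ b * eval f x
  eval-scale b []      x = sym (zeroʳ b)
  eval-scale b (a ∷ f) x = trans (+-congˡ (*-congˡ (eval-scale b f x)))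
    (solve 4 (λ a b x s → b :* a :+ x :* (b :* s) := b :* (a :+ x :* s)) refl a b x (eval f x))

  eval-* : ∀ f g x → eval (f *ₚ g) x ≈ eval f x * eval g x
  eval-* []      g x = sym (zeroˡ _)
  eval-* (a ∷ f) g x = begin
    eval (List.map (a *_) g +ₚ (0# ∷ f *ₚ g)) x              ≈⟨ eval-+ (List.map (a *_) g) (0# ∷ f *ₚ g) x ⟩
    eval (List.map (a *_) g) x + (0# + x * eval (f *ₚ g) x)  ≈⟨ +-cong (eval-scale a g x) (+-congˡ (*-congˡ (eval-* f g x))) ⟩
    a * eval g x + (0# + x * (eval f x * eval g x))
      ≈⟨ solve 4 (λ a x s t → a :* t :+ (con (+ 0) :+ x :* (s :* t)) := (a :+ x :* s) :* t) refl a x (eval f x) (eval g x) ⟩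
    (a + x * eval f x) * eval g x                            ∎

  -- The derivative at `x`, by `(a + X f)′ = f + X f′`. For values the product rule is an identity
  -- in the ring `K̄`; `deriv` is the derivative as a polynomial.
  deval : Poly → Carrier → Carrier
  deval []      x = 0#
  deval (a ∷ f) x = eval f x + x * deval f x

  deval-≈0 : ∀ f {x} → (∀ n → coeff f n ≈ 0#) → deval f x ≈ 0#
  deval-≈0 []          f≈0 = refl
  deval-≈0 (a ∷ f) {x} f≈0 = begin
    eval f x + x * deval f x  ≈⟨ +-cong (eval-≈0 f (f≈0 ∘ suc)) (*-congˡ (deval-≈0 f (f≈0 ∘ suc))) ⟩
    0# + x * 0#               ≈⟨ solve 1 (λ x → con (+ 0) :+ x :* con (+ 0) := con (+ 0)) refl x ⟩
    0#                        ∎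

  deval-cong : ∀ f g {x} → f ≋ g → deval f x ≈ deval g x
  deval-cong []      g       f≋g = sym (deval-≈0 g (λ n → sym (f≋g n)))
  deval-cong (a ∷ f) []      f≋g = deval-≈0 (a ∷ f) f≋g
  deval-cong (a ∷ f) (b ∷ g) f≋g = +-cong (eval-cong f g (f≋g ∘ suc)) (*-congˡ (deval-cong f g (f≋g ∘ suc)))

  deval-+ : ∀ f g x → deval (f +ₚ g) x ≈ deval f x + deval g x
  deval-+ []      g       x = sym (+-identityˡ _)
  deval-+ (a ∷ f) []      x = sym (+-identityʳ _)
  deval-+ (a ∷ f) (b ∷ g) x = trans (+-cong (eval-+ f g x) (*-congˡ (deval-+ f g x)))
    (solve 5 (λ e e′ x s t → e :+ e′ :+ x :* (s :+ t) := e :+ x :* s :+ (e′ :+ x :* t)) refl (eval f x) (eval g x) x (deval f x) (deval g x))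

  deval-scale : ∀ b f x → deval (List.map (b *_) f) x ≈ b * deval f x
  deval-scale b []      x = sym (zeroʳ b)
  deval-scale b (a ∷ f) x = trans (+-cong (eval-scale b f x) (*-congˡ (deval-scale b f x)))
    (solve 4 (λ a b x s → b :* a :+ x :* (b :* s) := b :* (a :+ x :* s)) refl (eval f x) b x (deval f x))

  deval-* : ∀ f g x → deval (f *ₚ g) x ≈ deval f x * eval g x + eval f x * deval g x
  deval-* []      g x = solve 2 (λ s t → con (+ 0) := con (+ 0) :* s :+ con (+ 0) :* t) refl (eval g x) (deval g x)
  deval-* (a ∷ f) g x = begin
    deval (List.map (a *_) g +ₚ (0# ∷ f *ₚ g)) x  ≈⟨ deval-+ (List.map (a *_) g) (0# ∷ f *ₚ g) x ⟩
    deval (List.map (a *_) g) x + (eval (f *ₚ g) x + x * deval (f *ₚ g) x)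
      ≈⟨ +-cong (deval-scale a g x) (+-cong (eval-* f g x) (*-congˡ (deval-* f g x))) ⟩
    a * deval g x + (eval f x * eval g x + x * (deval f x * eval g x + eval f x * deval g x))
      ≈⟨ solve 6 (λ a x s s′ t t′ → a :* t′ :+ (s :* t :+ x :* (s′ :* t :+ s :* t′)) := (s :+ x :* s′) :* t :+ (a :+ x :* s) :* t′)
           refl a x (eval f x) (deval f x) (eval g x) (deval g x) ⟩
    (eval f x + x * deval f x) * eval g x + (a + x * eval f x) * deval g x  ∎

  deriv : Poly → Poly
  deriv []      = []
  deriv (a ∷ f) = f +ₚ (0# ∷ deriv f)

  eval-deriv : ∀ f x → eval (deriv f) x ≈ deval f x
  eval-deriv []      x = refl
  eval-deriv (a ∷ f) x = trans (eval-+ f (0# ∷ deriv f) x) (+-congˡ (trans (+-identityˡ _) (*-congˡ (eval-deriv f x))))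

  module _ (F : Subfield) where
    open Subfield F

    over-+ : ∀ {f g} → Over F f → Over F g → Over F (f +ₚ g)
    over-+ []        g∈        = g∈
    over-+ (a∈ ∷ f∈) []        = a∈ ∷ f∈
    over-+ (a∈ ∷ f∈) (b∈ ∷ g∈) = +-closed a∈ b∈ ∷ over-+ f∈ g∈

    over-scale : ∀ {b f} → b ∈ᶠ F → Over F f → Over F (List.map (b *_) f)
    over-scale b∈ []        = []
    over-scale b∈ (a∈ ∷ f∈) = *-closed b∈ a∈ ∷ over-scale b∈ f∈

    over-* : ∀ {f g} → Over F f → Over F g → Over F (f *ₚ g)
    over-* []        g∈ = []
    over-* (a∈ ∷ f∈) g∈ = over-+ (over-scale a∈ g∈) (0#-closed ∷ over-* f∈ g∈)

    over-deriv : ∀ {f} → Over F f → Over F (deriv f)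
    over-deriv []        = []
    over-deriv (a∈ ∷ f∈) = over-+ f∈ (0#-closed ∷ over-deriv f∈)

    coeff∈ : ∀ {f} → Over F f → ∀ n → coeff f n ∈ᶠ F
    coeff∈ []        n       = 0#-closed
    coeff∈ (a∈ ∷ f∈) zero    = a∈
    coeff∈ (a∈ ∷ f∈) (suc n) = coeff∈ f∈ n

    eval-closed : ∀ {f x} → Over F f → x ∈ᶠ F → eval f x ∈ᶠ F
    eval-closed []        x∈ = 0#-closed
    eval-closed (a∈ ∷ f∈) x∈ = +-closed a∈ (*-closed x∈ (eval-closed f∈ x∈))

  over-mono : ∀ {F E f} → F ⊑ E → Over F f → Over E f
  over-mono F⊑E = All.map F⊑E

  degree-exists : ∀ f → (∀ n → coeff f n ≈ 0#) ⊎ ∃ (DegreeIs f)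
  degree-exists []      = inj₁ λ _ → refl
  degree-exists (a ∷ f) with degree-exists f
  ... | inj₂ (n , lead , above) = inj₂ (suc n , lead , λ { (suc m) (s≤s n<m) → above m n<m })
  ... | inj₁ f≈0 with em {P = a ≈ 0#}
  ... | yes a≈0 = inj₁ λ { zero → a≈0 ; (suc n) → f≈0 n }
  ... | no  a≉0 = inj₂ (0 , a≉0 , λ { (suc m) _ → f≈0 m })

  -- Synthetic division by X - a
  quot : Carrier → Poly → Poly
  quot a []      = []
  quot a (b ∷ f) = eval f a ∷ quot a f

  coeff-zero-quot : ∀ a f → coeff f 0 ≈ eval f a - a * coeff (quot a f) 0
  coeff-zero-quot a []      = solve 1 (λ a → con (+ 0) := con (+ 0) :- a :* con (+ 0)) refl a
  coeff-zero-quot a (b ∷ f) = solve 3 (λ a b s → b := (b :+ a :* s) :- a :* s) refl a b (eval f a)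

  coeff-suc-quot : ∀ a f n → coeff f (suc n) ≈ coeff (quot a f) n - a * coeff (quot a f) (suc n)
  coeff-suc-quot a []      n       = solve 1 (λ a → con (+ 0) := con (+ 0) :- a :* con (+ 0)) refl a
  coeff-suc-quot a (b ∷ f) zero    = coeff-zero-quot a f
  coeff-suc-quot a (b ∷ f) (suc n) = coeff-suc-quot a f n

  quot-above : ∀ {a} n f → (∀ m → n ℕ.< m → coeff f m ≈ 0#) → ∀ m → n ℕ.≤ m → coeff (quot a f) m ≈ 0#
  quot-above n       []      h m       n≤m       = refl
  quot-above zero    (b ∷ f) h zero    n≤m       = eval-≈0 f λ k → h (suc k) (s≤s z≤n)
  quot-above zero    (b ∷ f) h (suc m) n≤m       = quot-above zero f (λ k _ → h (suc k) (s≤s z≤n)) m z≤n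
  quot-above (suc n) (b ∷ f) h (suc m) (s≤s n≤m) = quot-above n f (λ k n<k → h (suc k) (s≤s n<k)) m n≤m

  quot-lead : ∀ {a} n f → (∀ m → suc n ℕ.< m → coeff f m ≈ 0#) → coeff (quot a f) n ≈ coeff f (suc n)
  quot-lead {a} n f above = begin
    coeff (quot a f) n                                  ≈⟨ solve 2 (λ a q → q := q :- a :* con (+ 0)) refl a (coeff (quot a f) n) ⟩
    coeff (quot a f) n - a * 0#                         ≈⟨ +-congˡ (-‿cong (*-congˡ (quot-above (suc n) f above (suc n) ℕ.≤-refl))) ⟨
    coeff (quot a f) n - a * coeff (quot a f) (suc n)   ≈⟨ coeff-suc-quot a f n ⟨
    coeff f (suc n)                                     ∎

  -- Differentiating `f = (X - a) q + f(a)` at `a` leaves `q(a)`.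
  eval-quot : ∀ a f → eval (quot a f) a ≈ deval f a
  eval-quot a []      = refl
  eval-quot a (b ∷ f) = +-congˡ (*-congˡ (eval-quot a f))

  coeff-zero-X-* : ∀ a g → coeff ((X- a) *ₚ g) 0 ≈ - a * coeff g 0
  coeff-zero-X-* a g = trans (coeff-+ (List.map (- a *_) g) (0# ∷ (1# ∷ []) *ₚ g) 0) (trans (+-congʳ (coeff-scale (- a) g 0)) (+-identityʳ _))

  coeff-suc-X-* : ∀ a g n → coeff ((X- a) *ₚ g) (suc n) ≈ coeff g n - a * coeff g (suc n)
  coeff-suc-X-* a g n = begin
    coeff ((X- a) *ₚ g) (suc n)
      ≈⟨ coeff-+ (List.map (- a *_) g) (0# ∷ (1# ∷ []) *ₚ g) (suc n) ⟩
    coeff (List.map (- a *_) g) (suc n) + coeff (List.map (1# *_) g +ₚ (0# ∷ [])) n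
      ≈⟨ +-cong (coeff-scale (- a) g (suc n)) (trans (coeff-+ (List.map (1# *_) g) (0# ∷ []) n) (+-cong (coeff-scale 1# g n) (coeff-0∷[] n))) ⟩
    - a * coeff g (suc n) + (1# * coeff g n + 0#)
      ≈⟨ solve 3 (λ a s t → :- a :* s :+ (con (+ 1) :* t :+ con (+ 0)) := t :- a :* s) refl a (coeff g (suc n)) (coeff g n) ⟩
    coeff g n - a * coeff g (suc n)  ∎

  factor : ∀ {a} f → eval f a ≈ 0# → f ≋ (X- a) *ₚ quot a f
  factor {a} f fa≈0 zero = begin
    coeff f 0                           ≈⟨ coeff-zero-quot a f ⟩
    eval f a - a * coeff (quot a f) 0   ≈⟨ +-congʳ fa≈0 ⟩
    0# - a * coeff (quot a f) 0         ≈⟨ solve 2 (λ a q → con (+ 0) :- a :* q := :- a :* q) refl a (coeff (quot a f) 0) ⟩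
    - a * coeff (quot a f) 0            ≈⟨ coeff-zero-X-* a (quot a f) ⟨
    coeff ((X- a) *ₚ quot a f) 0        ∎
  factor {a} f fa≈0 (suc n) = trans (coeff-suc-quot a f n) (sym (coeff-suc-X-* a (quot a f) n))

  eval-X- : ∀ a x → eval (X- a) x ≈ x - a
  eval-X- a x = solve 2 (λ a x → :- a :+ x :* (con (+ 1) :+ x :* con (+ 0)) := x :- a) refl a x

  division : ∀ {F f m} → Over F f → coeff f m ≈ 1# → (∀ n → m ℕ.< n → coeff f n ≈ 0#) → ∀ {g} → Over F g →
             ∃[ k ] ∃[ r ] Over F k × Over F r × g ≋ k *ₚ f +ₚ r × (∀ n → m ℕ.≤ n → coeff r n ≈ 0#)
  division {f = f} f∈ lead above [] = [] , [] , [] , [] , (λ n → refl) , (λ n _ → refl)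
  division {F} {f} {m} f∈ lead above {c ∷ g} (c∈ ∷ g∈) with division {F} {f} {m} f∈ lead above g∈
  ... | k , r , k∈ , r∈ , g≋ , r-small = b ∷ k , (c ∷ r) +ₚ List.map (- b *_) f , b∈ ∷ k∈ ,
      over-+ F (c∈ ∷ r∈) (over-scale F (Subfield.neg-closed F b∈) f∈) , eq , small
    where
    -- Multiplying the recursive identity by `X` and adding `c` leaves the remainder `c ∷ r` of
    -- degree at most `m`. Its coefficient `b` there is removed by subtracting `b f`, as `f` is
    -- monic, and becomes the constant term of the quotient.
    b : Carrier
    b = coeff (c ∷ r) m
    b∈ : b ∈ᶠ F
    b∈ = coeff∈ F (c∈ ∷ r∈) m
    coeff-r′ : ∀ n → coeff ((c ∷ r) +ₚ List.map (- b *_) f) n ≈ coeff (c ∷ r) n - b * coeff f n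
    coeff-r′ n = trans (coeff-+ (c ∷ r) (List.map (- b *_) f) n) (+-congˡ (trans (coeff-scale (- b) f n) (sym (-‿distribˡ-* b (coeff f n)))))
    step : ∀ n → coeff (c ∷ g) n ≈ coeff (0# ∷ k *ₚ f) n + coeff (c ∷ r) n
    step zero    = sym (+-identityˡ c)
    step (suc n) = trans (g≋ n) (coeff-+ (k *ₚ f) r n)
    eq : (c ∷ g) ≋ (List.map (b *_) f +ₚ (0# ∷ k *ₚ f)) +ₚ ((c ∷ r) +ₚ List.map (- b *_) f)
    eq n = begin
      coeff (c ∷ g) n  ≈⟨ step n ⟩
      coeff (0# ∷ k *ₚ f) n + coeff (c ∷ r) n
        ≈⟨ solve 4 (λ s t b u → s :+ t := b :* u :+ s :+ (t :- b :* u)) refl (coeff (0# ∷ k *ₚ f) n) (coeff (c ∷ r) n) b (coeff f n) ⟩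
      b * coeff f n + coeff (0# ∷ k *ₚ f) n + (coeff (c ∷ r) n - b * coeff f n)
        ≈⟨ +-cong (trans (coeff-+ (List.map (b *_) f) (0# ∷ k *ₚ f) n) (+-congʳ (coeff-scale b f n))) (coeff-r′ n) ⟨
      coeff (List.map (b *_) f +ₚ (0# ∷ k *ₚ f)) n + coeff ((c ∷ r) +ₚ List.map (- b *_) f) n
        ≈⟨ coeff-+ (List.map (b *_) f +ₚ (0# ∷ k *ₚ f)) ((c ∷ r) +ₚ List.map (- b *_) f) n ⟨
      coeff ((List.map (b *_) f +ₚ (0# ∷ k *ₚ f)) +ₚ ((c ∷ r) +ₚ List.map (- b *_) f)) n  ∎
    c∷r-above : ∀ n → m ℕ.< n → coeff (c ∷ r) n ≈ 0#
    c∷r-above (suc n) (s≤s m≤n) = r-small n m≤n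
    small : ∀ n → m ℕ.≤ n → coeff ((c ∷ r) +ₚ List.map (- b *_) f) n ≈ 0#
    small n m≤n with ℕ.m≤n⇒m<n∨m≡n m≤n
    ... | inj₁ m<n = trans (coeff-r′ n) (trans (+-cong (c∷r-above n m<n) (-‿cong (*-congˡ (above n m<n))))
                       (solve 1 (λ b → con (+ 0) :- b :* con (+ 0) := con (+ 0)) refl b))
    ... | inj₂ ≡.refl = trans (coeff-r′ n) (trans (+-congˡ (-‿cong (trans (*-congˡ lead) (*-identityʳ b)))) (x≈y⇒x∙y⁻¹≈ε refl))

  coeff-∷-* : ∀ a f g n → coeff ((a ∷ f) *ₚ g) n ≈ a * coeff g n + coeff (0# ∷ f *ₚ g) n
  coeff-∷-* a f g n = trans (coeff-+ (List.map (a *_) g) (0# ∷ f *ₚ g) n) (+-congʳ (coeff-scale a g n))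

  coeff-+-* : ∀ f g h n → coeff ((f +ₚ g) *ₚ h) n ≈ coeff (f *ₚ h) n + coeff (g *ₚ h) n
  coeff-+-* []      g       h n = sym (+-identityˡ _)
  coeff-+-* (a ∷ f) []      h n = sym (+-identityʳ _)
  coeff-+-* (a ∷ f) (b ∷ g) h n = begin
    coeff ((a + b ∷ f +ₚ g) *ₚ h) n                        ≈⟨ coeff-∷-* (a + b) (f +ₚ g) h n ⟩
    (a + b) * coeff h n + coeff (0# ∷ (f +ₚ g) *ₚ h) n     ≈⟨ +-congˡ (shifted n) ⟩
    (a + b) * coeff h n + (coeff (0# ∷ f *ₚ h) n + coeff (0# ∷ g *ₚ h) n)
      ≈⟨ solve 5 (λ a b h s t → (a :+ b) :* h :+ (s :+ t) := a :* h :+ s :+ (b :* h :+ t)) refl a b (coeff h n) _ _ ⟩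
    a * coeff h n + coeff (0# ∷ f *ₚ h) n + (b * coeff h n + coeff (0# ∷ g *ₚ h) n)
      ≈⟨ +-cong (coeff-∷-* a f h n) (coeff-∷-* b g h n) ⟨
    coeff ((a ∷ f) *ₚ h) n + coeff ((b ∷ g) *ₚ h) n        ∎
    where
    shifted : ∀ n → coeff (0# ∷ (f +ₚ g) *ₚ h) n ≈ coeff (0# ∷ f *ₚ h) n + coeff (0# ∷ g *ₚ h) n
    shifted zero    = sym (+-identityʳ 0#)
    shifted (suc n) = coeff-+-* f g h n

  coeff-scale-* : ∀ a f h n → coeff (List.map (a *_) f *ₚ h) n ≈ a * coeff (f *ₚ h) n
  coeff-scale-* a []      h n = sym (zeroʳ a)
  coeff-scale-* a (b ∷ f) h n = begin
    coeff ((a * b ∷ List.map (a *_) f) *ₚ h) n                        ≈⟨ coeff-∷-* (a * b) (List.map (a *_) f) h n ⟩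
    a * b * coeff h n + coeff (0# ∷ List.map (a *_) f *ₚ h) n         ≈⟨ +-congˡ (shifted n) ⟩
    a * b * coeff h n + a * coeff (0# ∷ f *ₚ h) n
      ≈⟨ solve 4 (λ a b h s → a :* b :* h :+ a :* s := a :* (b :* h :+ s)) refl a b (coeff h n) _ ⟩
    a * (b * coeff h n + coeff (0# ∷ f *ₚ h) n)                       ≈⟨ *-congˡ (coeff-∷-* b f h n) ⟨
    a * coeff ((b ∷ f) *ₚ h) n                                        ∎
    where
    shifted : ∀ n → coeff (0# ∷ List.map (a *_) f *ₚ h) n ≈ a * coeff (0# ∷ f *ₚ h) n
    shifted zero    = sym (zeroʳ a)
    shifted (suc n) = coeff-scale-* a f h n

  *ₚ-assoc : ∀ f g h → (f *ₚ g) *ₚ h ≋ f *ₚ (g *ₚ h)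
  *ₚ-assoc []      g h n = refl
  *ₚ-assoc (a ∷ f) g h n = begin
    coeff ((List.map (a *_) g +ₚ (0# ∷ f *ₚ g)) *ₚ h) n                   ≈⟨ coeff-+-* (List.map (a *_) g) (0# ∷ f *ₚ g) h n ⟩
    coeff (List.map (a *_) g *ₚ h) n + coeff ((0# ∷ f *ₚ g) *ₚ h) n       ≈⟨ +-cong (coeff-scale-* a g h n) (coeff-∷-* 0# (f *ₚ g) h n) ⟩
    a * coeff (g *ₚ h) n + (0# * coeff h n + coeff (0# ∷ f *ₚ g *ₚ h) n)  ≈⟨ +-congˡ (trans (+-congʳ (zeroˡ _)) (+-identityˡ _)) ⟩
    a * coeff (g *ₚ h) n + coeff (0# ∷ f *ₚ g *ₚ h) n                     ≈⟨ +-congˡ (shifted n) ⟩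
    a * coeff (g *ₚ h) n + coeff (0# ∷ f *ₚ (g *ₚ h)) n                   ≈⟨ coeff-∷-* a f (g *ₚ h) n ⟨
    coeff ((a ∷ f) *ₚ (g *ₚ h)) n                                         ∎
    where
    shifted : ∀ n → coeff (0# ∷ f *ₚ g *ₚ h) n ≈ coeff (0# ∷ f *ₚ (g *ₚ h)) n
    shifted zero    = refl
    shifted (suc n) = *ₚ-assoc f g h n

  X-*-cong : ∀ a f g → f ≋ g → (X- a) *ₚ f ≋ (X- a) *ₚ g
  X-*-cong a f g f≋g zero    = trans (coeff-zero-X-* a f) (trans (*-congˡ (f≋g 0)) (sym (coeff-zero-X-* a g)))
  X-*-cong a f g f≋g (suc n) = trans (coeff-suc-X-* a f n)
    (trans (+-cong (f≋g n) (-‿cong (*-congˡ (f≋g (suc n))))) (sym (coeff-suc-X-* a g n)))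

  -- The quotient of `f` by `X - a` takes the value of the derivative at `a`, so it has the factor
  -- `X - a` too. Associativity brings the product into the form of `HasMultipleRoot`, where the two
  -- linear factors are multiplied first.
  multiple-root : ∀ f {a} → eval f a ≈ 0# → deval f a ≈ 0# → HasMultipleRoot f
  multiple-root f {a} fa≈0 f′a≈0 = a , q₂ , λ n → trans (factor f fa≈0 n)
    (trans (X-*-cong a q₁ ((X- a) *ₚ q₂) (factor q₁ (trans (eval-quot a f) f′a≈0)) n) (sym (*ₚ-assoc (X- a) (X- a) q₂ n)))
    where
    q₁ q₂ : Poly
    q₁ = quot a f
    q₂ = quot a q₁

  multiple-root⁻¹ : ∀ f → HasMultipleRoot f → ∃[ a ] eval f a ≈ 0# × deval f a ≈ 0#
  multiple-root⁻¹ f (a , g , f≋) = a , fa≈0 , f′a≈0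
    where
    X₂ : Poly
    X₂ = (X- a) *ₚ (X- a)
    a-a : eval (X- a) a ≈ 0#
    a-a = trans (eval-X- a a) (x≈y⇒x∙y⁻¹≈ε refl)
    X₂≈0 : eval X₂ a ≈ 0#
    X₂≈0 = trans (eval-* (X- a) (X- a) a) (trans (*-congʳ a-a) (zeroˡ _))
    X₂′≈0 : deval X₂ a ≈ 0#
    X₂′≈0 = trans (deval-* (X- a) (X- a) a) (trans (+-cong (*-congˡ a-a) (*-congʳ a-a))
      (solve 1 (λ s → s :* con (+ 0) :+ con (+ 0) :* s := con (+ 0)) refl (deval (X- a) a)))
    fa≈0 : eval f a ≈ 0#
    fa≈0 = trans (eval-cong f (X₂ *ₚ g) f≋) (trans (eval-* X₂ g a) (trans (*-congʳ X₂≈0) (zeroˡ _)))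
    f′a≈0 : deval f a ≈ 0#
    f′a≈0 = trans (deval-cong f (X₂ *ₚ g) f≋) (trans (deval-* X₂ g a) (trans (+-cong (*-congʳ X₂′≈0) (*-congʳ X₂≈0))
      (solve 2 (λ s t → con (+ 0) :* s :+ con (+ 0) :* t := con (+ 0)) refl (eval g a) (deval g a))))

  prodX : List Carrier → Poly
  prodX zs = List.foldr _*ₚ_ (1# ∷ []) (List.map X-_ zs)

  prodX-root : ∀ {q} {P : Pred Carrier q} → P Respects _≈_ → ∀ {zs x} → All P zs → eval (prodX zs) x ≈ 0# → P x
  prodX-root P-resp {[]} {x} [] eq = contradiction (trans (sym (trans (+-congˡ (zeroʳ x)) (+-identityʳ 1#))) eq) 1≉0
  prodX-root P-resp {z ∷ zs} {x} (z∈ ∷ zs∈) eq with em {P = eval (X- z) x ≈ 0#}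
  ... | yes x-z≈0 = P-resp (sym (x-y≈0⇒x≈y (trans (sym (eval-X- z x)) x-z≈0))) z∈
  ... | no  x-z≉0 = prodX-root P-resp zs∈ (cancel-≉0 (trans (sym (eval-* (X- z) (prodX zs) x)) eq) x-z≉0)

  -- The scalar factor of a nonzero split polynomial is nonzero, so a root annihilates the product
  -- of the linear factors and is one of the listed roots.
  splits-root : ∀ {N f n x} → DegreeIs f n → SplitsOver N f → eval f x ≈ 0# → x ∈ᶠ N
  splits-root {N} {f} {n} {x} (lead , _) (a , zs , _ , zs∈ , f≋) fx≈0 = prodX-root (Subfield.resp N) zs∈ (cancel-≉0 eq a≉0)
    where
    eq : a * eval (prodX zs) x ≈ 0#
    eq = begin
      a * eval (prodX zs) x                      ≈⟨ *-congʳ (trans (+-congˡ (zeroʳ x)) (+-identityʳ a)) ⟨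
      eval (a ∷ []) x * eval (prodX zs) x        ≈⟨ eval-* (a ∷ []) (prodX zs) x ⟨
      eval ((a ∷ []) *ₚ prodX zs) x              ≈⟨ eval-cong f ((a ∷ []) *ₚ prodX zs) f≋ ⟨
      eval f x                                   ≈⟨ fx≈0 ⟩
      0#                                         ∎
    a≉0 : ¬ a ≈ 0#
    a≉0 a≈0 = lead (trans (f≋ n) (trans (coeff-∷-* a [] (prodX zs) n) (trans (+-cong (trans (*-congʳ a≈0) (zeroˡ _)) (coeff-0∷[] n)) (+-identityʳ 0#))))

  -- All roots of f lie in N, so its coefficients do, K̄ being algebraically closed.
  roots⇒coeff∈ : ∀ {N} m f → coeff f m ≈ 1# → (∀ n → m ℕ.< n → coeff f n ≈ 0#) →
                 (∀ {z} → eval f z ≈ 0# → z ∈ᶠ N) → ∀ n → coeff f n ∈ᶠ N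
  roots⇒coeff∈ {N} zero f lead above roots∈ zero    = Subfield.resp N (sym lead) (Subfield.1#-closed N)
  roots⇒coeff∈ {N} zero f lead above roots∈ (suc n) = Subfield.resp N (sym (above (suc n) (s≤s z≤n))) (Subfield.0#-closed N)
  roots⇒coeff∈ {N} (suc m) f lead above roots∈ n with algebraicallyClosed f m ((λ eq → 1≉0 (trans (sym lead) eq)) , above)
  ... | z , fz≈0 = Subfield.resp N (sym (f≋ n)) (X-*∈ n)
    where
    module N = Subfield N
    f≋ : f ≋ (X- z) *ₚ quot z f
    f≋ = factor f fz≈0
    z∈ : z ∈ᶠ N
    z∈ = roots∈ fz≈0
    q∈ : ∀ n → coeff (quot z f) n ∈ᶠ N
    q∈ = roots⇒coeff∈ {N} m (quot z f) (trans (quot-lead m f above) lead) (quot-above (suc m) f above) λ {y} qy≈0 →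
      roots∈ (trans (eval-cong f ((X- z) *ₚ quot z f) f≋) (trans (eval-* (X- z) (quot z f) y) (trans (*-congˡ qy≈0) (zeroʳ _))))
    X-*∈ : ∀ n → coeff ((X- z) *ₚ quot z f) n ∈ᶠ N
    X-*∈ zero    = N.resp (sym (coeff-zero-X-* z (quot z f))) (N.*-closed (N.neg-closed z∈) (q∈ 0))
    X-*∈ (suc n) = N.resp (sym (coeff-suc-X-* z (quot z f) n)) (sub-closed N (q∈ n) (N.*-closed z∈ (q∈ (suc n))))

  -- Minimal polynomials

  powers : Carrier → ∀ m → Vector Carrier m
  powers x m i = x ^ toℕ i

  eval-lin : ∀ m f {x} → (∀ n → m ℕ.≤ n → coeff f n ≈ 0#) → eval f x ≈ lin (λ i → coeff f (toℕ i)) (powers x m)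
  eval-lin zero    f       small = eval-≈0 f λ n → small n z≤n
  eval-lin (suc m) []      {x} small = sym (lin-0 {a = λ _ → 0#} (powers x (suc m)) λ _ → refl)
  eval-lin (suc m) (a ∷ f) {x} small = +-cong (sym (*-identityʳ a))
    (trans (*-congˡ (eval-lin m f (λ n m≤n → small (suc n) (s≤s m≤n))))
           (sym (lin-*ʳ x (λ i → coeff f (toℕ i)) (powers x m))))

  tabulate-coeff : ∀ {m} (a : Vector Carrier m) i → coeff (List.tabulate a) (toℕ i) ≡ a i
  tabulate-coeff a zero    = ≡.refl
  tabulate-coeff a (suc i) = tabulate-coeff (a ∘ suc) i

  tabulate-small : ∀ {m} (a : Vector Carrier m) n → m ℕ.≤ n → coeff (List.tabulate a) n ≈ 0#
  tabulate-small {zero}  a n       _         = refl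
  tabulate-small {suc m} a (suc n) (s≤s m≤n) = tabulate-small (a ∘ suc) n m≤n

  eval-tabulate : ∀ {m} (a : Vector Carrier m) x → eval (List.tabulate a) x ≈ lin a (powers x m)
  eval-tabulate {m} a x = trans (eval-lin m (List.tabulate a) (tabulate-small a))
    (lin-cong {b = a} {powers x m} (λ i → reflexive (tabulate-coeff a i)) (λ _ → refl))

  minimal-polynomial : ∀ F → K ⊑ F → ∀ x → ∃ (MinimalPolynomial F x)
  minimal-polynomial F K⊑F x with algebraic x
  ... | f , n , f∈ , degree , fx≈0 = monic (least em Killed (n , f , over-mono {K} {F} K⊑F f∈ , degree , fx≈0))
    where
    Killed : ℕ → Set p
    Killed n = ∃[ f ] Over F f × DegreeIs f n × eval f x ≈ 0#
    monic : (∃[ n ] Killed n × (∀ {m} → Killed m → n ℕ.≤ m)) → ∃ (MinimalPolynomial F x)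
    monic (n , (f , f∈ , (lead , above) , fx≈0) , minimal) with inverse lead
    ... | b , lead*b≈1 = List.map (b *_) f , record
      { over    = over-scale F (Subfield.inv-closed F (coeff∈ F f∈ n) lead*b≈1) f∈
      ; deg     = n
      ; hasDeg  = (λ eq → 1≉0 (trans (sym lead≈1) eq)) , λ m n<m → trans (coeff-scale b f m) (trans (*-congˡ (above m n<m)) (zeroʳ b))
      ; monic   = lead≈1
      ; root    = trans (eval-scale b f x) (trans (*-congˡ fx≈0) (zeroʳ b))
      ; minimal = λ {g} g∈ degree gx≈0 → minimal (g , g∈ , degree , gx≈0)
      }
      where
      lead≈1 : coeff (List.map (b *_) f) n ≈ 1#
      lead≈1 = trans (coeff-scale b f n) (trans (*-comm b _) lead*b≈1)

  -- Division with remainder by `f`, which may be any monic polynomial over `F` that vanishes at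
  -- `x`. In `normal⇒adj` its degree is that of the minimal polynomial of `y ^ q`.
  eval∈powers : ∀ {F f m x} → Over F f → coeff f m ≈ 1# → (∀ n → m ℕ.< n → coeff f n ≈ 0#) → eval f x ≈ 0# →
                ∀ {g} → Over F g → eval g x ∈ Comb F (powers x m)
  eval∈powers {F} {f} {m} {x} f∈ lead above fx≈0 {g} g∈ with division {F} {f} {m} f∈ lead above g∈
  ... | k , r , _ , r∈ , g≋ , r-small = comb (λ i → coeff r (toℕ i)) (λ i → coeff∈ F r∈ (toℕ i)) (trans gx≈rx (eval-lin m r r-small))
    where
    gx≈rx : eval g x ≈ eval r x
    gx≈rx = begin
      eval g x                      ≈⟨ eval-cong g (k *ₚ f +ₚ r) g≋ ⟩
      eval (k *ₚ f +ₚ r) x          ≈⟨ eval-+ (k *ₚ f) r x ⟩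
      eval (k *ₚ f) x + eval r x    ≈⟨ +-congʳ (trans (eval-* k f x) (trans (*-congˡ fx≈0) (zeroʳ _))) ⟩
      0# + eval r x                 ≈⟨ +-identityˡ _ ⟩
      eval r x                      ∎

  module MinPoly {F : Subfield} {x : Carrier} {f : Poly} (mp : MinimalPolynomial F x f) where
    open MinimalPolynomial mp

    small-zero : ∀ {r} → Over F r → (∀ n → deg ℕ.≤ n → coeff r n ≈ 0#) → eval r x ≈ 0# → ∀ n → coeff r n ≈ 0#
    small-zero {r} r∈ small rx≈0 with degree-exists r
    ... | inj₁ r≈0 = r≈0
    ... | inj₂ (d , lead , above) = contradiction (small d (minimal r∈ (lead , above) rx≈0)) lead

    divides′ : ∀ {g} → Over F g → eval g x ≈ 0# → ∃[ k ] g ≋ k *ₚ f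
    divides′ {g} g∈ gx≈0 with division {F} {f} {deg} over monic (proj₂ hasDeg) g∈
    ... | k , r , _ , r∈ , g≋ , r-small = k , λ n → trans (g≋ n) (trans (coeff-+ (k *ₚ f) r n)
        (trans (+-congˡ (small-zero r∈ r-small rx≈0 n)) (+-identityʳ _)))
      where
      rx≈0 : eval r x ≈ 0#
      rx≈0 = begin
        eval r x                      ≈⟨ +-identityˡ _ ⟨
        0# + eval r x                 ≈⟨ +-congʳ (trans (eval-* k f x) (trans (*-congˡ root) (zeroʳ _))) ⟨
        eval (k *ₚ f) x + eval r x    ≈⟨ eval-+ (k *ₚ f) r x ⟨
        eval (k *ₚ f +ₚ r) x          ≈⟨ eval-cong g (k *ₚ f +ₚ r) g≋ ⟨
        eval g x                      ≈⟨ gx≈0 ⟩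
        0#                            ∎

    divides-root : ∀ {g} → Over F g → eval g x ≈ 0# → ∀ {a} → eval f a ≈ 0# → eval g a ≈ 0#
    divides-root {g} g∈ gx≈0 {a} fa≈0 with divides′ g∈ gx≈0
    ... | k , g≋ = trans (eval-cong g (k *ₚ f) g≋) (trans (eval-* k f a) (trans (*-congˡ fa≈0) (zeroʳ _)))

    divides-double : ∀ {g} → Over F g → eval g x ≈ 0# → ∀ {a} → eval f a ≈ 0# → deval f a ≈ 0# → deval g a ≈ 0#
    divides-double {g} g∈ gx≈0 {a} fa≈0 f′a≈0 with divides′ g∈ gx≈0
    ... | k , g≋ = trans (deval-cong g (k *ₚ f) g≋) (trans (deval-* k f a) (trans (+-cong (*-congˡ fa≈0) (*-congˡ f′a≈0))
      (solve 2 (λ s t → s :* con (+ 0) :+ t :* con (+ 0) := con (+ 0)) refl (deval k a) (eval k a))))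

    powers-li : LinearlyIndependent F (powers x deg)
    powers-li a a∈ eq i = trans (sym (reflexive (tabulate-coeff a i)))
      (small-zero (All.tabulate⁺ a∈) (tabulate-small a) (trans (eval-tabulate a x) eq) (toℕ i))

    deg≢0 : ¬ deg ≡ 0
    deg≢0 deg≡0 = 1≉0 (begin
      1#                                              ≈⟨ monic ⟨
      coeff f deg                                     ≈⟨ reflexive (≡.cong (coeff f) deg≡0) ⟩
      coeff f 0                                       ≈⟨ trans (+-identityʳ _) (*-identityʳ _) ⟨
      lin (λ i → coeff f (toℕ i)) (powers x 1)        ≈⟨ eval-lin 1 f (λ n 1≤n → proj₂ hasDeg n (≡.subst (ℕ._< n) (≡.sym deg≡0) 1≤n)) ⟨
      eval f x                                        ≈⟨ root ⟩
      0#                                              ∎)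

  -- The ring `F[y]`, which is the field `F(y)` once `F` contains `K`. In characteristic `q`,
  -- separability is used in the form that `y` lies in `K[y^q]`.
  record Adj (F : Subfield) (y x : Carrier) : Set p where
    constructor adj
    field
      poly : Poly
      over : Over F poly
      eq   : x ≈ eval poly y

  adj-subspace : ∀ F y → IsSubspace F (Adj F y)
  adj-subspace F y = record
    { resp  = λ { x≈x′ (adj f f∈ x≈) → adj f f∈ (trans (sym x≈x′) x≈) }
    ; 0∈    = adj [] [] refl
    ; +∈    = λ { (adj f f∈ x≈) (adj g g∈ z≈) → adj (f +ₚ g) (over-+ F f∈ g∈) (trans (+-cong x≈ z≈) (sym (eval-+ f g y))) }
    ; scale = λ { {a} a∈ (adj f f∈ x≈) → adj (List.map (a *_) f) (over-scale F a∈ f∈) (trans (*-congˡ x≈) (sym (eval-scale a f y))) }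
    }

  adj-subalgebra : ∀ F → K ⊑ F → ∀ y → IsSubalgebra (Adj F y)
  adj-subalgebra F K⊑F y = record
    { subspace = restrict-scalars {K} {F} K⊑F (adj-subspace F y)
    ; 1∈       = adj (1# ∷ []) (Subfield.1#-closed F ∷ []) (sym (trans (+-congˡ (zeroʳ y)) (+-identityʳ 1#)))
    ; *∈       = λ { (adj f f∈ x≈) (adj g g∈ z≈) → adj (f *ₚ g) (over-* F f∈ g∈) (trans (*-cong x≈ z≈) (sym (eval-* f g y))) }
    }

  adj-⊇ : ∀ F {y x} → x ∈ᶠ F → Adj F y x
  adj-⊇ F {y} {x} x∈ = adj (x ∷ []) (x∈ ∷ []) (sym (trans (+-congˡ (zeroʳ y)) (+-identityʳ x)))

  adj-∋ : ∀ F {y} → Adj F y y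
  adj-∋ F {y} = adj (0# ∷ 1# ∷ []) (Subfield.0#-closed F ∷ Subfield.1#-closed F ∷ [])
    (solve 1 (λ y → y := con (+ 0) :+ y :* (con (+ 1) :+ y :* con (+ 0))) refl y)

  adj-least : ∀ {F y} E → F ⊑ E → y ∈ᶠ E → Adj F y ⊆ mem E
  adj-least E F⊑E y∈ (adj f f∈ x≈) = Subfield.resp E (sym x≈) (eval-closed E (All.map F⊑E f∈) y∈)

  comb⇒adj : ∀ {F y} m → Comb F (powers y m) ⊆ Adj F y
  comb⇒adj {F} {y} m (comb a a∈ x≈) = adj (List.tabulate a) (All.tabulate⁺ a∈) (trans x≈ (sym (eval-tabulate a y)))

  adjoin-field : ∀ F → K ⊑ F → Carrier → Subfield
  adjoin-field F K⊑F y = IsSubalgebra.toSubfield (adj-subalgebra F K⊑F y)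

  -- Separable elements

  -- If f has a multiple root a, then f and so h vanishes doubly at a, whereas w h′ - 1, which
  -- vanishes at x for a suitable w over K, is also a multiple of f.
  simple-root⇒separable : ∀ {h x} → Over K h → eval h x ≈ 0# → ¬ deval h x ≈ 0# → Separable K x
  simple-root⇒separable {h} {x} h∈ hx≈0 h′x≉0 =
    f , proj₂ (minimal-polynomial K id x) , λ multiple → no-multiple (multiple-root⁻¹ f multiple)
    where
    f : Poly
    f = proj₁ (minimal-polynomial K id x)
    y : Carrier
    y = proj₁ (inverse h′x≉0)
    y∈ : Adj K x y
    y∈ = Subfield.inv-closed (adjoin-field K id x) (adj (deriv h) (over-deriv K h∈) (sym (eval-deriv h x))) (proj₂ (inverse h′x≉0))
    w u : Poly
    w = Adj.poly y∈
    u = (w *ₚ deriv h) +ₚ (- 1# ∷ [])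
    eval-u : ∀ a → eval u a ≈ eval w a * deval h a - 1#
    eval-u a = trans (eval-+ (w *ₚ deriv h) (- 1# ∷ []) a) (+-cong (trans (eval-* w (deriv h) a) (*-congˡ (eval-deriv h a)))
      (trans (+-congˡ (zeroʳ a)) (+-identityʳ _)))
    ux≈0 : eval u x ≈ 0#
    ux≈0 = trans (eval-u x) (x≈y⇒x∙y⁻¹≈ε (trans (*-congʳ (sym (Adj.eq y∈))) (trans (*-comm y _) (proj₂ (inverse h′x≉0)))))
    u∈ : Over K u
    u∈ = over-+ K (over-* K (Adj.over y∈) (over-deriv K h∈)) (Subfield.neg-closed K (Subfield.1#-closed K) ∷ [])
    open MinPoly (proj₂ (minimal-polynomial K id x))
    no-multiple : ¬ (∃[ a ] eval f a ≈ 0# × deval f a ≈ 0#)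
    no-multiple (a , fa≈0 , f′a≈0) = 1≉0 (begin
      1#                                ≈⟨ solve 1 (λ s → con (+ 1) := s :* con (+ 0) :- (s :* con (+ 0) :- con (+ 1))) refl (eval w a) ⟩
      eval w a * 0# - (eval w a * 0# - 1#)
        ≈⟨ +-congˡ (-‿cong (+-congʳ (*-congˡ (divides-double h∈ hx≈0 fa≈0 f′a≈0)))) ⟨
      eval w a * 0# - (eval w a * deval h a - 1#)
        ≈⟨ +-cong (zeroʳ _) (-‿cong (trans (sym (eval-u a)) (divides-root u∈ ux≈0 fa≈0))) ⟩
      0# - 0#                           ≈⟨ x≈y⇒x∙y⁻¹≈ε refl ⟩
      0#                                ∎)

  -- Separability in characteristic zero

  n·0≈0 : ∀ n → n · 0# ≈ 0#
  n·0≈0 zero    = refl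
  n·0≈0 (suc n) = trans (+-identityˡ _) (n·0≈0 n)

  coeff-deriv : ∀ f n → coeff (deriv f) n ≈ suc n · coeff f (suc n)
  coeff-deriv []      n       = sym (n·0≈0 (suc n))
  coeff-deriv (a ∷ f) zero    = coeff-+ f (0# ∷ deriv f) 0
  coeff-deriv (a ∷ f) (suc n) = trans (coeff-+ f (0# ∷ deriv f) (suc n)) (+-congˡ (coeff-deriv f n))

  Characteristic0 : Set ℓ₁
  Characteristic0 = ∀ n → Prime n → ¬ n · 1# ≈ 0#

  -- `Characteristic0` speaks of primes; a positive integer is a product of primes, and `K̄` has no
  -- zero divisors.
  characteristic0⇒·1≉0 : Characteristic0 → ∀ n → ¬ suc n · 1# ≈ 0#
  characteristic0⇒·1≉0 char0 n eq with factorise (suc n)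
  ... | record { factors = ps ; isFactorisation = n≡ ; factorsPrime = ps-prime } =
      product≉0 ps-prime (trans (reflexive (≡.cong (_· 1#) (≡.sym n≡))) eq)
    where
    product≉0 : ∀ {ps} → All Prime ps → ¬ product ps · 1# ≈ 0#
    product≉0 [] eq = 1≉0 (trans (sym (+-identityʳ 1#)) eq)
    product≉0 {q ∷ qs} (q-prime ∷ qs-prime) eq =
      product≉0 qs-prime (cancel-≉0 (trans (sym (×1-homo-* q (product qs))) eq) (char0 q q-prime))

  n·x≈n1*x : ∀ n x → n · x ≈ (n · 1#) * x
  n·x≈n1*x n x = sym (trans (×-assoc-* n 1# x) (×-congʳ n (*-identityˡ x)))

  -- The derivative of the minimal polynomial has degree one less, its leading coefficient being
  -- `deg · 1#`, so by minimality it does not vanish at `x`.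
  characteristic0⇒separable : Characteristic0 → ∀ x → Separable K x
  characteristic0⇒separable char0 x with minimal-polynomial K id x
  ... | f , mp = simple-root⇒separable over root λ f′x≈0 → go deg ≡.refl f′x≈0
    where
    open MinimalPolynomial mp
    go : ∀ d → deg ≡ d → ¬ deval f x ≈ 0#
    go zero    deg≡0 _ = MinPoly.deg≢0 mp deg≡0
    go (suc d) deg≡1+d f′x≈0 = ℕ.1+n≰n (≡.subst (ℕ._≤ d) deg≡1+d
      (minimal (over-deriv K over) (lead , above) (trans (eval-deriv f x) f′x≈0)))
      where
      lead : ¬ coeff (deriv f) d ≈ 0#
      lead eq = characteristic0⇒·1≉0 char0 d (begin
        suc d · 1#                   ≈⟨ ×-congʳ (suc d) (trans (sym (reflexive (≡.cong (coeff f) deg≡1+d))) monic) ⟨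
        suc d · coeff f (suc d)      ≈⟨ coeff-deriv f d ⟨
        coeff (deriv f) d            ≈⟨ eq ⟩
        0#                           ∎)
      above : ∀ m → d ℕ.< m → coeff (deriv f) m ≈ 0#
      above m d<m = trans (coeff-deriv f m) (trans (n·x≈n1*x (suc m) (coeff f (suc m)))
        (trans (*-congˡ (proj₂ hasDeg (suc m) (≡.subst (ℕ._< suc m) (≡.sym deg≡1+d) (s≤s d<m)))) (zeroʳ _)))

  -- Powers and monomials

  pow-≈0 : ∀ n {x} → x ^ n ≈ 0# → x ≈ 0#
  pow-≈0 zero    1≈0 = contradiction 1≈0 1≉0
  pow-≈0 (suc n) {x} x^1+n≈0 with em {P = x ≈ 0#}
  ... | yes x≈0 = x≈0
  ... | no  x≉0 = pow-≈0 n (cancel-≉0 x^1+n≈0 x≉0)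

  1^n≈1 : ∀ n → 1# ^ n ≈ 1#
  1^n≈1 zero    = refl
  1^n≈1 (suc n) = trans (*-identityˡ _) (1^n≈1 n)

  pow-closed : ∀ F {x} n → x ∈ᶠ F → x ^ n ∈ᶠ F
  pow-closed F zero    x∈ = Subfield.1#-closed F
  pow-closed F (suc n) x∈ = Subfield.*-closed F x∈ (pow-closed F n x∈)

  Xpow : ℕ → Poly
  Xpow zero    = 1# ∷ []
  Xpow (suc n) = 0# ∷ Xpow n

  eval-Xpow : ∀ n x → eval (Xpow n) x ≈ x ^ n
  eval-Xpow zero    x = trans (+-congˡ (zeroʳ x)) (+-identityʳ 1#)
  eval-Xpow (suc n) x = trans (+-identityˡ _) (*-congˡ (eval-Xpow n x))

  deval-Xpow : ∀ n x → deval (Xpow (suc n)) x ≈ suc n · x ^ n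
  deval-Xpow zero    x = solve 1 (λ x → (con (+ 1) :+ x :* con (+ 0)) :+ x :* (con (+ 0) :+ x :* con (+ 0)) := con (+ 1) :+ con (+ 0)) refl x
  deval-Xpow (suc n) x = +-cong (eval-Xpow (suc n) x) (trans (*-congˡ (deval-Xpow n x)) (×-comm-* (suc n) x (x ^ n)))

  over-Xpow : ∀ F n → Over F (Xpow n)
  over-Xpow F zero    = Subfield.1#-closed F ∷ []
  over-Xpow F (suc n) = Subfield.0#-closed F ∷ over-Xpow F n

  coeff-Xpow : ∀ n → coeff (Xpow n) n ≈ 1#
  coeff-Xpow zero    = refl
  coeff-Xpow (suc n) = coeff-Xpow n

  Xpow-above : ∀ n m → n ℕ.< m → coeff (Xpow n) m ≈ 0#
  Xpow-above zero    (suc m) n<m       = refl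
  Xpow-above (suc n) (suc m) (s≤s n<m) = Xpow-above n m n<m

  largest-unique : ∀ {P : Pred Carrier p} {E F} → LargestSubextension K P E F → largestSubextension K P E ≑ F
  largest-unique {P} {E} {F} L with em {P = ∃ (LargestSubextension K P E)}
  ... | yes (F′ , L′) = L.largest F′ L′.above L′.below L′.all , L′.largest F L.above L.below L.all
    where
    module L = LargestSubextension L
    module L′ = LargestSubextension L′
  ... | no ∄ = contradiction (F , L) ∄

  largest-resp : ∀ {P : Pred Carrier p} {E E′ F} → E ≑ E′ → LargestSubextension K P E F → LargestSubextension K P E′ F
  largest-resp (E⊑E′ , E′⊑E) L = record
    { above = above ; below = λ x∈ → E⊑E′ (below x∈) ; all = all
    ; largest = λ F′ K⊑F′ F′⊑E′ → largest F′ K⊑F′ (λ x∈ → E′⊑E (F′⊑E′ x∈)) }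
    where
    open LargestSubextension L

  li-++ˡ : ∀ {F m n} (u : Vector Carrier (m ℕ.+ n)) → LinearlyIndependent F u → LinearlyIndependent F (λ i → u (i ↑ˡ n))
  li-++ˡ {F} {m} {n} u li a a∈ eq i = trans (sym (reflexive (Vector.lookup-++ˡ a (λ _ → 0#) i)))
    (li (a ++ λ _ → 0#) (++-all (mem F) a∈ λ _ → Subfield.0#-closed F) eq′ (i ↑ˡ n))
    where
    eq′ : lin (a ++ λ _ → 0#) u ≈ 0#
    eq′ = begin
      lin (a ++ λ _ → 0#) u  ≈⟨ sum-split m (λ i → (a ++ λ _ → 0#) i * u i) ⟩
      lin (λ i → (a ++ λ _ → 0#) (i ↑ˡ n)) (λ i → u (i ↑ˡ n)) + lin (λ j → (a ++ λ _ → 0#) (m ↑ʳ j)) (λ j → u (m ↑ʳ j))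
        ≈⟨ +-cong (lin-cong {v = λ i → u (i ↑ˡ n)} (λ i → reflexive (Vector.lookup-++ˡ a (λ _ → 0#) i)) (λ _ → refl))
                  (lin-0 (λ j → u (m ↑ʳ j)) (λ j → reflexive (Vector.lookup-++ʳ a (λ _ → 0#) j))) ⟩
      lin a (λ i → u (i ↑ˡ n)) + 0#  ≈⟨ +-identityʳ _ ⟩
      lin a (λ i → u (i ↑ˡ n))       ≈⟨ eq ⟩
      0#                             ∎

  infixl 7 _⊓_
  _⊓_ : Subfield → Subfield → Subfield
  E ⊓ F = record
    { mem        = λ x → x ∈ᶠ E × x ∈ᶠ F
    ; resp       = λ eq (x∈E , x∈F) → E.resp eq x∈E , F.resp eq x∈F
    ; 0#-closed  = E.0#-closed , F.0#-closed
    ; 1#-closed  = E.1#-closed , F.1#-closed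
    ; +-closed   = λ (x∈E , x∈F) (y∈E , y∈F) → E.+-closed x∈E y∈E , F.+-closed x∈F y∈F
    ; *-closed   = λ (x∈E , x∈F) (y∈E , y∈F) → E.*-closed x∈E y∈E , F.*-closed x∈F y∈F
    ; neg-closed = λ (x∈E , x∈F) → E.neg-closed x∈E , F.neg-closed x∈F
    ; inv-closed = λ (x∈E , x∈F) eq → E.inv-closed x∈E eq , F.inv-closed x∈F eq
    }
    where
    module E = Subfield E
    module F = Subfield F

  over-coeff : ∀ F f → (∀ n → coeff f n ∈ᶠ F) → Over F f
  over-coeff F []      h = []
  over-coeff F (a ∷ f) h = h 0 ∷ over-coeff F f (h ∘ suc)

  -- Characteristic `q` and the Frobenius map

  module CharP (q : ℕ) (q-prime : Prime q) (q·1≈0 : q · 1# ≈ 0#) where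

    q·x≈0 : ∀ x → q · x ≈ 0#
    q·x≈0 x = trans (n·x≈n1*x q x) (trans (*-congʳ q·1≈0) (zeroˡ x))

    ∣⇒·≈0 : ∀ {m} → q ∣ m → ∀ x → m · x ≈ 0#
    ∣⇒·≈0 (divides d ≡.refl) x = trans (sym (×-assocˡ x d q)) (trans (×-congʳ d (q·x≈0 x)) (n·0≈0 d))

    frobenius-+ : ∀ x y → (x + y) ^ q ≈ x ^ q + y ^ q
    frobenius-+ x y = go q ≡.refl
      where
      go : ∀ n → q ≡ n → (x + y) ^ n ≈ x ^ n + y ^ n
      go zero    ≡.refl = case q-prime of λ ()
      go (suc n) ≡.refl = begin
        (x + y) ^ suc n                                 ≈⟨ Binomial.theorem commutativeSemiring (suc n) x y ⟩
        term zero + sum (λ i → term (suc i))            ≈⟨ +-congˡ (sum-init-last (λ i → term (suc i))) ⟩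
        term zero + (sum (λ i → term (suc (Fin.inject₁ i))) + term (Fin.fromℕ (suc n)))
          ≈⟨ +-cong first (+-cong (trans (sum-cong-≋ {n} middle) (sum-replicate-zero n)) last) ⟩
        y ^ suc n + (0# + x ^ suc n)                    ≈⟨ solve 2 (λ x y → y :+ (con (+ 0) :+ x) := x :+ y) refl _ _ ⟩
        x ^ suc n + y ^ suc n                           ∎
        where
        term : Fin (suc (suc n)) → Carrier
        term = Binomial.binomialTerm commutativeSemiring x y (suc n)
        first : term zero ≈ y ^ suc n
        first = trans (+-identityʳ _) (*-identityˡ _)
        -- The indices strictly between `0` and `q`, where `q` divides the binomial coefficient.
        middle : ∀ i → term (suc (Fin.inject₁ i)) ≈ 0#
        middle i = ∣⇒·≈0 (prime∣binomial q-prime (s≤s (≡.subst (ℕ._< n) (≡.sym (Fin.toℕ-inject₁ i)) (Fin.toℕ<n i)))) _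
        last : term (Fin.fromℕ (suc n)) ≈ x ^ suc n
        last = begin
          (suc n C toℕ (Fin.fromℕ (suc n))) · (x ^ toℕ (Fin.fromℕ (suc n)) * y ^ (suc n ℕ.∸ toℕ (Fin.fromℕ (suc n))))
            ≈⟨ reflexive (≡.cong (λ k → (suc n C k) · (x ^ k * y ^ (suc n ℕ.∸ k))) (Fin.toℕ-fromℕ (suc n))) ⟩
          (suc n C suc n) · (x ^ suc n * y ^ (suc n ℕ.∸ suc n))
            ≈⟨ reflexive (≡.cong₂ (λ c k → c · (x ^ suc n * y ^ k)) (nCn≡1 (suc n)) (ℕ.n∸n≡0 (suc n))) ⟩
          1 · (x ^ suc n * 1#)  ≈⟨ trans (+-identityʳ _) (*-identityʳ _) ⟩
          x ^ suc n             ∎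

    0^q≈0 : 0# ^ q ≈ 0#
    0^q≈0 = go q ≡.refl
      where
      go : ∀ n → q ≡ n → 0# ^ n ≈ 0#
      go zero    ≡.refl = case q-prime of λ ()
      go (suc n) _      = zeroˡ _

    frobenius-≈ : ∀ {x y} → x ^ q ≈ y ^ q → x ≈ y
    frobenius-≈ {x} {y} x^q≈y^q = x-y≈0⇒x≈y (pow-≈0 q (begin
      (x - y) ^ q                      ≈⟨ solve 2 (λ s t → s := (s :+ t) :- t) refl _ _ ⟩
      ((x - y) ^ q + y ^ q) - y ^ q    ≈⟨ +-congʳ (frobenius-+ (x - y) y) ⟨
      (x - y + y) ^ q - y ^ q          ≈⟨ +-congʳ (^-congˡ q (solve 2 (λ x y → (x :- y) :+ y := x) refl x y)) ⟩
      x ^ q - y ^ q                    ≈⟨ x≈y⇒x∙y⁻¹≈ε x^q≈y^q ⟩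
      0#                               ∎))

    infixl 8 _^^_
    _^^_ : Carrier → ℕ → Carrier
    x ^^ n = x ^ (q ℕ.^ n)

    ^^-zero : ∀ x → x ^^ 0 ≈ x
    ^^-zero x = *-identityʳ x

    ^^-suc : ∀ x n → x ^^ suc n ≈ (x ^ q) ^^ n
    ^^-suc x n = sym (^-assocʳ x q (q ℕ.^ n))

    ^^-sucʳ : ∀ x n → x ^^ suc n ≈ (x ^^ n) ^ q
    ^^-sucʳ x n = trans (reflexive (≡.cong (x ^_) (ℕ.*-comm q (q ℕ.^ n)))) (sym (^-assocʳ x (q ℕ.^ n) q))

    ^^-cong : ∀ n {x y} → x ≈ y → x ^^ n ≈ y ^^ n
    ^^-cong n = ^-congˡ (q ℕ.^ n)

    ^^-* : ∀ n x y → (x * y) ^^ n ≈ (x ^^ n) * (y ^^ n)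
    ^^-* n x y = ^-distrib-* x y (q ℕ.^ n)

    ^^-+ : ∀ n x y → (x + y) ^^ n ≈ x ^^ n + y ^^ n
    ^^-+ zero    x y = trans (^^-zero _) (sym (+-cong (^^-zero x) (^^-zero y)))
    ^^-+ (suc n) x y = begin
      (x + y) ^^ suc n             ≈⟨ ^^-suc (x + y) n ⟩
      ((x + y) ^ q) ^^ n           ≈⟨ ^^-cong n (frobenius-+ x y) ⟩
      (x ^ q + y ^ q) ^^ n         ≈⟨ ^^-+ n (x ^ q) (y ^ q) ⟩
      (x ^ q) ^^ n + (y ^ q) ^^ n  ≈⟨ +-cong (^^-suc x n) (^^-suc y n) ⟨
      x ^^ suc n + y ^^ suc n      ∎

    0^^n≈0 : ∀ n → 0# ^^ n ≈ 0#
    0^^n≈0 zero    = ^^-zero 0#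
    0^^n≈0 (suc n) = trans (^^-suc 0# n) (trans (^^-cong n 0^q≈0) (0^^n≈0 n))

    ^^-lin : ∀ n {m} (a v : Vector Carrier m) → lin a v ^^ n ≈ lin (λ i → a i ^^ n) (λ i → v i ^^ n)
    ^^-lin n {zero}  a v = 0^^n≈0 n
    ^^-lin n {suc m} a v = trans (^^-+ n _ _) (+-cong (^^-* n (a zero) (v zero)) (^^-lin n (a ∘ suc) (v ∘ suc)))

    ^^1 : ∀ x → x ^^ 1 ≈ x ^ q
    ^^1 x = trans (^^-suc x 0) (^^-zero _)

    frobenius-lin : ∀ {m} (a v : Vector Carrier m) → lin a v ^ q ≈ lin (λ i → a i ^ q) (λ i → v i ^ q)
    frobenius-lin a v = trans (sym (^^1 (lin a v))) (trans (^^-lin 1 a v)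
      (lin-cong {b = λ i → a i ^ q} {w = λ i → v i ^ q} (λ i → ^^1 (a i)) (λ i → ^^1 (v i))))

    -- If `y` lies in `F[y^(q^n)]`, then `step` at `y^(q^n)` gains one more power. The set `T` is a
    -- separable subextension in `D-largest` and a normal extension in `normal-adj-^^`.
    adj-^^ : ∀ F → K ⊑ F → (T : Pred Carrier p) → (∀ {y} n → y ∈ T → y ^^ n ∈ T) → (∀ {y} → y ∈ T → Adj F (y ^ q) y) →
             ∀ n {y} → y ∈ T → Adj F (y ^^ n) y
    adj-^^ F K⊑F T T-closed step zero    {y} y∈ = resp (adj-subspace F (y ^^ 0)) (^^-zero y) (adj-∋ F)
    adj-^^ F K⊑F T T-closed step (suc n) {y} y∈ = adj-least (adjoin-field F K⊑F (y ^^ suc n)) (adj-⊇ F)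
      (adj-least (adjoin-field F K⊑F (y ^^ suc n)) (adj-⊇ F)
        (resp (adj-subspace F (y ^^ suc n)) (^^-sucʳ y n) (adj-∋ F)) (step (T-closed n y∈)))
      (adj-^^ F K⊑F T T-closed step n y∈)

    -- In characteristic q, the separable elements are those with x ∈ K[x^q]

    -- The polynomial `f(X^q)`, whose derivative vanishes in characteristic `q`.
    compose-Xq : Poly → Poly
    compose-Xq []      = []
    compose-Xq (a ∷ f) = (a ∷ []) +ₚ Xpow q *ₚ compose-Xq f

    over-compose-Xq : ∀ F {f} → Over F f → Over F (compose-Xq f)
    over-compose-Xq F []        = []
    over-compose-Xq F (a∈ ∷ f∈) = over-+ F (a∈ ∷ []) (over-* F (over-Xpow F q) (over-compose-Xq F f∈))

    eval-compose-Xq : ∀ f x → eval (compose-Xq f) x ≈ eval f (x ^ q)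
    eval-compose-Xq []      x = refl
    eval-compose-Xq (a ∷ f) x = trans (eval-+ (a ∷ []) (Xpow q *ₚ compose-Xq f) x) (+-cong
      (trans (+-congˡ (zeroʳ x)) (+-identityʳ a))
      (trans (eval-* (Xpow q) (compose-Xq f) x) (*-cong (eval-Xpow q x) (eval-compose-Xq f x))))

    deval-Xq : ∀ x → deval (Xpow q) x ≈ 0#
    deval-Xq x = go q ≡.refl
      where
      go : ∀ n → q ≡ n → deval (Xpow n) x ≈ 0#
      go zero    ≡.refl = case q-prime of λ ()
      go (suc n) ≡.refl = trans (deval-Xpow n x) (q·x≈0 (x ^ n))

    deval-compose-Xq : ∀ f x → deval (compose-Xq f) x ≈ 0#
    deval-compose-Xq []      x = refl
    deval-compose-Xq (a ∷ f) x = begin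
      deval ((a ∷ []) +ₚ Xpow q *ₚ g) x                  ≈⟨ deval-+ (a ∷ []) (Xpow q *ₚ g) x ⟩
      (0# + x * 0#) + deval (Xpow q *ₚ g) x              ≈⟨ +-cong (trans (+-identityˡ _) (zeroʳ x)) (deval-* (Xpow q) g x) ⟩
      0# + (deval (Xpow q) x * eval g x + eval (Xpow q) x * deval g x)
        ≈⟨ +-congˡ (+-cong (*-congʳ (deval-Xq x)) (*-congˡ (deval-compose-Xq f x))) ⟩
      0# + (0# * eval g x + eval (Xpow q) x * 0#)
        ≈⟨ solve 2 (λ s t → con (+ 0) :+ (con (+ 0) :* s :+ t :* con (+ 0)) := con (+ 0)) refl (eval g x) (eval (Xpow q) x) ⟩
      0#                                                 ∎
      where
      g : Poly
      g = compose-Xq f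

    -- If `x = v(x^q)`, then `x` is a root of `X - v(X^q)`, whose derivative is `1#`.
    adj⇒separable : ∀ {x} → Adj K (x ^ q) x → Separable K x
    adj⇒separable {x} (adj v v∈ x≈) = simple-root⇒separable {h}
      (over-+ K (K.0#-closed ∷ K.1#-closed ∷ []) (over-scale K (K.neg-closed K.1#-closed) (over-compose-Xq K v∈)))
      hx≈0 (λ h′x≈0 → 1≉0 (trans (sym h′x≈1) h′x≈0))
      where
      module K = Subfield K
      g h : Poly
      g = compose-Xq v
      h = (0# ∷ 1# ∷ []) +ₚ List.map (- 1# *_) g
      hx≈0 : eval h x ≈ 0#
      hx≈0 = begin
        eval h x                                            ≈⟨ eval-+ (0# ∷ 1# ∷ []) (List.map (- 1# *_) g) x ⟩
        eval (0# ∷ 1# ∷ []) x + eval (List.map (- 1# *_) g) x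
          ≈⟨ +-congˡ (trans (eval-scale (- 1#) g x) (*-congˡ (trans (eval-compose-Xq v x) (sym x≈)))) ⟩
        (0# + x * (1# + x * 0#)) + - 1# * x
          ≈⟨ solve 1 (λ x → (con (+ 0) :+ x :* (con (+ 1) :+ x :* con (+ 0))) :+ :- con (+ 1) :* x := con (+ 0)) refl x ⟩
        0#                                                  ∎
      h′x≈1 : deval h x ≈ 1#
      h′x≈1 = begin
        deval h x                                           ≈⟨ deval-+ (0# ∷ 1# ∷ []) (List.map (- 1# *_) g) x ⟩
        deval (0# ∷ 1# ∷ []) x + deval (List.map (- 1# *_) g) x
          ≈⟨ +-congˡ (trans (deval-scale (- 1#) g x) (*-congˡ (deval-compose-Xq v x))) ⟩
        ((1# + x * 0#) + x * (0# + x * 0#)) + - 1# * 0#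
          ≈⟨ solve 1 (λ x → ((con (+ 1) :+ x :* con (+ 0)) :+ x :* (con (+ 0) :+ x :* con (+ 0))) :+ :- con (+ 1) :* con (+ 0) := con (+ 1)) refl x ⟩
        1#                                                  ∎

    -- The minimal polynomial g of x over K[x^q] divides X^q - x^q, so x is its only root;
    -- if g is not linear, x is a multiple root of it and hence of the minimal polynomial over K.
    separable⇒adj : ∀ {x} → Separable K x → Adj K (x ^ q) x
    separable⇒adj {x} (f , f-mp , simple) = go G.deg ≡.refl
      where
      K′ : Subfield
      K′ = adjoin-field K id (x ^ q)
      module K′ = Subfield K′
      g : Poly
      g = proj₁ (minimal-polynomial K′ (adj-⊇ K) x)
      g-mp : MinimalPolynomial K′ x g
      g-mp = proj₂ (minimal-polynomial K′ (adj-⊇ K) x)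
      module G = MinimalPolynomial g-mp
      module F = MinimalPolynomial f-mp
      open MinPoly g-mp
      u : Poly
      u = Xpow q +ₚ (- (x ^ q) ∷ [])
      eval-u : ∀ b → eval u b ≈ b ^ q - x ^ q
      eval-u b = trans (eval-+ (Xpow q) (- (x ^ q) ∷ []) b) (+-cong (eval-Xpow q b) (trans (+-congˡ (zeroʳ b)) (+-identityʳ _)))
      g-root : ∀ {b} → eval g b ≈ 0# → b ≈ x
      g-root {b} gb≈0 = frobenius-≈ (x-y≈0⇒x≈y (trans (sym (eval-u b))
        (divides-root {u} (over-+ K′ (over-Xpow K′ q) (K′.neg-closed (adj-∋ K) ∷ []))
          (trans (eval-u x) (x≈y⇒x∙y⁻¹≈ε refl)) gb≈0)))
      go : ∀ d → G.deg ≡ d → x ∈ᶠ K′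
      go zero d≡ = contradiction d≡ deg≢0
      go (suc zero) d≡ = K′.resp x≈ (K′.neg-closed (coeff∈ K′ G.over 0))
        where
        eq : coeff g 0 * 1# + (coeff g 1 * (x * 1#) + 0#) ≈ 0#
        eq = trans (sym (eval-lin 2 g (λ n 2≤n → proj₂ G.hasDeg n (≡.subst (ℕ._< n) (≡.sym d≡) 2≤n)))) G.root
        x≈ : - coeff g 0 ≈ x
        x≈ = begin
          - coeff g 0                ≈⟨ +-identityʳ _ ⟨
          - coeff g 0 + 0#           ≈⟨ +-congˡ eq ⟨
          - coeff g 0 + (coeff g 0 * 1# + (coeff g 1 * (x * 1#) + 0#))
            ≈⟨ +-congˡ (+-congˡ (+-congʳ (*-congʳ (trans (reflexive (≡.cong (coeff g) (≡.sym d≡))) G.monic)))) ⟩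
          - coeff g 0 + (coeff g 0 * 1# + (1# * (x * 1#) + 0#))
            ≈⟨ solve 2 (λ c x → :- c :+ (c :* con (+ 1) :+ (con (+ 1) :* (x :* con (+ 1)) :+ con (+ 0))) := x) refl (coeff g 0) x ⟩
          x                          ∎
      go (suc (suc d)) d≡ = contradiction (multiple-root f F.root f′x≈0) simple
        where
        above : ∀ m → suc (suc d) ℕ.< m → coeff g m ≈ 0#
        above m <m = proj₂ G.hasDeg m (≡.subst (ℕ._< m) (≡.sym d≡) <m)
        lead : coeff (quot x g) (suc d) ≈ 1#
        lead = trans (quot-lead (suc d) g above) (trans (reflexive (≡.cong (coeff g) (≡.sym d≡))) G.monic)
        root : ∃[ b ] eval (quot x g) b ≈ 0#
        root = algebraicallyClosed (quot x g) d ((λ eq → 1≉0 (trans (sym lead) eq)) , quot-above (suc (suc d)) g above)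
        hx≈0 : eval (quot x g) x ≈ 0#
        hx≈0 = trans (eval-congʳ (quot x g) (sym (g-root gb≈0))) (proj₂ root)
          where
          gb≈0 : eval g (proj₁ root) ≈ 0#
          gb≈0 = trans (eval-cong g ((X- x) *ₚ quot x g) (factor g G.root))
            (trans (eval-* (X- x) (quot x g) (proj₁ root)) (trans (*-congˡ (proj₂ root)) (zeroʳ _)))
        f′x≈0 : deval f x ≈ 0#
        f′x≈0 = divides-double {f} (over-mono {K} {K′} (adj-⊇ K) F.over) F.root G.root (trans (sym (eval-quot x g)) hx≈0)

    li-cong : ∀ {F m} {v w : Vector Carrier m} → (∀ i → v i ≈ w i) → LinearlyIndependent F v → LinearlyIndependent F w
    li-cong {v = v} {w} v≈w li a a∈ eq = li a a∈ (trans (lin-cong {b = a} {v} {w} (λ _ → refl) v≈w) eq)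

    -- The fields K E^(q^n)

    Powers : Subfield → ℕ → Pred Carrier p
    Powers E n y = ∃[ x ] x ∈ᶠ E × y ≈ x ^^ n

    powers-subalgebra : ∀ E n → IsSubalgebra (Span K (Powers E n))
    powers-subalgebra E n = span-subalgebra K id (1# , E.1#-closed , sym (1^n≈1 (q ℕ.^ n)))
      λ { (x , x∈ , ≈x) (y , y∈ , ≈y) → x * y , E.*-closed x∈ y∈ , trans (*-cong ≈x ≈y) (sym (^^-* n x y)) }
      where
      module E = Subfield E

    D : Subfield → ℕ → Subfield
    D E n = IsSubalgebra.toSubfield (powers-subalgebra E n)

    K⊑D : ∀ E n → K ⊑ D E n
    K⊑D E n = IsSubalgebra.⊇K (powers-subalgebra E n)

    D-∋ : ∀ E n {x} → x ∈ᶠ E → x ^^ n ∈ᶠ D E n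
    D-∋ E n {x} x∈ = span-∋ (x , x∈ , refl)

    D-least : ∀ E n {U} → IsSubspace K U → (∀ {x} → x ∈ᶠ E → x ^^ n ∈ U) → mem (D E n) ⊆ U
    D-least E n S h = span-least S λ { (x , x∈ , y≈) → resp S (sym y≈) (h x∈) }

    D-mono : ∀ {E E′} n → E ⊑ E′ → D E n ⊑ D E′ n
    D-mono {E} {E′} n E⊑E′ = D-least E n (subfield-subspace {K} (D E′ n) (K⊑D E′ n)) (λ x∈ → D-∋ E′ n (E⊑E′ x∈))

    D⊑ : ∀ {E} n → K ⊑ E → D E n ⊑ E
    D⊑ {E} n K⊑E = D-least E n (subfield-subspace {K} E K⊑E) (pow-closed E (q ℕ.^ n))

    D-suc⊑ : ∀ E n → D E (suc n) ⊑ D E n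
    D-suc⊑ E n = D-least E (suc n) (subfield-subspace {K} (D E n) (K⊑D E n)) λ {x} x∈ →
      Subfield.resp (D E n) (sym (^^-suc x n)) (D-∋ E n (pow-closed E q x∈))

    D-antitone : ∀ E {m n} → m ℕ.≤′ n → D E n ⊑ D E m
    D-antitone E ℕ.≤′-refl x∈ = x∈
    D-antitone E (ℕ.≤′-step {n} m≤n) x∈ = D-antitone E m≤n (D-suc⊑ E n x∈)

    comb-frobenius : ∀ {m} {v : Vector Carrier m} {x} → x ∈ Comb K v → x ^ q ∈ Comb K (λ i → v i ^ q)
    comb-frobenius {v = v} (comb a a∈ x≈) = comb (λ i → a i ^ q) (λ i → pow-closed K q (a∈ i))
      (trans (^-congˡ q x≈) (frobenius-lin a v))

    D-frobenius : ∀ E n {y} → y ∈ᶠ D E n → y ^ q ∈ᶠ D E (suc n)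
    D-frobenius E n {y} (span v v∈ y∈) = comb-least (span-subspace K (Powers E (suc n))) (λ i → step (v∈ i)) (comb-frobenius y∈)
      where
      step : ∀ {z} → z ∈ Powers E n → z ^ q ∈ᶠ D E (suc n)
      step (x , x∈ , z≈) = Subfield.resp (D E (suc n)) (sym (trans (^-congˡ q z≈) (sym (^^-sucʳ x n)))) (D-∋ E (suc n) x∈)

    -- Mac Lane's criterion for separability over `K`; `preserves⇒separable` draws the consequence
    -- for single elements.
    PreservesLI : Subfield → Set p
    PreservesLI E = ∀ {m} {v : Vector Carrier m} → (∀ i → v i ∈ᶠ E) → LinearlyIndependent K v →
                    LinearlyIndependent K (λ i → v i ^ q)

    -- The `q`-th powers of a family spanning `D E n` span `D E (suc n)`. If the family has as many
    -- members as this space has dimensions, the powers form a basis.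
    spanning-frobenius : ∀ E n {m} → Basis K (D E (suc n)) m → {v : Vector Carrier m} → mem (D E n) ⊆ Comb K v →
                         LinearlyIndependent K (λ i → v i ^ q)
    spanning-frobenius E n B {v} spans = spanning-li {K} {v = λ i → v i ^ q} {B.vec} B.independent
      (λ i → D-least E (suc n) (comb-subspace K (λ i → v i ^ q))
        (λ {x} x∈ → resp (comb-subspace K (λ i → v i ^ q)) (sym (^^-sucʳ x n)) (comb-frobenius (spans (D-∋ E n x∈)))) (B.vec∈ i))
      ℕ.≤-refl
      where
      module B = Basis B

    basis-unique : ∀ {F E m n} → Basis F E m → Basis F E n → m ≡ n
    basis-unique B B′ = ≡.trans (≡.sym (degree-≡ B)) (degree-≡ B′)

    -- `v` is completed to a basis of `D E n`. Its `d` members have `q`-th powers spanning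
    -- `D E (suc n)`, also of dimension `d`; so these powers are independent, and with them those of
    -- `v`.
    stable⇒preserves : ∀ E n {d} → Basis K (D E n) d → Basis K (D E (suc n)) d → PreservesLI (D E n)
    stable⇒preserves E n {d} B B′ {m} {v} v∈ li =
      go (li-extend {K} {V = mem (D E n)} d {v} li (λ {_} {w} w∈ w-li → basis-bound B {w = w} w-li w∈) v∈)
      where
      go : (∃[ k ] Σ[ w ∈ Vector Carrier k ] (∀ i → w i ∈ᶠ D E n) × LinearlyIndependent K (v ++ w) × mem (D E n) ⊆ Comb K (v ++ w)) →
           LinearlyIndependent K (λ i → v i ^ q)
      go (k , w , w∈ , vw-li , spans) = li-cong {K} {v = λ i → (v ++ w) (i ↑ˡ k) ^ q}
        (λ i → ^-congˡ q (reflexive (Vector.lookup-++ˡ v w i)))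
        (li-++ˡ {K} {m} {k} (λ i → (v ++ w) i ^ q) (spanning-frobenius E n
          (≡.subst (Basis K (D E (suc n))) (≡.sym m+k≡d) B′) {v ++ w} spans))
        where
        m+k≡d : m ℕ.+ k ≡ d
        m+k≡d = basis-unique (basis-of {K} {D E n} {v = v ++ w} (++-all (mem (D E n)) v∈ w∈) vw-li spans) B

    Stable : Subfield → ℕ → Set p
    Stable E N = ∀ n → N ℕ.≤ n → PreservesLI (D E n)

    -- The degrees over `K` of the decreasing chain `D E n` have a least value. Once attained it
    -- persists, and equal consecutive degrees are what `stable⇒preserves` asks for.
    stable-exists : ∀ E → K ⊑ E → ∃ (Basis K E) → ∃ (Stable E)
    stable-exists E K⊑E fin = go (least em HasDim (map₂ (0 ,_) (sub-finite {K} {E} {D E 0} fin (D⊑ {E} 0 K⊑E))))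
      where
      HasDim : ℕ → Set p
      HasDim d = ∃[ n ] Basis K (D E n) d
      go : (∃[ d ] HasDim d × (∀ {d′} → HasDim d′ → d ℕ.≤ d′)) → ∃ (Stable E)
      go (d , (N , B) , minimal) = N , λ n N≤n → stable⇒preserves E n (basis n N≤n) (basis (suc n) (ℕ.m≤n⇒m≤1+n N≤n))
        where
        basis : ∀ n → N ℕ.≤ n → Basis K (D E n) d
        basis n N≤n = resize (sub-finite {K} {D E N} {D E n} (d , B) ⊑)
          where
          ⊑ : D E n ⊑ D E N
          ⊑ = D-antitone E (ℕ.≤⇒≤′ N≤n)
          resize : ∃ (Basis K (D E n)) → Basis K (D E n) d
          resize (d′ , B′) = ≡.subst (Basis K (D E n)) (ℕ.≤-antisym
            (basis-bound B {w = Basis.vec B′} (Basis.independent B′) (λ i → ⊑ (Basis.vec∈ B′ i))) (minimal (n , B′))) B′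

    -- Frobenius carries `D E n` into `D E (suc n)`, where independence is again preserved, so it
    -- can be applied repeatedly.
    li-^^ : ∀ E N → Stable E N → ∀ n → N ℕ.≤ n → ∀ k {m} {v : Vector Carrier m} → (∀ i → v i ∈ᶠ D E n) →
            LinearlyIndependent K v → LinearlyIndependent K (λ i → v i ^^ k)
    li-^^ E N stable n N≤n zero    {v = v} v∈ li = li-cong {K} {v = v} (λ i → sym (^^-zero (v i))) li
    li-^^ E N stable n N≤n (suc k) {v = v} v∈ li = li-cong {K} {v = λ i → (v i ^ q) ^^ k} (λ i → sym (^^-suc (v i) k))
      (li-^^ E N stable (suc n) (ℕ.m≤n⇒m≤1+n N≤n) k {v = λ i → v i ^ q} (λ i → D-frobenius E n (v∈ i)) (stable n N≤n v∈ li))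

    -- Maximal separable subextensions

    eval-pow∈powers : ∀ {F x f} → (mp : MinimalPolynomial F x f) → ∀ n → x ^ n ∈ Comb F (powers x (MinimalPolynomial.deg mp))
    eval-pow∈powers {F} {x} mp n = resp (comb-subspace F (powers x deg)) (eval-Xpow n x)
      (eval∈powers {F} over monic (proj₂ hasDeg) root {Xpow n} (over-Xpow F n))
      where
      open MinimalPolynomial mp

    -- The powers of `x` below `deg` form a `K`-basis of `K[x]`. Their `q`-th powers are as many
    -- independent elements of `K[x]`, so they span it, and `x` becomes a polynomial in `x ^ q`.
    preserves⇒separable : ∀ E → PreservesLI E → ∀ {x} → x ∈ᶠ E → Separable K x
    preserves⇒separable E preserves {x} x∈ = adj⇒separable (comb⇒adj deg
      (li-spans {K} {v = powers x deg} {powers (x ^ q) deg}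
        (li-cong {K} {v = λ i → (x ^ toℕ i) ^ q} power-swap (preserves {v = powers x deg} (λ i → pow-closed E (toℕ i) x∈) powers-li))
        (λ i → resp (comb-subspace K (powers x deg)) (sym (^-assocʳ x q (toℕ i))) (eval-pow∈powers mp (q ℕ.* toℕ i)))
        ℕ.≤-refl (resp (comb-subspace K (powers x deg)) (*-identityʳ x) (eval-pow∈powers mp 1))))
      where
      mp : MinimalPolynomial K x (proj₁ (minimal-polynomial K id x))
      mp = proj₂ (minimal-polynomial K id x)
      open MinimalPolynomial mp using (deg)
      open MinPoly mp
      power-swap : ∀ i → (x ^ toℕ i) ^ q ≈ (x ^ q) ^ toℕ i
      power-swap i = trans (^-assocʳ x (toℕ i) q) (trans (reflexive (≡.cong (x ^_) (ℕ.*-comm (toℕ i) q))) (sym (^-assocʳ x q (toℕ i))))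

    -- For maximality: an element `x` of a separable subextension of `E` lies in `K[x^(q^n)]`, and
    -- `x^(q^n)` lies in `D E n`.
    D-largest : ∀ E n → K ⊑ E → PreservesLI (D E n) → LargestSubextension K (Separable K) E (D E n)
    D-largest E n K⊑E preserves = record
      { above   = K⊑D E n
      ; below   = D⊑ {E} n K⊑E
      ; all     = preserves⇒separable (D E n) preserves
      ; largest = λ F _ F⊑E F-sep {x} x∈ → adj-least (D E n) (K⊑D E n) (D-∋ E n (F⊑E x∈))
                    (adj-^^ K id (mem F) (λ n → pow-closed F (q ℕ.^ n)) (λ y∈ → separable⇒adj (F-sep y∈)) n x∈)
      }

    sep≑D : ∀ E n → K ⊑ E → PreservesLI (D E n) → sep K E ≑ D E n
    sep≑D E n K⊑E preserves = largest-unique {Separable K} {E} (D-largest E n K⊑E preserves)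

    -- Raising to the power `q^n` is additive, so it turns an `A`-combination of elements of `B`
    -- into the corresponding combination of powers.
    D-∙ : ∀ A B n → K ⊑ A → K ⊑ B → D (A ∙ B) n ≑ D A n ∙ D B n
    D-∙ A B n K⊑A K⊑B = ⊑ , ∙-least {D A n} {D B n} (D (A ∙ B) n) (D-mono {A} {A ∙ B} n (∙-left {A} {B})) (D-mono {B} {A ∙ B} n (∙-right {A} {B}))
      where
      DD : Subfield
      DD = D A n ∙ D B n
      ⊑ : D (A ∙ B) n ⊑ DD
      ⊑ = D-least (A ∙ B) n (subfield-subspace {K} DD (λ x∈ → ∙-left {D A n} {D B n} (K⊑D A n x∈))) λ x∈ → step (∙⇒span {A} {B} K⊑A K⊑B x∈)
        where
        step : ∀ {x} → Span A (mem B) x → x ^^ n ∈ᶠ DD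
        step (span v v∈ (comb a a∈ x≈)) = Subfield.resp DD (sym (trans (^^-cong n x≈) (^^-lin n a v)))
          (lin∈ (subfield-subspace {D A n} DD (∙-left {D A n} {D B n})) {a = λ i → a i ^^ n} {λ i → v i ^^ n}
            (λ i → D-∋ A n (a∈ i)) (λ i → ∙-right {D A n} {D B n} (D-∋ B n (v∈ i))))

    sep-∙ : ∀ A B → K ⊑ A → K ⊑ B → ∃ (Basis K A) → ∃ (Basis K B) → ∃ (Basis K (A ∙ B)) → sep K (A ∙ B) ≑ sep K A ∙ sep K B
    sep-∙ A B K⊑A K⊑B finA finB finAB = go (stable-exists A K⊑A finA) (stable-exists B K⊑B finB) (stable-exists (A ∙ B) K⊑AB finAB)
      where
      K⊑AB : K ⊑ A ∙ B
      K⊑AB x∈ = ∙-left {A} {B} (K⊑A x∈)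
      go : ∃ (Stable A) → ∃ (Stable B) → ∃ (Stable (A ∙ B)) → sep K (A ∙ B) ≑ sep K A ∙ sep K B
      go (N₁ , s₁) (N₂ , s₂) (N₃ , s₃) = ≐-trans (sep≑D (A ∙ B) n K⊑AB (s₃ n (ℕ.m≤n⊔m (N₁ ℕ.⊔ N₂) N₃)))
        (≐-trans (D-∙ A B n K⊑A K⊑B) (∙-mono {D A n} {sep K A} {D B n} {sep K B} (proj₂ eqA) (proj₂ eqB) ,
                                      ∙-mono {sep K A} {D A n} {sep K B} {D B n} (proj₁ eqA) (proj₁ eqB)))
        where
        -- One exponent beyond the stability thresholds of all three fields.
        n : ℕ
        n = N₁ ℕ.⊔ N₂ ℕ.⊔ N₃
        eqA : sep K A ≑ D A n
        eqA = sep≑D A n K⊑A (s₁ n (ℕ.≤-trans (ℕ.m≤m⊔n N₁ N₂) (ℕ.m≤m⊔n (N₁ ℕ.⊔ N₂) N₃)))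
        eqB : sep K B ≑ D B n
        eqB = sep≑D B n K⊑B (s₂ n (ℕ.≤-trans (ℕ.m≤n⊔m N₁ N₂) (ℕ.m≤m⊔n (N₁ ℕ.⊔ N₂) N₃)))

    -- The perfect closure I of K

    PI : Pred Carrier p
    PI x = ∃[ n ] x ^^ n ∈ᶠ K

    ^^-mono : ∀ k m x → x ^^ m ∈ᶠ K → x ^^ (k ℕ.+ m) ∈ᶠ K
    ^^-mono zero    m x x^m∈ = x^m∈
    ^^-mono (suc k) m x x^m∈ = Subfield.resp K (sym (^^-sucʳ x (k ℕ.+ m))) (pow-closed K q (^^-mono k m x x^m∈))

    ^^-monoʳ : ∀ k m x → x ^^ m ∈ᶠ K → x ^^ (m ℕ.+ k) ∈ᶠ K
    ^^-monoʳ k m x x^m∈ = ≡.subst (λ n → x ^^ n ∈ᶠ K) (ℕ.+-comm k m) (^^-mono k m x x^m∈)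

    PI-subalgebra : IsSubalgebra PI
    PI-subalgebra = record
      { subspace = record
        { resp  = λ { x≈y (n , x^n∈) → n , K.resp (^^-cong n x≈y) x^n∈ }
        ; 0∈    = 0 , K.resp (sym (^^-zero 0#)) K.0#-closed
        ; +∈    = λ { {x} {y} (m , x^m∈) (n , y^n∈) → m ℕ.+ n ,
                    K.resp (sym (^^-+ (m ℕ.+ n) x y)) (K.+-closed (^^-monoʳ n m x x^m∈) (^^-mono m n y y^n∈)) }
        ; scale = λ { {a} {x} a∈ (n , x^n∈) → n ,
                    K.resp (sym (^^-* n a x)) (K.*-closed (pow-closed K (q ℕ.^ n) a∈) x^n∈) }
        }
      ; 1∈ = 0 , K.resp (sym (^^-zero 1#)) K.1#-closed
      ; *∈ = λ { {x} {y} (m , x^m∈) (n , y^n∈) → m ℕ.+ n ,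
                 K.resp (sym (^^-* (m ℕ.+ n) x y)) (K.*-closed (^^-monoʳ n m x x^m∈) (^^-mono m n y y^n∈)) }
      }
      where
      module K = Subfield K

    I : Subfield
    I = IsSubalgebra.toSubfield PI-subalgebra

    K⊑I : K ⊑ I
    K⊑I = IsSubalgebra.⊇K PI-subalgebra

    PI-root : ∀ {x} → x ^ q ∈ᶠ I → x ∈ᶠ I
    PI-root {x} (n , h) = suc n , Subfield.resp K (sym (^^-suc x n)) h

    PI-common : ∀ {m} {v : Vector Carrier m} → (∀ i → PI (v i)) → ∃[ n ] (∀ i → v i ^^ n ∈ᶠ K)
    PI-common {zero}  v∈ = 0 , λ ()
    PI-common {suc m} {v} v∈ with v∈ zero | PI-common (v∈ ∘ suc)
    ... | k , v₀∈ | n , h = k ℕ.+ n , λ { zero → ^^-monoʳ n k (v zero) v₀∈ ; (suc i) → ^^-mono k n (v (suc i)) (h i) }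

    bézout⇒1≈0 : ∀ {m n} x y → m · 1# ≈ 0# → n · 1# ≈ 0# → 1 ℕ.+ y ℕ.* n ≡ x ℕ.* m → 1# ≈ 0#
    bézout⇒1≈0 {m} {n} x y m≈0 n≈0 eq = begin
      1#                          ≈⟨ +-identityʳ 1# ⟨
      1# + 0#                     ≈⟨ +-congˡ (multiple y n≈0) ⟨
      1# + (y ℕ.* n) · 1#         ≈⟨ reflexive (≡.cong (_· 1#) eq) ⟩
      (x ℕ.* m) · 1#              ≈⟨ multiple x m≈0 ⟩
      0#                          ∎
      where
      multiple : ∀ x {m} → m · 1# ≈ 0# → (x ℕ.* m) · 1# ≈ 0#
      multiple x {m} m≈0 = trans (×1-homo-* x m) (trans (*-congˡ m≈0) (zeroʳ _))

    coprime⇒1≈0 : ∀ {m n} → m · 1# ≈ 0# → n · 1# ≈ 0# → Coprime m n → 1# ≈ 0#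
    coprime⇒1≈0 m≈0 n≈0 coprime with coprime-Bézout coprime
    ... | Bézout.+- x y eq = bézout⇒1≈0 x y m≈0 n≈0 eq
    ... | Bézout.-+ x y eq = bézout⇒1≈0 y x n≈0 m≈0 eq

    -- `PurelyInseparable` admits any prime that vanishes in `K̄`. Two different ones would be
    -- coprime, and Bézout would give `1# ≈ 0#`.
    characteristic-unique : ∀ {q′} → Prime q′ → q′ · 1# ≈ 0# → q′ ≡ q
    characteristic-unique {q′} q′-prime q′≈0 with ℕ.<-cmp q′ q
    ... | tri≈ _ eq _ = eq
    ... | tri< lt _ _ = contradiction (coprime⇒1≈0 q·1≈0 q′≈0 (prime⇒coprime q-prime {{prime⇒nonZero q′-prime}} lt)) 1≉0
    ... | tri> _ _ gt = contradiction (coprime⇒1≈0 q′≈0 q·1≈0 (prime⇒coprime q′-prime {{prime⇒nonZero q-prime}} gt)) 1≉0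

    purelyInseparable⇒PI : ∀ {x} → PurelyInseparable K x → PI x
    purelyInseparable⇒PI {x} (inj₁ x∈) = 0 , Subfield.resp K (sym (^^-zero x)) x∈
    purelyInseparable⇒PI {x} (inj₂ (q′ , n , q′-prime , q′≈0 , x^∈)) =
      n , ≡.subst (λ q → x ^ (q ℕ.^ n) ∈ᶠ K) (characteristic-unique q′-prime q′≈0) x^∈

    insep≑ : ∀ E → K ⊑ E → insep K E ≑ E ⊓ I
    insep≑ E K⊑E = largest-unique {PurelyInseparable K} {E} {E ⊓ I} (record
      { above   = λ x∈ → K⊑E x∈ , K⊑I x∈
      ; below   = proj₁
      ; all     = λ { (_ , n , x^n∈) → inj₂ (q , n , q-prime , q·1≈0 , x^n∈) }
      ; largest = λ F _ F⊑E F-pi x∈ → F⊑E x∈ , purelyInseparable⇒PI (F-pi x∈)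
      })

    -- A high power `q^n` moves the finitely many coefficients of a relation over `I` into `K`, and
    -- by stability the powers of `v` are still independent over `K`.
    D-disjoint-I : ∀ E N → Stable E N → LinearlyDisjoint K (D E N) I
    D-disjoint-I E N stable v v∈ li a a∈ eq = go (PI-common {v = a} a∈)
      where
      go : (∃[ n ] (∀ i → a i ^^ n ∈ᶠ K)) → ∀ i → a i ≈ 0#
      go (n , a^n∈) i = pow-≈0 (q ℕ.^ n) (li-^^ E N stable N ℕ.≤-refl n {v = v} v∈ li (λ i → a i ^^ n) a^n∈
        (trans (sym (^^-lin n a v)) (trans (^^-cong n eq) (0^^n≈0 n))) i)

    -- Normal extensions

    root-q : ∀ c → ∃[ x ] x ^ q ≈ c
    root-q c = go q ≡.refl
      where
      go : ∀ n → q ≡ n → ∃[ x ] x ^ q ≈ c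
      go zero    ≡.refl = case q-prime of λ ()
      go (suc n) q≡ = map₂ (λ {x} ux≈0 → x-y≈0⇒x≈y (trans (sym (eval-u x)) ux≈0)) (algebraicallyClosed u n (≡.subst (DegreeIs u) q≡ (lead , above)))
        where
        u : Poly
        u = Xpow q +ₚ (- c ∷ [])
        eval-u : ∀ x → eval u x ≈ x ^ q - c
        eval-u x = trans (eval-+ (Xpow q) (- c ∷ []) x) (+-cong (eval-Xpow q x) (trans (+-congˡ (zeroʳ x)) (+-identityʳ _)))
        coeff-constant : ∀ m → 0 ℕ.< m → coeff (- c ∷ []) m ≈ 0#
        coeff-constant (suc m) _ = refl
        coeff-u : ∀ m → 0 ℕ.< m → coeff u m ≈ coeff (Xpow q) m
        coeff-u m 0<m = trans (coeff-+ (Xpow q) (- c ∷ []) m) (trans (+-congˡ (coeff-constant m 0<m)) (+-identityʳ _))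
        0<q : 0 ℕ.< q
        0<q = ≡.subst (0 ℕ.<_) (≡.sym q≡) (s≤s z≤n)
        lead : ¬ coeff u q ≈ 0#
        lead eq = 1≉0 (trans (sym (trans (coeff-u q 0<q) (coeff-Xpow q))) eq)
        above : ∀ m → q ℕ.< m → coeff u m ≈ 0#
        above m q<m = trans (coeff-u m (ℕ.<-trans 0<q q<m)) (Xpow-above q m q<m)

    coeff-map-^q : ∀ f n → coeff (List.map (_^ q) f) n ≈ coeff f n ^ q
    coeff-map-^q []      n       = sym 0^q≈0
    coeff-map-^q (a ∷ f) zero    = refl
    coeff-map-^q (a ∷ f) (suc n) = coeff-map-^q f n

    eval-map-^q : ∀ f x → eval (List.map (_^ q) f) (x ^ q) ≈ eval f x ^ q
    eval-map-^q []      x = sym 0^q≈0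
    eval-map-^q (a ∷ f) x = begin
      a ^ q + x ^ q * eval (List.map (_^ q) f) (x ^ q)  ≈⟨ +-congˡ (*-congˡ (eval-map-^q f x)) ⟩
      a ^ q + x ^ q * eval f x ^ q                      ≈⟨ +-congˡ (^-distrib-* x (eval f x) q) ⟨
      a ^ q + (x * eval f x) ^ q                        ≈⟨ frobenius-+ a _ ⟨
      (a + x * eval f x) ^ q                            ∎

    over-map-^q : ∀ F {f} → Over F f → Over F (List.map (_^ q) f)
    over-map-^q F []        = []
    over-map-^q F (a∈ ∷ f∈) = pow-closed F q a∈ ∷ over-map-^q F f∈

    roots-q : Poly → Poly
    roots-q = List.map (λ c → proj₁ (root-q c))

    roots-q-≋ : ∀ f → List.map (_^ q) (roots-q f) ≋ f
    roots-q-≋ []      n       = refl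
    roots-q-≋ (a ∷ f) zero    = proj₂ (root-q a)
    roots-q-≋ (a ∷ f) (suc n) = roots-q-≋ f n

    -- Let u be the minimal polynomial of y^q over F and w^q = u(X^q).  All roots of w are conjugates
    -- of y, so w has coefficients in N and hence in F, and [F(y) : F] ≤ deg w = [F(y^q) : F].
    normal⇒adj : ∀ N F → Normal K N → K ⊑ F → F ⊑ N → (∀ {y} → y ∈ᶠ N → y ^ q ∈ᶠ F → y ∈ᶠ F) →
                 ∀ {y} → y ∈ᶠ N → Adj F (y ^ q) y
    normal⇒adj N F (_ , splits) K⊑F F⊑N root-closed {y} y∈ = comb⇒adj U.deg
      (li-spans {F} {v = powers y U.deg} {powers (y ^ q) U.deg} powers-li
        (λ i → resp (comb-subspace F (powers y U.deg)) (trans (eval-Xpow (q ℕ.* toℕ i) y) (sym (^-assocʳ y q (toℕ i)))) (reduce (Xpow (q ℕ.* toℕ i)) (over-Xpow F _)))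
        ℕ.≤-refl
        (resp (comb-subspace F (powers y U.deg)) (trans (eval-Xpow 1 y) (*-identityʳ y)) (reduce (Xpow 1) (over-Xpow F 1))))
      where
      f u w : Poly
      f = proj₁ (minimal-polynomial K id y)
      f-mp : MinimalPolynomial K y f
      f-mp = proj₂ (minimal-polynomial K id y)
      u = proj₁ (minimal-polynomial F K⊑F (y ^ q))
      u-mp : MinimalPolynomial F (y ^ q) u
      u-mp = proj₂ (minimal-polynomial F K⊑F (y ^ q))
      w = roots-q u
      module M = MinimalPolynomial f-mp
      module U = MinimalPolynomial u-mp
      open MinPoly u-mp
      coeff-w : ∀ n → coeff w n ^ q ≈ coeff u n
      coeff-w n = trans (sym (coeff-map-^q w n)) (roots-q-≋ u n)
      eval-w : ∀ z → eval w z ^ q ≈ eval u (z ^ q)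
      eval-w z = trans (sym (eval-map-^q w z)) (eval-cong (List.map (_^ q) w) u (roots-q-≋ u))
      w-lead : coeff w U.deg ≈ 1#
      w-lead = frobenius-≈ (trans (coeff-w U.deg) (trans U.monic (sym (1^n≈1 q))))
      w-above : ∀ n → U.deg ℕ.< n → coeff w n ≈ 0#
      w-above n <n = pow-≈0 q (trans (coeff-w n) (proj₂ U.hasDeg n <n))
      -- If `w(z) = 0`, then `z^q` is a root of `u`. Raising the coefficients of `f` to the power
      -- `q` gives a polynomial over `K` vanishing at `y^q`, hence at `z^q`, where its value is
      -- `f(z)^q`; so `z` is a conjugate of `y`.
      w-root∈ : ∀ {z} → eval w z ≈ 0# → z ∈ᶠ N
      w-root∈ {z} wz≈0 = splits-root {N} {f} M.hasDeg (splits y∈ f-mp) (pow-≈0 q (trans (sym (eval-map-^q f z))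
        (divides-root {List.map (_^ q) f} (over-mono {K} {F} K⊑F (over-map-^q K M.over))
          (trans (eval-map-^q f y) (trans (^-congˡ q M.root) 0^q≈0))
          (trans (sym (eval-w z)) (trans (^-congˡ q wz≈0) 0^q≈0)))))
      w∈ : Over F w
      w∈ = over-coeff F w λ n → root-closed (roots⇒coeff∈ {N} U.deg w w-lead w-above w-root∈ n)
        (Subfield.resp F (sym (coeff-w n)) (coeff∈ F U.over n))
      wy≈0 : eval w y ≈ 0#
      wy≈0 = pow-≈0 q (trans (eval-w y) U.root)
      reduce : ∀ g → Over F g → eval g y ∈ Comb F (powers y U.deg)
      reduce g g∈ = eval∈powers {F} {w} w∈ w-lead w-above wy≈0 {g} g∈

    -- Since `I` is closed under `q`-th roots, `N ⊓ I` contains every element of `N` whose `q`-th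
    -- power it contains. So `normal⇒adj` applies, and `adj-^^` iterates it.
    normal-adj-^^ : ∀ N → Normal K N → ∀ n {y} → y ∈ᶠ N → Adj (N ⊓ I) (y ^^ n) y
    normal-adj-^^ N normal = adj-^^ (N ⊓ I) (λ x∈ → proj₁ normal x∈ , K⊑I x∈) (mem N) (λ n → pow-closed N (q ℕ.^ n))
      (normal⇒adj N (N ⊓ I) normal (λ x∈ → proj₁ normal x∈ , K⊑I x∈) proj₁ (λ y∈ y^q∈ → y∈ , PI-root (proj₂ y^q∈)))

    module _ {N N′ : Subfield} (normal : Normal K N) (normal′ : Normal K N′) (disjoint : LinearlyDisjoint K N N′) where

      private
        K⊑N : K ⊑ N
        K⊑N = proj₁ normal
        K⊑N′ : K ⊑ N′
        K⊑N′ = proj₁ normal′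
        FF′ : Subfield
        FF′ = (N ⊓ I) ∙ (N′ ⊓ I)
        K⊑F : K ⊑ N ⊓ I
        K⊑F x∈ = K⊑N x∈ , K⊑I x∈
        K⊑F′ : K ⊑ N′ ⊓ I
        K⊑F′ x∈ = K⊑N′ x∈ , K⊑I x∈
        K⊑FF′ : K ⊑ FF′
        K⊑FF′ x∈ = ∙-left {N ⊓ I} {N′ ⊓ I} (K⊑F x∈)
        FF′⊑I : FF′ ⊑ I
        FF′⊑I = ∙-least {N ⊓ I} {N′ ⊓ I} I proj₂ proj₂

      open Disjoint {N} {N′} K⊑N K⊑N′ disjoint

      -- With E = P Q and E = F F′ D, where D = K E^(q^n) is disjoint from I for large n,
      -- the intersection E ∩ I is contained in F F′.
      ∙-⊓-I : ∀ P Q → K ⊑ P → P ⊑ N → K ⊑ Q → Q ⊑ N′ → ∃ (Basis K P) → ∃ (Basis K Q) →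
              (P ∙ Q) ⊓ I ⊑ (P ⊓ I) ∙ (Q ⊓ I)
      ∙-⊓-I P Q K⊑P P⊑N K⊑Q Q⊑N′ finP finQ {x} (x∈E , x∈I) =
        -- The family consists of the single pair `N ⊓ I` and `N′ ⊓ I`, so it remains to place `x`
        -- in their compositum `FF′`.
        ∙-∩ {P} {Q} {P ⊓ I} {Q ⊓ I} K⊑P P⊑N K⊑Q Q⊑N′ (λ x∈ → K⊑P x∈ , K⊑I x∈) proj₁ finP finQ
          {S = ⊤ {p}} (λ _ → N ⊓ I) (λ _ → N′ ⊓ I) (λ _ → K⊑F) (λ _ → proj₁) (λ _ → K⊑F′) (λ _ → proj₁)
          (λ x∈ h → x∈ , proj₂ (h tt)) (λ x∈ h → x∈ , proj₂ (h tt)) x∈E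
          (λ _ → go (stable-exists E K⊑E (finite-∙ {P} {Q} K⊑P P⊑N K⊑Q Q⊑N′ finP finQ)))
        where
        E : Subfield
        E = P ∙ Q
        K⊑E : K ⊑ E
        K⊑E x∈ = ∙-left {P} {Q} (K⊑P x∈)
        go : ∃ (Stable E) → x ∈ᶠ FF′
        -- The disjoint pair is now `I` and `D E n`: an element of `FF′ ∙ D E n` that lies in `I`
        -- lies in `FF′`.
        go (n , stable) = Disjoint.∙-∩-left {I} {D E n} K⊑I (K⊑D E n)
          (disjoint-sym {D E n} {I} (K⊑D E n) K⊑I (D-disjoint-I E n stable))
          {FF′} {D E n} K⊑FF′ FF′⊑I (K⊑D E n) (λ y∈ → y∈) (E⊑G x∈E) x∈I
          where
          G : Subfield
          G = FF′ ∙ D E n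
          P⊑G : P ⊑ G
          P⊑G y∈ = adj-least {N ⊓ I} G (λ z∈ → ∙-left {FF′} {D E n} (∙-left {N ⊓ I} {N′ ⊓ I} z∈))
            (∙-right {FF′} {D E n} (D-∋ E n (∙-left {P} {Q} y∈))) (normal-adj-^^ N normal n (P⊑N y∈))
          Q⊑G : Q ⊑ G
          Q⊑G y∈ = adj-least {N′ ⊓ I} G (λ z∈ → ∙-left {FF′} {D E n} (∙-right {N ⊓ I} {N′ ⊓ I} z∈))
            (∙-right {FF′} {D E n} (D-∋ E n (∙-right {P} {Q} y∈))) (normal-adj-^^ N′ normal′ n (Q⊑N′ y∈))
          E⊑G : E ⊑ G
          E⊑G = ∙-least {P} {Q} G P⊑G Q⊑G

      insep-∙ : ∀ P Q → K ⊑ P → P ⊑ N → K ⊑ Q → Q ⊑ N′ → ∃ (Basis K P) → ∃ (Basis K Q) →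
                insep K (P ∙ Q) ≑ insep K P ∙ insep K Q
      insep-∙ P Q K⊑P P⊑N K⊑Q Q⊑N′ finP finQ = ≐-trans (insep≑ (P ∙ Q) (λ x∈ → ∙-left {P} {Q} (K⊑P x∈)))
        (≐-trans (∙-⊓-I P Q K⊑P P⊑N K⊑Q Q⊑N′ finP finQ , ⊒)
          (∙-mono {P ⊓ I} {insep K P} {Q ⊓ I} {insep K Q} (proj₂ eqP) (proj₂ eqQ) ,
           ∙-mono {insep K P} {P ⊓ I} {insep K Q} {Q ⊓ I} (proj₁ eqP) (proj₁ eqQ)))
        where
        eqP : insep K P ≑ P ⊓ I
        eqP = insep≑ P K⊑P
        eqQ : insep K Q ≑ Q ⊓ I
        eqQ = insep≑ Q K⊑Q
        ⊒ : (P ⊓ I) ∙ (Q ⊓ I) ⊑ (P ∙ Q) ⊓ I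
        ⊒ = ∙-least {P ⊓ I} {Q ⊓ I} ((P ∙ Q) ⊓ I) (λ (y∈ , y∈I) → ∙-left {P} {Q} y∈ , y∈I) (λ (y∈ , y∈I) → ∙-right {P} {Q} y∈ , y∈I)

  private
    Char : Set ℓ₁
    Char = ∃[ q ] Prime q × q · 1# ≈ 0#

  -- Maximal separable and purely inseparable subextensions in any characteristic

  -- The dummy value `K` is the same for `E` and `E′`, so the equality also covers the case in which
  -- no largest subextension exists.
  largest-cong : ∀ {P : Pred Carrier p} {E E′} → E ≑ E′ → largestSubextension K P E ≑ largestSubextension K P E′
  largest-cong {P} {E} {E′} E≑E′ with em {P = ∃ (LargestSubextension K P E)}
  ... | yes (F , L) = ≐-sym (largest-unique {P} {E′} {F} (largest-resp {P} {E} {E′} {F} E≑E′ L))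
  ... | no ∄ with em {P = ∃ (LargestSubextension K P E′)}
  ... | yes (F , L) = contradiction (F , largest-resp {P} {E′} {E} {F} (≐-sym E≑E′) L) ∄
  ... | no _ = ≐-refl

  -- The dummy value `K` satisfies both inclusions as well, so they are available before existence
  -- is settled.
  largest-bounds : ∀ (P : Pred Carrier p) E → K ⊑ E → K ⊑ largestSubextension K P E × largestSubextension K P E ⊑ E
  largest-bounds P E K⊑E with em {P = ∃ (LargestSubextension K P E)}
  ... | yes (F , L) = LargestSubextension.above L , LargestSubextension.below L
  ... | no _ = id , K⊑E

  K⊑sep : ∀ E → K ⊑ E → K ⊑ sep K E
  K⊑sep E K⊑E = proj₁ (largest-bounds (Separable K) E K⊑E)

  sep⊑ : ∀ E → K ⊑ E → sep K E ⊑ E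
  sep⊑ E K⊑E = proj₂ (largest-bounds (Separable K) E K⊑E)

  K⊑insep : ∀ E → K ⊑ E → K ⊑ insep K E
  K⊑insep E K⊑E = proj₁ (largest-bounds (PurelyInseparable K) E K⊑E)

  insep⊑ : ∀ E → K ⊑ E → insep K E ⊑ E
  insep⊑ E K⊑E = proj₂ (largest-bounds (PurelyInseparable K) E K⊑E)

  ∙-cong : ∀ {A A′ B B′} → A ≑ A′ → B ≑ B′ → A ∙ B ≑ A′ ∙ B′
  ∙-cong {A} {A′} {B} {B′} (A⊑ , A⊒) (B⊑ , B⊒) = ∙-mono {A} {A′} {B} {B′} A⊑ B⊑ , ∙-mono {A′} {A} {B′} {B} A⊒ B⊒

  module Char0 (char0 : Characteristic0) where

    sep≑ : ∀ E → K ⊑ E → sep K E ≑ E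
    sep≑ E K⊑E = largest-unique {Separable K} {E} {E} (record
      { above = K⊑E ; below = id ; all = λ {x} _ → characteristic0⇒separable char0 x ; largest = λ _ _ F⊑E _ → F⊑E })

    insep≑ : ∀ E → K ⊑ E → insep K E ≑ K
    insep≑ E K⊑E = largest-unique {PurelyInseparable K} {E} {K} (record
      { above = id ; below = K⊑E ; all = inj₁ ; largest = λ F _ _ F-pi x∈ → go (F-pi x∈) })
      where
      go : ∀ {x} → PurelyInseparable K x → x ∈ᶠ K
      go (inj₁ x∈) = x∈
      go (inj₂ (q , _ , q-prime , q≈0 , _)) = contradiction q≈0 (char0 q q-prime)

  sep-compositum : ∀ A B → K ⊑ A → K ⊑ B → ∃ (Basis K A) → ∃ (Basis K B) → ∃ (Basis K (A ∙ B)) →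
                   sep K (A ∙ B) ≑ sep K A ∙ sep K B
  sep-compositum A B K⊑A K⊑B finA finB finAB = go em
    where
    go : Dec Char → sep K (A ∙ B) ≑ sep K A ∙ sep K B
    go (yes (q , q-prime , q≈0)) = CharP.sep-∙ q q-prime q≈0 A B K⊑A K⊑B finA finB finAB
    go (no ∄) = ≐-trans (sep≑ (A ∙ B) (λ x∈ → ∙-left {A} {B} (K⊑A x∈)))
      (∙-cong {A} {sep K A} {B} {sep K B} (≐-sym (sep≑ A K⊑A)) (≐-sym (sep≑ B K⊑B)))
      where
      char0 : Characteristic0
      char0 q q-prime q≈0 = ∄ (q , q-prime , q≈0)
      open Char0 char0

  insep-compositum : ∀ {N N′} → Normal K N → Normal K N′ → LinearlyDisjoint K N N′ →
                     ∀ P Q → K ⊑ P → P ⊑ N → K ⊑ Q → Q ⊑ N′ → ∃ (Basis K P) → ∃ (Basis K Q) →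
                     insep K (P ∙ Q) ≑ insep K P ∙ insep K Q
  insep-compositum {N} {N′} normal normal′ disjoint P Q K⊑P P⊑N K⊑Q Q⊑N′ finP finQ = go em
    where
    go : Dec Char → insep K (P ∙ Q) ≑ insep K P ∙ insep K Q
    go (yes (q , q-prime , q≈0)) = CharP.insep-∙ q q-prime q≈0 {N} {N′} normal normal′ disjoint P Q K⊑P P⊑N K⊑Q Q⊑N′ finP finQ
    go (no ∄) = ≐-trans (insep≑ (P ∙ Q) (λ x∈ → ∙-left {P} {Q} (K⊑P x∈)))
      (≐-trans (∙-left {K} {K} , ∙-least {K} {K} K id id)
        (∙-cong {K} {insep K P} {K} {insep K Q} (≐-sym (insep≑ P K⊑P)) (≐-sym (insep≑ Q K⊑Q))))
      where
      char0 : Characteristic0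
      char0 q q-prime q≈0 = ∄ (q , q-prime , q≈0)
      open Char0 char0

  -- K-isomorphisms as relations

  -- As relations, isomorphisms can be restricted, inverted and glued without membership proofs or
  -- chosen values. Functionality and injectivity reduce, by taking differences, to `≈0⇒` and `≈0⇐`.
  record IsIso (E F : Subfield) (R : Carrier → Carrier → Set p) : Set p where
    field
      dom   : ∀ {x y} → R x y → x ∈ᶠ E
      cod   : ∀ {x y} → R x y → y ∈ᶠ F
      total : ∀ {x} → x ∈ᶠ E → ∃[ y ] R x y
      onto  : ∀ {y} → y ∈ᶠ F → ∃[ x ] R x y
      resp-iso : ∀ {x x′ y y′} → x ≈ x′ → y ≈ y′ → R x y → R x′ y′
      +-iso : ∀ {x x′ y y′} → R x y → R x′ y′ → R (x + x′) (y + y′)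
      *-iso : ∀ {x x′ y y′} → R x y → R x′ y′ → R (x * x′) (y * y′)
      fixes : ∀ {a} → a ∈ᶠ K → R a a
      ≈0⇒   : ∀ {x y} → R x y → x ≈ 0# → y ≈ 0#
      ≈0⇐   : ∀ {x y} → R x y → y ≈ 0# → x ≈ 0#

    neg-iso : ∀ {x y} → R x y → R (- x) (- y)
    neg-iso xy = resp-iso (-1*x _) (-1*x _) (*-iso (fixes (Subfield.neg-closed K (Subfield.1#-closed K))) xy)
      where
      -1*x : ∀ x → - 1# * x ≈ - x
      -1*x = solve 1 (λ x → :- con (+ 1) :* x := :- x) refl

    functional : ∀ {x x′ y y′} → x ≈ x′ → R x y → R x′ y′ → y ≈ y′
    functional x≈x′ xy x′y′ = x-y≈0⇒x≈y (≈0⇒ (+-iso xy (neg-iso x′y′)) (x≈y⇒x∙y⁻¹≈ε x≈x′))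

    injective : ∀ {x x′ y y′} → y ≈ y′ → R x y → R x′ y′ → x ≈ x′
    injective y≈y′ xy x′y′ = x-y≈0⇒x≈y (≈0⇐ (+-iso xy (neg-iso x′y′)) (x≈y⇒x∙y⁻¹≈ε y≈y′))

    eval-iso : ∀ {f x y} → Over K f → R x y → R (eval f x) (eval f y)
    eval-iso []        xy = fixes (Subfield.0#-closed K)
    eval-iso (a∈ ∷ f∈) xy = +-iso (fixes a∈) (*-iso xy (eval-iso f∈ xy))

    lin-iso : ∀ {n} {a v w : Vector Carrier n} → (∀ i → a i ∈ᶠ K) → (∀ i → R (v i) (w i)) → R (lin a v) (lin a w)
    lin-iso {zero}  a∈ vw = fixes (Subfield.0#-closed K)
    lin-iso {suc n} a∈ vw = +-iso (*-iso (fixes (a∈ zero)) (vw zero)) (lin-iso (a∈ ∘ suc) (vw ∘ suc))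

    -- The image of x is a conjugate of x.
    normal-iso : ∀ {N x y} → Normal K N → x ∈ᶠ N → R x y → y ∈ᶠ N
    normal-iso {N} {x} {y} (_ , splits) x∈ xy = splits-root {N} {proj₁ mp} hasDeg (splits x∈ (proj₂ mp)) (≈0⇒ (eval-iso over xy) root)
      where
      mp : ∃ (MinimalPolynomial K x)
      mp = minimal-polynomial K id x
      open MinimalPolynomial (proj₂ mp)

    ⇒≅ : E ≅[ K ] F
    ⇒≅ = record
      { to    = f
      ; isIso = record
        { isRingMonomorphism = record
          { isRingHomomorphism = record
            { isSemiringHomomorphism = record
              { isNearSemiringHomomorphism = record
                { +-isMonoidHomomorphism = record
                  { isMagmaHomomorphism = record
                    { isRelHomomorphism = record { cong = λ {x} {y} eq → functional eq (f-R x) (f-R y) }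
                    ; homo = λ x y → functional refl (f-R _) (+-iso (f-R x) (f-R y)) }
                  ; ε-homo = functional refl (f-R _) (fixes (Subfield.0#-closed K)) }
                ; *-homo = λ x y → functional refl (f-R _) (*-iso (f-R x) (f-R y)) }
              ; 1#-homo = functional refl (f-R _) (fixes (Subfield.1#-closed K)) }
            ; -‿homo = λ x → functional refl (f-R _) (neg-iso (f-R x)) }
          ; injective = λ {x} {y} eq → injective eq (f-R x) (f-R y) }
        ; surjective = λ (y , y∈) → (proj₁ (onto y∈) , dom (proj₂ (onto y∈))) , λ {z} eq → functional eq (f-R z) (proj₂ (onto y∈)) }
      ; fixes = λ x x∈K → functional refl (f-R x) (fixes x∈K)
      }
      where
      f : El E → El F
      f (x , x∈) = proj₁ (total x∈) , cod (proj₂ (total x∈))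
      f-R : ∀ x → R (proj₁ x) (proj₁ (f x))
      f-R (x , x∈) = proj₂ (total x∈)

    to-R : ∀ (x : El E) → R (proj₁ x) (proj₁ (_≅[_]_.to ⇒≅ x))
    to-R (x , x∈) = proj₂ (total x∈)

  open IsIso using (⇒≅; to-R)

  Graph : ∀ {E F} → E ≅[ K ] F → Carrier → Carrier → Set p
  Graph {E} σ x y = Σ[ x∈ ∈ x ∈ᶠ E ] Lift p (proj₁ (_≅[_]_.to σ (x , x∈)) ≈ y)

  graph-iso : ∀ {E F} (σ : E ≅[ K ] F) → K ⊑ E → IsIso E F (Graph σ)
  graph-iso {E} {F} σ K⊑E = record
    { dom   = proj₁
    ; cod   = λ { (x∈ , lift eq) → Subfield.resp F eq (proj₂ (to (_ , x∈))) }
    ; total = λ x∈ → _ , x∈ , lift refl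
    ; onto  = λ {y} y∈ → let ((x , x∈) , eq) = surjective (y , y∈) in x , x∈ , lift (eq refl)
    ; resp-iso = λ { x≈x′ y≈y′ (x∈ , lift eq) → Subfield.resp E x≈x′ x∈ , lift (trans (⟦⟧-cong (sym x≈x′)) (trans eq y≈y′)) }
    ; +-iso = λ { (x∈ , lift eq) (x′∈ , lift eq′) → Subfield.+-closed E x∈ x′∈ , lift (trans (+-homo _ _) (+-cong eq eq′)) }
    ; *-iso = λ { (x∈ , lift eq) (x′∈ , lift eq′) → Subfield.*-closed E x∈ x′∈ , lift (trans (*-homo _ _) (*-cong eq eq′)) }
    ; fixes = λ a∈ → K⊑E a∈ , lift (fixes _ a∈)
    ; ≈0⇒   = λ { (x∈ , lift eq) x≈0 → trans (sym eq) (trans (⟦⟧-cong {x = _ , x∈} {y = 0# , Subfield.0#-closed E} x≈0) 0#-homo) }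
    ; ≈0⇐   = λ { (x∈ , lift eq) y≈0 → injective {x = _ , x∈} {y = 0# , Subfield.0#-closed E} (trans eq (trans y≈0 (sym 0#-homo))) }
    }
    where
    open _≅[_]_ σ
    open RingMorphisms.IsRingIsomorphism isIso

  iso-K⊑ : ∀ {E F R} → IsIso E F R → K ⊑ F
  iso-K⊑ iso a∈ = IsIso.cod iso (IsIso.fixes iso a∈)

  image : ∀ {E F R} → IsIso E F R → ∀ E₁ → K ⊑ E₁ → E₁ ⊑ E → Subfield
  image {E} {F} {R} iso E₁ K⊑E₁ E₁⊑E = record
    { mem        = λ y → ∃[ x ] x ∈ᶠ E₁ × R x y
    ; resp       = λ { y≈y′ (x , x∈ , xy) → x , x∈ , iso.resp-iso refl y≈y′ xy }
    ; 0#-closed  = 0# , E₁.0#-closed , iso.fixes (Subfield.0#-closed K)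
    ; 1#-closed  = 1# , E₁.1#-closed , iso.fixes (Subfield.1#-closed K)
    ; +-closed   = λ { (x , x∈ , xy) (x′ , x′∈ , xy′) → _ , E₁.+-closed x∈ x′∈ , iso.+-iso xy xy′ }
    ; *-closed   = λ { (x , x∈ , xy) (x′ , x′∈ , xy′) → _ , E₁.*-closed x∈ x′∈ , iso.*-iso xy xy′ }
    ; neg-closed = λ { (x , x∈ , xy) → _ , E₁.neg-closed x∈ , iso.neg-iso xy }
    ; inv-closed = inv
    }
    where
    module iso = IsIso iso
    module E₁ = Subfield E₁
    inv : ∀ {y z} → (∃[ x ] x ∈ᶠ E₁ × R x y) → y * z ≈ 1# → ∃[ x ] x ∈ᶠ E₁ × R x z
    inv {y} {z} (x , x∈ , xy) yz≈1 = x′ , x′∈ , iso.resp-iso refl y′≈z (proj₂ (iso.total (E₁⊑E x′∈)))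
      where
      x≉0 : ¬ x ≈ 0#
      x≉0 x≈0 = 1≉0 (trans (sym yz≈1) (trans (*-congʳ (iso.≈0⇒ xy x≈0)) (zeroˡ z)))
      x′ : Carrier
      x′ = proj₁ (inverse x≉0)
      x′∈ : x′ ∈ᶠ E₁
      x′∈ = E₁.inv-closed x∈ (proj₂ (inverse x≉0))
      y′ : Carrier
      y′ = proj₁ (iso.total (E₁⊑E x′∈))
      yy′≈1 : y * y′ ≈ 1#
      yy′≈1 = iso.functional (proj₂ (inverse x≉0)) (iso.*-iso xy (proj₂ (iso.total (E₁⊑E x′∈)))) (iso.fixes (Subfield.1#-closed K))
      y′≈z : y′ ≈ z
      y′≈z = begin
        y′           ≈⟨ *-identityʳ y′ ⟨
        y′ * 1#      ≈⟨ *-congˡ yz≈1 ⟨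
        y′ * (y * z) ≈⟨ solve 3 (λ s t u → s :* (t :* u) := t :* s :* u) refl y′ y z ⟩
        y * y′ * z   ≈⟨ *-congʳ yy′≈1 ⟩
        1# * z       ≈⟨ *-identityˡ z ⟩
        z            ∎

  restrict-iso : ∀ {E F R} (iso : IsIso E F R) E₁ (K⊑E₁ : K ⊑ E₁) (E₁⊑E : E₁ ⊑ E) →
                 IsIso E₁ (image iso E₁ K⊑E₁ E₁⊑E) (λ x y → x ∈ᶠ E₁ × R x y)
  restrict-iso {R = R} iso E₁ K⊑E₁ E₁⊑E = record
    { dom   = proj₁
    ; cod   = λ (x∈ , xy) → _ , x∈ , xy
    ; total = λ x∈ → let (y , xy) = iso.total (E₁⊑E x∈) in y , x∈ , xy
    ; onto  = λ (x , x∈ , xy) → x , x∈ , xy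
    ; resp-iso = λ x≈ y≈ (x∈ , xy) → E₁.resp x≈ x∈ , iso.resp-iso x≈ y≈ xy
    ; +-iso = λ (x∈ , xy) (x′∈ , xy′) → E₁.+-closed x∈ x′∈ , iso.+-iso xy xy′
    ; *-iso = λ (x∈ , xy) (x′∈ , xy′) → E₁.*-closed x∈ x′∈ , iso.*-iso xy xy′
    ; fixes = λ a∈ → K⊑E₁ a∈ , iso.fixes a∈
    ; ≈0⇒   = λ (_ , xy) → iso.≈0⇒ xy
    ; ≈0⇐   = λ (_ , xy) → iso.≈0⇐ xy
    }
    where
    module iso = IsIso iso
    module E₁ = Subfield E₁

  -- The tensor product of two isomorphisms
  data Glue (R₁ R₂ : Carrier → Carrier → Set p) : Carrier → Carrier → Set p where
    zeroᵍ : Glue R₁ R₂ 0# 0#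
    pure  : ∀ {a a′ b b′} → R₁ a a′ → R₂ b b′ → Glue R₁ R₂ (a * b) (a′ * b′)
    plus  : ∀ {x x′ y y′} → Glue R₁ R₂ x y → Glue R₁ R₂ x′ y′ → Glue R₁ R₂ (x + x′) (y + y′)
    respᵍ : ∀ {x x′ y y′} → x ≈ x′ → y ≈ y′ → Glue R₁ R₂ x y → Glue R₁ R₂ x′ y′

  module _ {N N′ : Subfield} (K⊑N : K ⊑ N) (K⊑N′ : K ⊑ N′) (disjoint : LinearlyDisjoint K N N′)
           {E₁ E₂ F₁ F₂ : Subfield} {R₁ R₂ : Carrier → Carrier → Set p}
           (E₁⊑N : E₁ ⊑ N) (F₁⊑N : F₁ ⊑ N) (E₂⊑N′ : E₂ ⊑ N′) (F₂⊑N′ : F₂ ⊑ N′)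
           (K⊑E₁ : K ⊑ E₁) (K⊑E₂ : K ⊑ E₂) (finE₂ : ∃ (Basis K E₂))
           (iso₁ : IsIso E₁ F₁ R₁) (iso₂ : IsIso E₂ F₂ R₂) where

    private
      module I₁ = IsIso iso₁
      module I₂ = IsIso iso₂
      G : Carrier → Carrier → Set p
      G = Glue R₁ R₂
      open Disjoint {N} {N′} K⊑N K⊑N′ disjoint using (disjoint′)

    glue-* : ∀ {x x′ y y′} → G x y → G x′ y′ → G (x * x′) (y * y′)
    glue-* zeroᵍ h = respᵍ (sym (zeroˡ _)) (sym (zeroˡ _)) zeroᵍ
    glue-* (plus g₁ g₂) h = respᵍ (sym (distribʳ _ _ _)) (sym (distribʳ _ _ _)) (plus (glue-* g₁ h) (glue-* g₂ h))
    glue-* (respᵍ x≈ y≈ g) h = respᵍ (*-congʳ x≈) (*-congʳ y≈) (glue-* g h)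
    glue-* g@(pure _ _) zeroᵍ = respᵍ (sym (zeroʳ _)) (sym (zeroʳ _)) zeroᵍ
    glue-* g@(pure _ _) (plus h₁ h₂) = respᵍ (sym (distribˡ _ _ _)) (sym (distribˡ _ _ _)) (plus (glue-* g h₁) (glue-* g h₂))
    glue-* g@(pure _ _) (respᵍ x≈ y≈ h) = respᵍ (*-congˡ x≈) (*-congˡ y≈) (glue-* g h)
    glue-* (pure {a} {a′} {b} {b′} aa bb) (pure {c} {c′} {d} {d′} cc dd) = respᵍ (swap a c b d) (swap a′ c′ b′ d′) (pure (I₁.*-iso aa cc) (I₂.*-iso bb dd))
      where
      swap : ∀ a c b d → a * c * (b * d) ≈ a * b * (c * d)
      swap = solve 4 (λ a c b d → a :* c :* (b :* d) := a :* b :* (c :* d)) refl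

    glue-lin-total : ∀ {n} {a v : Vector Carrier n} → (∀ i → a i ∈ᶠ E₁) → (∀ i → v i ∈ᶠ E₂) → ∃[ y ] G (lin a v) y
    glue-lin-total {zero}  a∈ v∈ = 0# , zeroᵍ
    glue-lin-total {suc n} a∈ v∈ = _ , plus (pure (proj₂ (I₁.total (a∈ zero))) (proj₂ (I₂.total (v∈ zero)))) (proj₂ (glue-lin-total (a∈ ∘ suc) (v∈ ∘ suc)))

    glue-lin-onto : ∀ {n} {a v : Vector Carrier n} → (∀ i → a i ∈ᶠ F₁) → (∀ i → v i ∈ᶠ F₂) → ∃[ x ] G x (lin a v)
    glue-lin-onto {zero}  a∈ v∈ = 0# , zeroᵍ
    glue-lin-onto {suc n} a∈ v∈ = _ , plus (pure (proj₂ (I₁.onto (a∈ zero))) (proj₂ (I₂.onto (v∈ zero)))) (proj₂ (glue-lin-onto (a∈ ∘ suc) (v∈ ∘ suc)))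

    private
      n : ℕ
      n = proj₁ finE₂
      module C = Basis (proj₂ finE₂)
      c′ : Vector Carrier n
      c′ i = proj₁ (I₂.total (C.vec∈ i))
      cc′ : ∀ i → R₂ (C.vec i) (c′ i)
      cc′ i = proj₂ (I₂.total (C.vec∈ i))

    c′-li : LinearlyIndependent K c′
    c′-li a a∈ eq = C.independent a a∈ (I₂.≈0⇐ (I₂.lin-iso a∈ cc′) eq)

    -- A pair in `Glue` comes with no normal form. Here both sides are expanded along one `K`-basis
    -- of `E₂` and its image `c′`, with coefficients that correspond under `R₁`.
    record Coordinates (x y : Carrier) : Set p where
      constructor coordinates
      field
        {e e′} : Vector Carrier n
        ee′    : ∀ i → R₁ (e i) (e′ i)
        x≈     : x ≈ lin e C.vec
        y≈     : y ≈ lin e′ c′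

    glue-coordinates : ∀ {x y} → G x y → Coordinates x y
    glue-coordinates zeroᵍ = coordinates {e = λ _ → 0#} {λ _ → 0#} (λ _ → I₁.fixes (Subfield.0#-closed K))
      (sym (lin-0 C.vec λ _ → refl)) (sym (lin-0 c′ λ _ → refl))
    glue-coordinates (plus g h) = add (glue-coordinates g) (glue-coordinates h)
      where
      add : ∀ {x x′ y y′} → Coordinates x y → Coordinates x′ y′ → Coordinates (x + x′) (y + y′)
      add (coordinates {e} {e′} ee′ x≈ y≈) (coordinates {f} {f′} ff′ x′≈ y′≈) = coordinates {e = λ i → e i + f i} {λ i → e′ i + f′ i}
        (λ i → I₁.+-iso (ee′ i) (ff′ i)) (trans (+-cong x≈ x′≈) (sym (lin-+ e f C.vec))) (trans (+-cong y≈ y′≈) (sym (lin-+ e′ f′ c′)))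
    glue-coordinates (respᵍ x≈x′ y≈y′ g) = move (glue-coordinates g)
      where
      move : Coordinates _ _ → Coordinates _ _
      move (coordinates ee′ x≈ y≈) = coordinates ee′ (trans (sym x≈x′) x≈) (trans (sym y≈y′) y≈)
    glue-coordinates (pure {a} {a′} {b} {b′} aa bb) = scale′ (basis-spans (proj₂ finE₂) (I₂.dom bb))
      where
      scale′ : Comb K C.vec b → Coordinates (a * b) (a′ * b′)
      scale′ (comb β β∈ b≈) = coordinates {e = λ i → a * β i} {λ i → a′ * β i} (λ i → I₁.*-iso aa (I₁.fixes (β∈ i)))
        (trans (*-congˡ b≈) (sym (lin-* a β C.vec)))
        (trans (*-congˡ (I₂.functional b≈ bb (I₂.lin-iso β∈ cc′))) (sym (lin-* a′ β c′)))

    -- The basis of `E₂` stays independent over `N`, so the coordinates of zero vanish, and so do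
    -- the corresponding ones under `R₁`. The converse uses `c′` in the same way.
    glue-≈0⇒ : ∀ {x y} → G x y → x ≈ 0# → y ≈ 0#
    glue-≈0⇒ g x≈0 = go (glue-coordinates g) x≈0
      where
      go : ∀ {x y} → Coordinates x y → x ≈ 0# → y ≈ 0#
      go (coordinates {e} {e′} ee′ x≈ y≈) x≈0 = trans y≈ (lin-0 c′ λ i → I₁.≈0⇒ (ee′ i)
        (disjoint′ C.vec (λ j → E₂⊑N′ (C.vec∈ j)) C.independent e (λ j → E₁⊑N (I₁.dom (ee′ j))) (trans (sym x≈) x≈0) i))

    glue-≈0⇐ : ∀ {x y} → G x y → y ≈ 0# → x ≈ 0#
    glue-≈0⇐ g y≈0 = go (glue-coordinates g) y≈0
      where
      go : ∀ {x y} → Coordinates x y → y ≈ 0# → x ≈ 0#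
      go (coordinates {e} {e′} ee′ x≈ y≈) y≈0 = trans x≈ (lin-0 C.vec λ i → I₁.≈0⇐ (ee′ i)
        (disjoint′ c′ (λ j → F₂⊑N′ (I₂.cod (cc′ j))) c′-li e′ (λ j → F₁⊑N (I₁.cod (ee′ j))) (trans (sym y≈) y≈0) i))

    glue-iso : IsIso (E₁ ∙ E₂) (F₁ ∙ F₂) G
    glue-iso = record
      { dom   = dom
      ; cod   = cod
      ; total = λ x∈ → total (∙⇒span {E₁} {E₂} K⊑E₁ K⊑E₂ x∈)
      ; onto  = λ y∈ → onto (∙⇒span {F₁} {F₂} (iso-K⊑ iso₁) (iso-K⊑ iso₂) y∈)
      ; resp-iso = respᵍ
      ; +-iso = plus
      ; *-iso = glue-*
      ; fixes = λ {a} a∈ → respᵍ (*-identityʳ a) (*-identityʳ a) (pure (I₁.fixes a∈) (I₂.fixes (Subfield.1#-closed K)))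
      ; ≈0⇒   = glue-≈0⇒
      ; ≈0⇐   = glue-≈0⇐
      }
      where
      module E = Subfield (E₁ ∙ E₂)
      module F = Subfield (F₁ ∙ F₂)
      dom : ∀ {x y} → G x y → x ∈ᶠ E₁ ∙ E₂
      dom zeroᵍ           = E.0#-closed
      dom (pure aa bb)    = E.*-closed (∙-left {E₁} {E₂} (I₁.dom aa)) (∙-right {E₁} {E₂} (I₂.dom bb))
      dom (plus g h)      = E.+-closed (dom g) (dom h)
      dom (respᵍ x≈ _ g)  = E.resp x≈ (dom g)
      cod : ∀ {x y} → G x y → y ∈ᶠ F₁ ∙ F₂
      cod zeroᵍ           = F.0#-closed
      cod (pure aa bb)    = F.*-closed (∙-left {F₁} {F₂} (I₁.cod aa)) (∙-right {F₁} {F₂} (I₂.cod bb))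
      cod (plus g h)      = F.+-closed (cod g) (cod h)
      cod (respᵍ _ y≈ g)  = F.resp y≈ (cod g)
      total : ∀ {x} → Span E₁ (mem E₂) x → ∃[ y ] G x y
      total (span v v∈ (comb a a∈ x≈)) = map₂ (respᵍ (sym x≈) refl) (glue-lin-total a∈ v∈)
      onto : ∀ {y} → Span F₁ (mem F₂) y → ∃[ x ] G x y
      onto (span v v∈ (comb a a∈ y≈)) = map₂ (respᵍ refl (sym y≈)) (glue-lin-onto a∈ v∈)

    glue-left : ∀ {x y} → R₁ x y → G x y
    glue-left xy = respᵍ (*-identityʳ _) (*-identityʳ _) (pure xy (I₂.fixes (Subfield.1#-closed K)))

    glue-right : ∀ {x y} → R₂ x y → G x y
    glue-right xy = respᵍ (*-identityˡ _) (*-identityˡ _) (pure (I₁.fixes (Subfield.1#-closed K)) xy)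

  iso-resp-≑ : ∀ {E E′ F F′ R} → E ≑ E′ → F ≑ F′ → IsIso E F R → IsIso E′ F′ R
  iso-resp-≑ (E⊑ , E⊒) (F⊑ , F⊒) iso = record
    { dom = λ xy → E⊑ (dom xy) ; cod = λ xy → F⊑ (cod xy) ; total = λ x∈ → total (E⊒ x∈) ; onto = λ y∈ → onto (F⊒ y∈)
    ; resp-iso = resp-iso ; +-iso = +-iso ; *-iso = *-iso ; fixes = fixes ; ≈0⇒ = ≈0⇒ ; ≈0⇐ = ≈0⇐ }
    where
    open IsIso iso

  flip-iso : ∀ {E F R} → IsIso E F R → IsIso F E (λ y x → R x y)
  flip-iso iso = record
    { dom = cod ; cod = dom ; total = onto ; onto = total ; resp-iso = λ y≈ x≈ → resp-iso x≈ y≈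
    ; +-iso = +-iso ; *-iso = *-iso ; fixes = fixes ; ≈0⇒ = ≈0⇐ ; ≈0⇐ = ≈0⇒ }
    where
    open IsIso iso

  id-iso : ∀ E → K ⊑ E → IsIso E E (λ x y → x ∈ᶠ E × Lift p (x ≈ y))
  id-iso E K⊑E = record
    { dom   = proj₁
    ; cod   = λ { (x∈ , lift x≈y) → E.resp x≈y x∈ }
    ; total = λ {x} x∈ → x , x∈ , lift refl
    ; onto  = λ {x} x∈ → x , x∈ , lift refl
    ; resp-iso = λ { x≈ y≈ (x∈ , lift x≈y) → E.resp x≈ x∈ , lift (trans (sym x≈) (trans x≈y y≈)) }
    ; +-iso = λ { (x∈ , lift eq) (y∈ , lift eq′) → E.+-closed x∈ y∈ , lift (+-cong eq eq′) }
    ; *-iso = λ { (x∈ , lift eq) (y∈ , lift eq′) → E.*-closed x∈ y∈ , lift (*-cong eq eq′) }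
    ; fixes = λ a∈ → K⊑E a∈ , lift refl
    ; ≈0⇒   = λ { (_ , lift eq) x≈0 → trans (sym eq) x≈0 }
    ; ≈0⇐   = λ { (_ , lift eq) y≈0 → trans eq y≈0 }
    }
    where
    module E = Subfield E

  -- An isomorphism extending `R₁` and `R₂` contains all they generate. As isomorphisms are
  -- functional, a glued map coincides with any common extension.
  glue-⊆ : ∀ {E F R R₁ R₂} → IsIso E F R → (∀ {x y} → R₁ x y → R x y) → (∀ {x y} → R₂ x y → R x y) →
           ∀ {x y} → Glue R₁ R₂ x y → R x y
  glue-⊆ {R = R} {R₁} {R₂} iso R₁⊆R R₂⊆R = go
    where
    open IsIso iso
    go : ∀ {x y} → Glue R₁ R₂ x y → R x y
    go zeroᵍ           = fixes (Subfield.0#-closed K)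
    go (pure aa bb)    = *-iso (R₁⊆R aa) (R₂⊆R bb)
    go (plus g h)      = +-iso (go g) (go h)
    go (respᵍ x≈ y≈ g) = resp-iso x≈ y≈ (go g)

  graph-⇒≅ : ∀ {E F R} (iso : IsIso E F R) → ∀ {x y} → Graph (⇒≅ iso) x y → R x y
  graph-⇒≅ iso (x∈ , lift eq) = IsIso.resp-iso iso refl eq (to-R iso (_ , x∈))

  graph-to : ∀ {E F} (σ : E ≅[ K ] F) (x : El E) → Graph σ (proj₁ x) (proj₁ (_≅[_]_.to σ x))
  graph-to σ (x , x∈) = x∈ , lift refl

  -- Automorphisms and copies of a compositum

  module Magnification {N N′ : Subfield} (normal : Normal K N) (normal′ : Normal K N′) (disjoint : LinearlyDisjoint K N N′) where

    private
      K⊑N : K ⊑ N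
      K⊑N = proj₁ normal
      K⊑N′ : K ⊑ N′
      K⊑N′ = proj₁ normal′

    open Disjoint {N} {N′} K⊑N K⊑N′ disjoint

    ∙-∩-right : ∀ {A B x} → K ⊑ A → A ⊑ N → K ⊑ B → B ⊑ N′ → x ∈ᶠ A ∙ B → x ∈ᶠ N′ → x ∈ᶠ B
    ∙-∩-right {A} {B} K⊑A A⊑N K⊑B B⊑N′ x∈ = Disjoint.∙-∩-left {N′} {N} K⊑N′ K⊑N disjoint′ {B} {A} K⊑B B⊑N′ K⊑A A⊑N (∙-comm {A} {B} x∈)

    module _ {L J L′ : Subfield} (K⊑L : K ⊑ L) (L⊑N : L ⊑ N) (K⊑J : K ⊑ J) (J⊑N′ : J ⊑ N′)
             (finJ : ∃ (Basis K J)) (LJ≑L′ : L ∙ J ≑ L′) where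

      private
        L⊑L′ : L ⊑ L′
        L⊑L′ x∈ = proj₁ LJ≑L′ (∙-left {L} {J} x∈)
        J⊑L′ : J ⊑ L′
        J⊑L′ x∈ = proj₁ LJ≑L′ (∙-right {L} {J} x∈)
        K⊑L′ : K ⊑ L′
        K⊑L′ x∈ = L⊑L′ (K⊑L x∈)

      glued : ∀ {F₁ F₂ R₁ R₂} → F₁ ⊑ N → F₂ ⊑ N′ → IsIso L F₁ R₁ → IsIso J F₂ R₂ → IsIso L′ (F₁ ∙ F₂) (Glue R₁ R₂)
      glued {F₁} {F₂} F₁⊑N F₂⊑N′ iso₁ iso₂ = iso-resp-≑ {F = F₁ ∙ F₂} LJ≑L′ ≐-refl
        (glue-iso {N} {N′} K⊑N K⊑N′ disjoint {L} {J} {F₁} {F₂} L⊑N F₁⊑N J⊑N′ F₂⊑N′ K⊑L K⊑J finJ iso₁ iso₂)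

      module _ {F R} (iso : IsIso L′ F R) where

        image-L image-J : Subfield
        image-L = image iso L K⊑L L⊑L′
        image-J = image iso J K⊑J J⊑L′

        image-L⊑ : ∀ {M} → F ⊑ M → image-L ⊑ M
        image-L⊑ F⊑M (x , x∈ , xy) = F⊑M (IsIso.cod iso xy)

        image-J⊑ : ∀ {M} → F ⊑ M → image-J ⊑ M
        image-J⊑ F⊑M (x , x∈ , xy) = F⊑M (IsIso.cod iso xy)

        image-L⊑N : image-L ⊑ N
        image-L⊑N (x , x∈ , xy) = IsIso.normal-iso iso {N} normal (L⊑N x∈) xy

        image-J⊑N′ : image-J ⊑ N′
        image-J⊑N′ (x , x∈ , xy) = IsIso.normal-iso iso {N′} normal′ (J⊑N′ x∈) xy

        restrict-L : IsIso L image-L (λ x y → x ∈ᶠ L × R x y)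
        restrict-L = restrict-iso iso L K⊑L L⊑L′

        restrict-J : IsIso J image-J (λ x y → x ∈ᶠ J × R x y)
        restrict-J = restrict-iso iso J K⊑J J⊑L′

        -- Gluing the two restrictions gives an isomorphism of `L′` onto the compositum of the
        -- images. Its relation is contained in `R`, so every value of `R` lies in that compositum.
        images-∙ : image-L ∙ image-J ≑ F
        images-∙ = ∙-least {image-L} {image-J} F (λ {y} → image-L⊑ {F} id {y}) (λ {y} → image-J⊑ {F} id {y}) , λ y∈ → go (IsIso.onto iso y∈)
          where
          glue : IsIso L′ (image-L ∙ image-J) (Glue (λ x y → x ∈ᶠ L × R x y) (λ x y → x ∈ᶠ J × R x y))
          glue = glued {image-L} {image-J} image-L⊑N image-J⊑N′ restrict-L restrict-J
          go : ∀ {y} → (∃[ x ] R x y) → y ∈ᶠ image-L ∙ image-J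
          go (x , xy) = Subfield.resp (image-L ∙ image-J) (IsIso.functional iso refl (glue-⊆ iso proj₂ proj₂ xy′) xy) (IsIso.cod glue xy′)
            where
            xy′ : Glue (λ x y → x ∈ᶠ L × R x y) (λ x y → x ∈ᶠ J × R x y) x _
            xy′ = proj₂ (IsIso.total glue (IsIso.dom iso xy))

      -- Gluing is injective because `σ` and `τ` are recovered by restriction, and surjective
      -- because an automorphism of `L′` maps `L` and `J` onto themselves.
      Aut-product : Extensions.r em K̄ K L′ ≡ Extensions.r em K̄ K L ℕ.* Extensions.r em K̄ K J
      Aut-product = enumerate-product em K̄ (Aut L′ K) (Aut L K) (Aut J K) f
        (λ {σ} {σ′} {τ} {τ′} → f-cong {σ} {σ′} {τ} {τ′}) (λ {σ} {σ′} {τ} {τ′} → f-inj {σ} {σ′} {τ} {τ′}) f-surj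
        (⇒≅ (id-iso L K⊑L)) (⇒≅ (id-iso J K⊑J))
        where
        f-iso : (σ : L ≅[ K ] L) (τ : J ≅[ K ] J) → IsIso L′ L′ (Glue (Graph σ) (Graph τ))
        f-iso σ τ = iso-resp-≑ {E = L′} ≐-refl LJ≑L′ (glued {L} {J} L⊑N J⊑N′ (graph-iso σ K⊑L) (graph-iso τ K⊑J))
        f : L ≅[ K ] L → J ≅[ K ] J → L′ ≅[ K ] L′
        f σ τ = ⇒≅ (f-iso σ τ)
        module Aut E = Setoid (Aut E K)
        graph-mono : ∀ {E} {σ σ′ : E ≅[ K ] E} → Aut._≈_ E σ σ′ → ∀ {x y} → Graph σ x y → Graph σ′ x y
        graph-mono σ≈σ′ (x∈ , lift eq) = x∈ , lift (trans (sym (σ≈σ′ (_ , x∈))) eq)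
        left : ∀ σ τ {x y} → Graph σ x y → Glue (Graph σ) (Graph τ) x y
        left σ τ = glue-left {N} {N′} K⊑N K⊑N′ disjoint {L} {J} {L} {J} L⊑N L⊑N J⊑N′ J⊑N′ K⊑L K⊑J finJ (graph-iso σ K⊑L) (graph-iso τ K⊑J)
        right : ∀ σ τ {x y} → Graph τ x y → Glue (Graph σ) (Graph τ) x y
        right σ τ = glue-right {N} {N′} K⊑N K⊑N′ disjoint {L} {J} {L} {J} L⊑N L⊑N J⊑N′ J⊑N′ K⊑L K⊑J finJ (graph-iso σ K⊑L) (graph-iso τ K⊑J)
        f-cong : ∀ {σ σ′ τ τ′} → Aut._≈_ L σ σ′ → Aut._≈_ J τ τ′ → Aut._≈_ L′ (f σ τ) (f σ′ τ′)
        f-cong {σ} {σ′} {τ} {τ′} σ≈ τ≈ x = IsIso.functional (f-iso σ′ τ′) refl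
          (glue-⊆ (f-iso σ′ τ′) (λ xy → left σ′ τ′ (graph-mono {σ = σ} {σ′} σ≈ xy)) (λ xy → right σ′ τ′ (graph-mono {σ = τ} {τ′} τ≈ xy)) (to-R (f-iso σ τ) x))
          (to-R (f-iso σ′ τ′) x)
        restrict-left : ∀ σ τ (x : El L) → proj₁ (_≅[_]_.to σ x) ≈ proj₁ (_≅[_]_.to (f σ τ) (proj₁ x , L⊑L′ (proj₂ x)))
        restrict-left σ τ x = IsIso.functional (f-iso σ τ) refl
          (left σ τ (graph-to σ x))
          (to-R (f-iso σ τ) (proj₁ x , L⊑L′ (proj₂ x)))
        restrict-right : ∀ σ τ (x : El J) → proj₁ (_≅[_]_.to τ x) ≈ proj₁ (_≅[_]_.to (f σ τ) (proj₁ x , J⊑L′ (proj₂ x)))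
        restrict-right σ τ x = IsIso.functional (f-iso σ τ) refl
          (right σ τ (graph-to τ x))
          (to-R (f-iso σ τ) (proj₁ x , J⊑L′ (proj₂ x)))
        f-inj : ∀ {σ σ′ τ τ′} → Aut._≈_ L′ (f σ τ) (f σ′ τ′) → Aut._≈_ L σ σ′ × Aut._≈_ J τ τ′
        f-inj {σ} {σ′} {τ} {τ′} eq =
          (λ x → trans (restrict-left σ τ x) (trans (eq _) (sym (restrict-left σ′ τ′ x)))) ,
          (λ x → trans (restrict-right σ τ x) (trans (eq _) (sym (restrict-right σ′ τ′ x))))
        f-surj : ∀ φ → ∃[ σ ] ∃[ τ ] Aut._≈_ L′ (f σ τ) φ
        f-surj φ = ⇒≅ σ-iso , ⇒≅ τ-iso , λ x → IsIso.functional iso refl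
          (glue-⊆ iso (λ xy → proj₂ (graph-⇒≅ σ-iso xy)) (λ xy → proj₂ (graph-⇒≅ τ-iso xy)) (to-R (f-iso (⇒≅ σ-iso) (⇒≅ τ-iso)) x))
          (graph-to φ x)
          where
          iso : IsIso L′ L′ (Graph φ)
          iso = graph-iso φ K⊑L′
          -- By normality the image of `L` lies in `N`, thus in `L′ ∩ N = L`. The same argument for
          -- the inverse automorphism shows that all of `L` is reached.
          image-L≑L : image-L iso ≑ L
          image-L≑L = (λ {y} y∈ → ∙-∩-left {L} {J} K⊑L L⊑N K⊑J J⊑N′ (proj₂ LJ≑L′ (image-L⊑ iso {L′} id {y} y∈)) (image-L⊑N iso {y} y∈)) ,
            λ {y} y∈ → let (x , xy) = IsIso.onto iso (L⊑L′ y∈) in x ,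
              ∙-∩-left {L} {J} K⊑L L⊑N K⊑J J⊑N′ (proj₂ LJ≑L′ (IsIso.dom iso xy)) (IsIso.normal-iso (flip-iso iso) {N} normal (L⊑N y∈) xy) , xy
          image-J≑J : image-J iso ≑ J
          image-J≑J = (λ {y} y∈ → ∙-∩-right {L} {J} K⊑L L⊑N K⊑J J⊑N′ (proj₂ LJ≑L′ (image-J⊑ iso {L′} id {y} y∈)) (image-J⊑N′ iso {y} y∈)) ,
            λ {y} y∈ → let (x , xy) = IsIso.onto iso (J⊑L′ y∈) in x ,
              ∙-∩-right {L} {J} K⊑L L⊑N K⊑J J⊑N′ (proj₂ LJ≑L′ (IsIso.dom iso xy)) (IsIso.normal-iso (flip-iso iso) {N′} normal′ (J⊑N′ y∈) xy) , xy
          σ-iso : IsIso L L (λ x y → x ∈ᶠ L × Graph φ x y)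
          σ-iso = iso-resp-≑ {E = L} {F = image-L iso} ≐-refl image-L≑L (restrict-L iso)
          τ-iso : IsIso J J (λ x y → x ∈ᶠ J × Graph φ x y)
          τ-iso = iso-resp-≑ {E = J} {F = image-J iso} ≐-refl image-J≑J (restrict-J iso)

      module _ {M J′ M′ : Subfield} (L⊑M : L ⊑ M) (M⊑N : M ⊑ N) (J⊑J′ : J ⊑ J′) (J′⊑N′ : J′ ⊑ N′) (MJ′≑M′ : M ∙ J′ ≑ M′) where

        private
          K⊑M : K ⊑ M
          K⊑M x∈ = L⊑M (K⊑L x∈)
          K⊑J′ : K ⊑ J′
          K⊑J′ x∈ = J⊑J′ (K⊑J x∈)
          module Copies T E = Setoid (Copies K T E)

        glue-copies : Copies.Carrier M L → Copies.Carrier J′ J → Copies.Carrier M′ L′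
        glue-copies (F₁ , F₁⊑M , σ) (F₂ , F₂⊑J′ , τ) = F₁ ∙ F₂ ,
          (λ x∈ → proj₁ MJ′≑M′ (∙-mono {F₁} {M} {F₂} {J′} F₁⊑M F₂⊑J′ x∈)) ,
          ⇒≅ (glued {F₁} {F₂} (λ x∈ → M⊑N (F₁⊑M x∈)) (λ x∈ → J′⊑N′ (F₂⊑J′ x∈)) (graph-iso σ K⊑L) (graph-iso τ K⊑J))

        glue-copies-surjective : ∀ F → ∃[ A ] ∃[ B ] Copies._≈_ M′ L′ (glue-copies A B) F
        glue-copies-surjective (F , F⊑M′ , φ) =
          (image-L iso , (λ {y} → image-L⊑M {y}) , ⇒≅ (restrict-L iso)) , (image-J iso , (λ {y} → image-J⊑J′ {y}) , ⇒≅ (restrict-J iso)) , images-∙ iso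
          where
          iso : IsIso L′ F (Graph φ)
          iso = graph-iso φ K⊑L′
          image-L⊑M : image-L iso ⊑ M
          image-L⊑M {y} y∈ = ∙-∩-left {M} {J′} K⊑M M⊑N K⊑J′ J′⊑N′ (proj₂ MJ′≑M′ (image-L⊑ iso {M′} F⊑M′ {y} y∈)) (image-L⊑N iso {y} y∈)
          image-J⊑J′ : image-J iso ⊑ J′
          image-J⊑J′ {y} y∈ = ∙-∩-right {M} {J′} K⊑M M⊑N K⊑J′ J′⊑N′ (proj₂ MJ′≑M′ (image-J⊑ iso {M′} F⊑M′ {y} y∈)) (image-J⊑N′ iso {y} y∈)

        copy-K⊑ : ∀ {T E} → K ⊑ E → (A : Copies.Carrier T E) → K ⊑ proj₁ A
        copy-K⊑ K⊑E (F , _ , σ) = iso-K⊑ (graph-iso σ K⊑E)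

        -- A copy determines its two factors as its intersections with `N` and `N′`, so gluing is
        -- injective on copies. `L` and `J` themselves show that both sets of copies are inhabited.
        Copies-product : proj₁ (copies K M′ L′) ≡ proj₁ (copies K M L) ℕ.* proj₁ (copies K J′ J)
        Copies-product = enumerate-product em K̄ (Copies K M′ L′) (Copies K M L) (Copies K J′ J) glue-copies
          (λ { {A} {A′} {B} {B′} → ∙-cong {proj₁ A} {proj₁ A′} {proj₁ B} {proj₁ B′} })
          (λ { {A} {A′} {B} {B′} (⊑ , ⊒) →
            (⊑-left A A′ B B′ ⊑ , ⊑-left A′ A B′ B ⊒) , (⊑-right A A′ B B′ ⊑ , ⊑-right A′ A B′ B ⊒) })
          glue-copies-surjective (L , L⊑M , ⇒≅ (id-iso L K⊑L)) (J , J⊑J′ , ⇒≅ (id-iso J K⊑J))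
          where
          ⊑-left : ∀ (A A′ : Copies.Carrier M L) (B B′ : Copies.Carrier J′ J) → proj₁ A ∙ proj₁ B ⊑ proj₁ A′ ∙ proj₁ B′ → proj₁ A ⊑ proj₁ A′
          ⊑-left A A′ B B′ ⊑ x∈ = ∙-∩-left {proj₁ A′} {proj₁ B′} (copy-K⊑ {M} {L} K⊑L A′) (λ y∈ → M⊑N (proj₁ (proj₂ A′) y∈))
            (copy-K⊑ {J′} {J} K⊑J B′) (λ y∈ → J′⊑N′ (proj₁ (proj₂ B′) y∈)) (⊑ (∙-left {proj₁ A} {proj₁ B} x∈)) (M⊑N (proj₁ (proj₂ A) x∈))
          ⊑-right : ∀ (A A′ : Copies.Carrier M L) (B B′ : Copies.Carrier J′ J) → proj₁ A ∙ proj₁ B ⊑ proj₁ A′ ∙ proj₁ B′ → proj₁ B ⊑ proj₁ B′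
          ⊑-right A A′ B B′ ⊑ x∈ = ∙-∩-right {proj₁ A′} {proj₁ B′} (copy-K⊑ {M} {L} K⊑L A′) (λ y∈ → M⊑N (proj₁ (proj₂ A′) y∈))
            (copy-K⊑ {J′} {J} K⊑J B′) (λ y∈ → J′⊑N′ (proj₁ (proj₂ B′) y∈)) (⊑ (∙-right {proj₁ A} {proj₁ B} x∈)) (J′⊑N′ (proj₁ (proj₂ B) x∈))


  -- Lists of copies, their composita and intersections

  record CopyList (T E : Subfield) {n : ℕ} (Es : Fin n → Subfield) : Set (lsuc p) where
    field
      below    : ∀ i → Es i ⊑ T
      isoTo    : ∀ i → E ≅[ K ] Es i
      complete : ∀ (A : Setoid.Carrier (Copies K T E)) → ∃[ i ] Es i ≑ proj₁ A

  Op : Set (lsuc p)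
  Op = ∀ {n} → (Fin n → Subfield) → Subfield

  Cases : Op → Subfield → Subfield → Set (lsuc p)
  Cases op T E =
    (proj₁ (copies K T E) ≡ 0 × indicium op K T E ≡ 0) ⊎
    (∃[ n ] Σ[ Es ∈ (Fin (suc n) → Subfield) ] CopyList T E Es ×
      proj₁ (copies K T E) ≡ suc n × indicium op K T E ≡ degree K (op Es))

  -- `copies` and `indicium` rest on the same use of excluded middle; splitting on it once ties the
  -- number of copies, their list and the indicium together. The default values fall into the first
  -- case.
  indicium-cases : ∀ (op : Op) T E → Cases op T E
  indicium-cases op T E with em {P = ∃[ n ] Inverse (≡.setoid (Fin n)) (Copies K T E)}
  ... | no _ = inj₁ (≡.refl , ≡.refl)
  ... | yes (zero , inv) = inj₁ (≡.refl , ≡.refl)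
  ... | yes (suc n , inv) = inj₂ (n , proj₁ ∘ Inverse.to inv , record
      { below    = λ i → proj₁ (proj₂ (Inverse.to inv i))
      ; isoTo    = λ i → proj₂ (proj₂ (Inverse.to inv i))
      ; complete = IsEnumeration.covers (inverse⇒enumeration {S = Copies K T E} inv)
      } , ≡.refl , ≡.refl)

  -- Only sets of fields are compared: `E` lists the composita of members of `G` and `H`, in any
  -- order and possibly with repetitions. This determines intersections and composita, and it
  -- survives applying `sep`, under which distinct copies may coincide.
  record Match {k m n} (E : Fin k → Subfield) (G : Fin m → Subfield) (H : Fin n → Subfield) : Set p where
    field
      each : ∀ s → ∃[ i ] ∃[ j ] E s ≑ G i ∙ H j
      hits : ∀ i j → ∃[ s ] E s ≑ G i ∙ H j

  ∏-⊒ : ∀ {n} (G : Fin n → Subfield) i → G i ⊑ ∏ G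
  ∏-⊒ G i x∈ = incl (i , x∈)

  ∏-least : ∀ {n} (G : Fin n → Subfield) F → (∀ i → G i ⊑ F) → ∏ G ⊑ F
  ∏-least G F G⊑F = closure-least F λ { (i , x∈) → G⊑F i x∈ }

  -- A member of one list enters `∏ E` through its compositum with member `zero` of the other, which
  -- is why both lists are nonempty.
  ∏-∙ : ∀ {k m n} {E : Fin k → Subfield} {G : Fin (suc m) → Subfield} {H : Fin (suc n) → Subfield} →
        Match E G H → ∏ E ≑ ∏ G ∙ ∏ H
  ∏-∙ {E = E} {G} {H} match =
    ∏-least E (∏ G ∙ ∏ H) (λ s x∈ → let (i , j , ⊑ , _) = each s in
      ∙-mono {G i} {∏ G} {H j} {∏ H} (∏-⊒ G i) (∏-⊒ H j) (⊑ x∈)) ,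
    ∙-least {∏ G} {∏ H} (∏ E)
      (∏-least G (∏ E) λ i x∈ → let (s , _ , ⊒) = hits i zero in ∏-⊒ E s (⊒ (∙-left {G i} {H zero} x∈)))
      (∏-least H (∏ E) λ j x∈ → let (s , _ , ⊒) = hits zero j in ∏-⊒ E s (⊒ (∙-right {G zero} {H j} x∈)))
    where
    open Match match

  -- Multiplicativity of the capacities and indicia

  module Indicia {N N′ : Subfield} (normal : Normal K N) (normal′ : Normal K N′) (disjoint : LinearlyDisjoint K N N′)
                 {L J L′ M J′ M′ : Subfield} (K⊑L : K ⊑ L) (K⊑J : K ⊑ J) (LJ≑L′ : L ∙ J ≑ L′)
                 (L⊑M : L ⊑ M) (M⊑N : M ⊑ N) (J⊑J′ : J ⊑ J′) (J′⊑N′ : J′ ⊑ N′) (MJ′≑M′ : M ∙ J′ ≑ M′)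
                 (finM : ∃ (Basis K M)) (finJ′ : ∃ (Basis K J′)) where

    private
      K⊑N : K ⊑ N
      K⊑N = proj₁ normal
      K⊑N′ : K ⊑ N′
      K⊑N′ = proj₁ normal′
      L⊑N : L ⊑ N
      L⊑N x∈ = M⊑N (L⊑M x∈)
      J⊑N′ : J ⊑ N′
      J⊑N′ x∈ = J′⊑N′ (J⊑J′ x∈)
      finL : ∃ (Basis K L)
      finL = sub-finite {K} {M} {L} finM L⊑M
      finJ : ∃ (Basis K J)
      finJ = sub-finite {K} {J′} {J} finJ′ J⊑J′
      aL aJ aL′ rL rJ rL′ : ℕ
      aL  = proj₁ (copies K M L)
      aJ  = proj₁ (copies K J′ J)
      aL′ = proj₁ (copies K M′ L′)
      rL  = Extensions.r em K̄ K L
      rJ  = Extensions.r em K̄ K J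
      rL′ = Extensions.r em K̄ K L′

    open Disjoint {N} {N′} K⊑N K⊑N′ disjoint
    open Magnification {N} {N′} normal normal′ disjoint

    Copies-≡ : aL′ ≡ aL ℕ.* aJ
    Copies-≡ = Copies-product {L} {J} {L′} K⊑L L⊑N K⊑J J⊑N′ finJ LJ≑L′ {M} {J′} {M′} L⊑M M⊑N J⊑J′ J′⊑N′ MJ′≑M′

    Aut-≡ : rL′ ≡ rL ℕ.* rJ
    Aut-≡ = Aut-product {L} {J} {L′} K⊑L L⊑N K⊑J J⊑N′ finJ LJ≑L′

    ρ-≡ : aL′ ℕ.* rL′ ≡ (aL ℕ.* rL) ℕ.* (aJ ℕ.* rJ)
    ρ-≡ = ≡.trans (≡.cong₂ ℕ._*_ Copies-≡ Aut-≡) (ℕ.[m*n]*[o*p]≡[m*o]*[n*p] aL aJ rL rJ)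

    degree-nonzero : ∀ E → K ⊑ E → ∃ (Basis K E) → ¬ degree K E ≡ 0
    degree-nonzero E K⊑E (n , B) eq = go n B (≡.trans (≡.sym (degree-≡ B)) eq)
      where
      go : ∀ n → Basis K E n → ¬ n ≡ 0
      go zero B ≡.refl with Basis.spans B (Subfield.1#-closed E)
      ... | _ , _ , 1≈0 = 1≉0 1≈0

    -- [L′ : L′_S] is computed from [L′ : K] = [L′ : L′_S] [L′_S : K] by cancellation.
    sep-degree-≡ : degree (sep K L′) L′ ≡ degree (sep K L) L ℕ.* degree (sep K J) J
    sep-degree-≡ = ≡.trans (degree-cong {sep K L′} {SL ∙ SJ} {L′} {LJ} sepL′≑ (≐-sym LJ≑L′))
      (ℕ.*-cancelʳ-≡ (degree (SL ∙ SJ) LJ) (degree SL L ℕ.* degree SJ J) (degree K (SL ∙ SJ))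
        {{ℕ.≢-nonZero (degree-nonzero (SL ∙ SJ) K⊑SLSJ finSLSJ)}} tower)
      where
      LJ SL SJ : Subfield
      LJ = L ∙ J
      SL = sep K L
      SJ = sep K J
      K⊑SL : K ⊑ SL
      K⊑SL = K⊑sep L K⊑L
      K⊑SJ : K ⊑ SJ
      K⊑SJ = K⊑sep J K⊑J
      SL⊑L : SL ⊑ L
      SL⊑L = sep⊑ L K⊑L
      SJ⊑J : SJ ⊑ J
      SJ⊑J = sep⊑ J K⊑J
      finLJ : ∃ (Basis K LJ)
      finLJ = finite-∙ {L} {J} K⊑L L⊑N K⊑J J⊑N′ finL finJ
      finSL : ∃ (Basis K SL)
      finSL = sub-finite {K} {L} {SL} finL SL⊑L
      finSJ : ∃ (Basis K SJ)
      finSJ = sub-finite {K} {J} {SJ} finJ SJ⊑J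
      K⊑SLSJ : K ⊑ SL ∙ SJ
      K⊑SLSJ x∈ = ∙-left {SL} {SJ} (K⊑SL x∈)
      SLSJ⊑LJ : SL ∙ SJ ⊑ LJ
      SLSJ⊑LJ = ∙-mono {SL} {L} {SJ} {J} SL⊑L SJ⊑J
      finSLSJ : ∃ (Basis K (SL ∙ SJ))
      finSLSJ = sub-finite {K} {LJ} {SL ∙ SJ} finLJ SLSJ⊑LJ
      sepL′≑ : sep K L′ ≑ SL ∙ SJ
      sepL′≑ = ≐-trans (largest-cong {Separable K} {L′} {LJ} (≐-sym LJ≑L′)) (sep-compositum L J K⊑L K⊑J finL finJ finLJ)

      tower : degree (SL ∙ SJ) LJ ℕ.* degree K (SL ∙ SJ) ≡ degree SL L ℕ.* degree SJ J ℕ.* degree K (SL ∙ SJ)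
      tower = ≡R.begin
        degree (SL ∙ SJ) LJ ℕ.* degree K (SL ∙ SJ)                     ≡R.≡⟨ degree-tower {K} {SL ∙ SJ} {LJ} K⊑SLSJ SLSJ⊑LJ finLJ ⟨
        degree K LJ                                                    ≡R.≡⟨ degree-∙ {L} {J} K⊑L L⊑N K⊑J J⊑N′ finL finJ ⟩
        degree K L ℕ.* degree K J                                      ≡R.≡⟨ ≡.cong₂ ℕ._*_ (degree-tower {K} {SL} {L} K⊑SL SL⊑L finL) (degree-tower {K} {SJ} {J} K⊑SJ SJ⊑J finJ) ⟩
        degree SL L ℕ.* degree K SL ℕ.* (degree SJ J ℕ.* degree K SJ)  ≡R.≡⟨ ℕ.[m*n]*[o*p]≡[m*o]*[n*p] (degree SL L) (degree K SL) (degree SJ J) (degree K SJ) ⟩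
        degree SL L ℕ.* degree SJ J ℕ.* (degree K SL ℕ.* degree K SJ)  ≡R.≡⟨ ≡.cong (degree SL L ℕ.* degree SJ J ℕ.*_)
          (degree-∙ {SL} {SJ} K⊑SL (λ x∈ → L⊑N (SL⊑L x∈)) K⊑SJ (λ x∈ → J⊑N′ (SJ⊑J x∈)) finSL finSJ) ⟨
        degree SL L ℕ.* degree SJ J ℕ.* degree K (SL ∙ SJ)             ≡R.∎

    Λ-≡ : aL′ ℕ.* (degree (sep K L′) L′ ℕ.* rL′) ≡
          (aL ℕ.* (degree (sep K L) L ℕ.* rL)) ℕ.* (aJ ℕ.* (degree (sep K J) J ℕ.* rJ))
    Λ-≡ = ≡.trans (≡.cong₂ ℕ._*_ Copies-≡ (≡.trans (≡.cong₂ ℕ._*_ sep-degree-≡ Aut-≡)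
            (ℕ.[m*n]*[o*p]≡[m*o]*[n*p] (degree (sep K L) L) (degree (sep K J) J) rL rJ)))
          (ℕ.[m*n]*[o*p]≡[m*o]*[n*p] aL aJ (degree (sep K L) L ℕ.* rL) (degree (sep K J) J ℕ.* rJ))

    Inside : ∀ {n} → Subfield → (Fin n → Subfield) → Set p
    Inside T G = ∀ i → K ⊑ G i × G i ⊑ T

    ⋂-∙ : ∀ {k m n} {E : Fin k → Subfield} {G : Fin (suc m) → Subfield} {H : Fin (suc n) → Subfield} →
          Match E G H → Inside M G → Inside J′ H → ⋂ E ≑ ⋂ G ∙ ⋂ H
    ⋂-∙ {E = E} {G} {H} match G-in H-in = ⊑ , ∙-least {⋂ G} {⋂ H} (⋂ E)
        (λ x∈ s → let (i , j , _ , ⊒) = each s in ⊒ (∙-left {G i} {H j} (x∈ i)))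
        (λ x∈ s → let (i , j , _ , ⊒) = each s in ⊒ (∙-right {G i} {H j} (x∈ j)))
      where
      open Match match
      ⊑ : ⋂ E ⊑ ⋂ G ∙ ⋂ H
      -- The expansions take place in `G zero` and `H zero`. The family is indexed by all pairs of
      -- indices, and those with one entry `zero` put an element into every `G i` or every `H j`.
      ⊑ {x} x∈ = ∙-∩ {G zero} {H zero} {⋂ G} {⋂ H} (proj₁ (G-in zero)) (λ y∈ → M⊑N (proj₂ (G-in zero) y∈))
        (proj₁ (H-in zero)) (λ y∈ → J′⊑N′ (proj₂ (H-in zero) y∈)) (λ y∈ i → proj₁ (G-in i) y∈) (λ y∈ → y∈ zero)
        (sub-finite {K} {M} {G zero} finM (proj₂ (G-in zero))) (sub-finite {K} {J′} {H zero} finJ′ (proj₂ (H-in zero)))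
        (λ s → G (proj₁ s)) (λ s → H (proj₂ s))
        (λ s → proj₁ (G-in (proj₁ s))) (λ s y∈ → M⊑N (proj₂ (G-in (proj₁ s)) y∈))
        (λ s → proj₁ (H-in (proj₂ s))) (λ s y∈ → J′⊑N′ (proj₂ (H-in (proj₂ s)) y∈))
        (λ _ y∈ i → y∈ (i , zero)) (λ _ y∈ j → y∈ (zero , j))
        (in-∙ zero zero) (λ s → in-∙ (proj₁ s) (proj₂ s))
        where
        in-∙ : ∀ i j → x ∈ᶠ G i ∙ H j
        in-∙ i j = let (s , ⊑ , _) = hits i j in ⊑ (x∈ s)

    degree-product : ∀ {E A B} → E ≑ A ∙ B → K ⊑ A → A ⊑ M → K ⊑ B → B ⊑ J′ → degree K E ≡ degree K A ℕ.* degree K B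
    degree-product {E} {A} {B} E≑ K⊑A A⊑M K⊑B B⊑J′ = ≡.trans (degree-cong {K} {K} {E} {A ∙ B} ≐-refl E≑)
      (degree-∙ {A} {B} K⊑A (λ x∈ → M⊑N (A⊑M x∈)) K⊑B (λ x∈ → J′⊑N′ (B⊑J′ x∈)) (sub-finite {K} {M} {A} finM A⊑M) (sub-finite {K} {J′} {B} finJ′ B⊑J′))

    Multiplicative : Op → Set (lsuc p)
    Multiplicative op = ∀ {k m n} {E : Fin (suc k) → Subfield} {G : Fin (suc m) → Subfield} {H : Fin (suc n) → Subfield} →
      Match E G H → Inside M G → Inside J′ H → degree K (op E) ≡ degree K (op G) ℕ.* degree K (op H)

    copies-match : ∀ {k m n} {E : Fin k → Subfield} {G : Fin m → Subfield} {H : Fin n → Subfield} →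
                   CopyList M′ L′ E → CopyList M L G → CopyList J′ J H → Match E G H
    copies-match {E = E} {G} {H} CE CG CH = record { each = each ; hits = hits }
      where
      module CE = CopyList CE
      module CG = CopyList CG
      module CH = CopyList CH
      each : ∀ s → ∃[ i ] ∃[ j ] E s ≑ G i ∙ H j
      each s = go (glue-copies-surjective {L} {J} {L′} K⊑L L⊑N K⊑J J⊑N′ finJ LJ≑L′ {M} {J′} {M′} L⊑M M⊑N J⊑J′ J′⊑N′ MJ′≑M′ (E s , CE.below s , CE.isoTo s))
        where
        go : (∃[ A ] ∃[ B ] proj₁ A ∙ proj₁ B ≑ E s) → ∃[ i ] ∃[ j ] E s ≑ G i ∙ H j
        go (A , B , AB≑E) = let (i , Gi≑A) = CG.complete A ; (j , Hj≑B) = CH.complete B in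
          i , j , ≐-trans (≐-sym AB≑E) (∙-cong {proj₁ A} {G i} {proj₁ B} {H j} (≐-sym Gi≑A) (≐-sym Hj≑B))
      hits : ∀ i j → ∃[ s ] E s ≑ G i ∙ H j
      hits i j = CE.complete (glue-copies {L} {J} {L′} K⊑L L⊑N K⊑J J⊑N′ finJ LJ≑L′ {M} {J′} {M′} L⊑M M⊑N J⊑J′ J′⊑N′ MJ′≑M′
        (G i , CG.below i , CG.isoTo i) (H j , CH.below j , CH.isoTo j))

    copies-inside : ∀ {T E n} {G : Fin n → Subfield} → K ⊑ E → CopyList T E G → Inside T G
    copies-inside K⊑E list i = iso-K⊑ (graph-iso (CopyList.isoTo list i) K⊑E) , CopyList.below list i

    -- By `Copies-≡` the list for `L′` is empty exactly when one of the other two is. Then both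
    -- sides are zero, and every other mixture of cases is contradictory.
    indicium-product : (op : Op) → Multiplicative op → indicium op K M′ L′ ≡ indicium op K M L ℕ.* indicium op K J′ J
    indicium-product op multiplicative = go (indicium-cases op M′ L′) (indicium-cases op M L) (indicium-cases op J′ J)
      where
      go : Cases op M′ L′ → Cases op M L → Cases op J′ J → indicium op K M′ L′ ≡ indicium op K M L ℕ.* indicium op K J′ J
      go (inj₁ (_ , ι≡0)) (inj₁ (_ , ι₁≡0)) _ = ≡.trans ι≡0 (≡.sym (≡.cong (ℕ._* indicium op K J′ J) ι₁≡0))
      go (inj₁ (_ , ι≡0)) _ (inj₁ (_ , ι₂≡0)) = ≡.trans ι≡0 (≡.sym (≡.trans (≡.cong (indicium op K M L ℕ.*_) ι₂≡0) (ℕ.*-zeroʳ (indicium op K M L))))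
      go (inj₁ (a≡0 , _)) (inj₂ (m , _ , _ , a₁≡ , _)) (inj₂ (n , _ , _ , a₂≡ , _)) =
        contradiction (≡.trans (≡.sym a≡0) (≡.trans Copies-≡ (≡.cong₂ ℕ._*_ a₁≡ a₂≡))) λ ()
      go (inj₂ (_ , _ , _ , a≡ , _)) (inj₁ (a₁≡0 , _)) _ =
        contradiction (≡.trans (≡.sym a≡) (≡.trans Copies-≡ (≡.cong (ℕ._* aJ) a₁≡0))) λ ()
      go (inj₂ (_ , _ , _ , a≡ , _)) (inj₂ _) (inj₁ (a₂≡0 , _)) =
        contradiction (≡.trans (≡.sym a≡) (≡.trans Copies-≡ (≡.trans (≡.cong (aL ℕ.*_) a₂≡0) (ℕ.*-zeroʳ aL)))) λ ()
      go (inj₂ (_ , E , CE , _ , ι≡)) (inj₂ (_ , G , CG , _ , ι₁≡)) (inj₂ (_ , H , CH , _ , ι₂≡)) =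
        ≡.trans ι≡ (≡.trans (multiplicative {E = E} {G} {H} (copies-match CE CG CH) (copies-inside {M} {L} K⊑L CG) (copies-inside {J′} {J} K⊑J CH))
          (≡.sym (≡.cong₂ ℕ._*_ ι₁≡ ι₂≡)))

    K⊑∏ : ∀ {n T} (G : Fin (suc n) → Subfield) → Inside T G → K ⊑ ∏ G
    K⊑∏ G G-in x∈ = ∏-⊒ G zero (proj₁ (G-in zero) x∈)

    ∏⊑ : ∀ {n} T (G : Fin n → Subfield) → Inside T G → ∏ G ⊑ T
    ∏⊑ T G G-in = ∏-least G T (λ i → proj₂ (G-in i))

    sep-inside : ∀ {n T} (G : Fin n → Subfield) → Inside T G → Inside T (λ i → sep K (G i))
    sep-inside G G-in i = K⊑sep (G i) (proj₁ (G-in i)) , λ x∈ → proj₂ (G-in i) (sep⊑ (G i) (proj₁ (G-in i)) x∈)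

    sep-match : ∀ {k m n} {E : Fin k → Subfield} {G : Fin m → Subfield} {H : Fin n → Subfield} → Match E G H →
                Inside M G → Inside J′ H → Match (λ s → sep K (E s)) (λ i → sep K (G i)) (λ j → sep K (H j))
    sep-match {E = E} {G} {H} match G-in H-in = record
      { each = λ s → let (i , j , eq) = each s in i , j , sep-≑ s i j eq
      ; hits = λ i j → let (s , eq) = hits i j in s , sep-≑ s i j eq }
      where
      open Match match
      sep-≑ : ∀ s i j → E s ≑ G i ∙ H j → sep K (E s) ≑ sep K (G i) ∙ sep K (H j)
      sep-≑ s i j eq = ≐-trans (largest-cong {Separable K} {E s} {G i ∙ H j} eq)
        (sep-compositum (G i) (H j) (proj₁ (G-in i)) (proj₁ (H-in j)) finG finH
          (finite-∙ {G i} {H j} (proj₁ (G-in i)) (λ x∈ → M⊑N (proj₂ (G-in i) x∈)) (proj₁ (H-in j)) (λ x∈ → J′⊑N′ (proj₂ (H-in j) x∈)) finG finH))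
        where
        finG : ∃ (Basis K (G i))
        finG = sub-finite {K} {M} {G i} finM (proj₂ (G-in i))
        finH : ∃ (Basis K (H j))
        finH = sub-finite {K} {J′} {H j} finJ′ (proj₂ (H-in j))

    ⋂-multiplicative : Multiplicative ⋂
    ⋂-multiplicative {E = E} {G} {H} match G-in H-in = degree-product {⋂ E} {⋂ G} {⋂ H} (⋂-∙ {E = E} {G} {H} match G-in H-in)
      (λ x∈ i → proj₁ (G-in i) x∈) (λ x∈ → proj₂ (G-in zero) (x∈ zero)) (λ x∈ j → proj₁ (H-in j) x∈) (λ x∈ → proj₂ (H-in zero) (x∈ zero))

    ∏-multiplicative : Multiplicative ∏
    ∏-multiplicative {E = E} {G} {H} match G-in H-in = degree-product {∏ E} {∏ G} {∏ H} (∏-∙ {E = E} {G} {H} match)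
      (K⊑∏ {T = M} G G-in) (∏⊑ M G G-in) (K⊑∏ {T = J′} H H-in) (∏⊑ J′ H H-in)

    sep-multiplicative : ∀ {op : Op} → Multiplicative op → Multiplicative (λ Es → op (λ i → sep K (Es i)))
    sep-multiplicative {op} multiplicative {E = E} {G} {H} match G-in H-in =
      multiplicative {E = λ s → sep K (E s)} {λ i → sep K (G i)} {λ j → sep K (H j)} (sep-match {E = E} {G} {H} match G-in H-in)
        (sep-inside {T = M} G G-in) (sep-inside {T = J′} H H-in)

    insep-∏-multiplicative : Multiplicative (λ Es → insep K (∏ Es))
    insep-∏-multiplicative {E = E} {G} {H} match G-in H-in = degree-product {insep K (∏ E)} {insep K (∏ G)} {insep K (∏ H)}
      (≐-trans (largest-cong {PurelyInseparable K} {∏ E} {∏ G ∙ ∏ H} (∏-∙ {E = E} {G} {H} match))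
        (insep-compositum {N} {N′} normal normal′ disjoint (∏ G) (∏ H) K⊑∏G (λ x∈ → M⊑N (∏G⊑M x∈)) K⊑∏H (λ x∈ → J′⊑N′ (∏H⊑J′ x∈))
          (sub-finite {K} {M} {∏ G} finM ∏G⊑M) (sub-finite {K} {J′} {∏ H} finJ′ ∏H⊑J′)))
      (K⊑insep (∏ G) K⊑∏G) (λ x∈ → ∏G⊑M (insep⊑ (∏ G) K⊑∏G x∈)) (K⊑insep (∏ H) K⊑∏H) (λ x∈ → ∏H⊑J′ (insep⊑ (∏ H) K⊑∏H x∈))
      where
      K⊑∏G : K ⊑ ∏ G
      K⊑∏G = K⊑∏ {T = M} G G-in
      ∏G⊑M : ∏ G ⊑ M
      ∏G⊑M = ∏⊑ M G G-in
      K⊑∏H : K ⊑ ∏ H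
      K⊑∏H = K⊑∏ {T = J′} H H-in
      ∏H⊑J′ : ∏ H ⊑ J′
      ∏H⊑J′ = ∏⊑ J′ H H-in

open import Data.Nat.Base using (_*_)

proposition3p8 : (em : ∀ {a : Level} → ExcludedMiddle a) →
    ∀ {c ℓ₁ ℓ₂} (K̄ : HeytingField c ℓ₁ ℓ₂) →
    let open Extensions em K̄ in
    (K L L′ M M′ J J′ : Subfield) →
    IsAlgebraicClosure K →
    FiniteExtension K L′ →
    FiniteExtension K M′ →
    L′ ⊑ M′ →
    GeneralNormalMagnification K M′ M J′ →
    GeneralNormalMagnification K L′ L J →
    L ⊑ M →
    J ⊑ J′ →
    ((ρ K M′ L′ ≡ ρ K M L * ρ K J′ J) × (Λ K M′ L′ ≡ Λ K M L * Λ K J′ J))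
    × ((τ K M′ L′ ≡ τ K M L * τ K J′ J) × (α K M′ L′ ≡ α K M L * α K J′ J))
    × ((γ K M′ L′ ≡ γ K M L * γ K J′ J) × (Γ K M′ L′ ≡ Γ K M L * Γ K J′ J)
    × (ι K M′ L′ ≡ ι K M L * ι K J′ J))
proposition3p8 em K̄ K L L′ M M′ J J′ ac _ _ _ mag′ mag L⊑M J⊑J′ =
  (ρ-≡ , Λ-≡) ,
  (indicium-product (λ Es → ⋂ (λ i → sep K (Es i))) (sep-multiplicative {⋂} ⋂-multiplicative) ,
   indicium-product ⋂ ⋂-multiplicative) ,
  (indicium-product (λ Es → ∏ (λ i → sep K (Es i))) (sep-multiplicative {∏} ∏-multiplicative) ,
   indicium-product ∏ ∏-multiplicative ,
   indicium-product (λ Es → insep K (∏ Es)) insep-∏-multiplicative)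
  where
  open Extensions em K̄
  module Mag′ = GeneralNormalMagnification mag′
  module Mag  = GeneralNormalMagnification mag
  open FieldTheory em K̄ using (sub-finite)
  open BaseField em K̄ K ac using (module Indicia)
  -- One disjoint pair, the normal closures of `M` and `J′`, serves both magnifications, since `L`
  -- and `J` lie in `M` and `J′`.
  open Indicia {Mag′.L~} {Mag′.J~} (NormalClosure.normal Mag′.closure-L) (NormalClosure.normal Mag′.closure-J) Mag′.disjoint
    {L} {J} {L′} {M} {J′} {M′} Mag.K⊑L (proj₁ Mag.finite-J) Mag.generates
    L⊑M (NormalClosure.contains Mag′.closure-L) J⊑J′ (NormalClosure.contains Mag′.closure-J) Mag′.generates
    (sub-finite {K} {M′} {M} (proj₂ Mag′.finite-M) Mag′.L⊑M) (proj₂ Mag′.finite-J)
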